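{- Let $\beta>0$ be a sufficiently small fixed constant, let $n$ be a sufficiently large integer, and let $G$ be an $n$-vertex graph with $\delta(G)\ge (n+1)/2$. Suppose that (1) $G$ has no vertex-cut of size at most $5\beta n$, and (2) there is no partition $V_1\cup V_2$ of $V(G)$ with $|V_1|\ge (1/2-7\beta)n$ and $\Delta(G[V_1])\le \beta n$. Then $G$ has a spanning Halin subgraph.
   Context: A homeomorphically irreducible tree (HIT) is a tree with no vertex of degree 2. A Halin graph is obtained from a HIT with at least 4 vertices embedded in the plane by connecting its leaves into a cycle following the cyclic order determined by the embedding. A spanning Halin subgraph of $G$ is a Halin subgraph of $G$ with vertex set $V(G)$. -}

module Defs where

open import Data.Nat using (ℕ; zero; suc; _+_; _<_; _≤_; _<?_)
open import Data.Bool using (Bool; true; false; _∧_; T)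
open import Data.Fin using (Fin; zero; suc; toℕ; fromℕ<)
open import Data.Fin.Subset using (Subset; _∈_; _∉_; ∣_∣)
open import Data.List using (List; map)
open import Data.List.Base using (allFin)
open import Data.Vec using (Vec; lookup)
open import Data.Product using (Σ; _×_; _,_; proj₁; proj₂; ∃)
open import Data.Sum using (_⊎_)
open import Data.Unit using (⊤)
open import Data.Integer using (+_)
open import Data.Rational using (ℚ; _/_; _*_; _-_; ½)
import Data.Rational as Q
open import Function.Definitions using (Injective)
open import Relation.Nullary using (¬_; yes; no)
open import Relation.Binary.PropositionalEquality using (_≡_; _≢_)

record Graph (n : ℕ) : Set where
  field
    adj    : Fin n → Fin n → Bool
    sym    : ∀ u v → adj u v ≡ adj v u
    irrefl : ∀ v → adj v v ≡ false
open Graph public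

Adj : ∀ {n} → Graph n → Fin n → Fin n → Set
Adj G u v = T (adj G u v)

countTrue : List Bool → ℕ
countTrue List.[] = 0
countTrue (true List.∷ bs) = suc (countTrue bs)
countTrue (false List.∷ bs) = countTrue bs

deg : ∀ {n} → Graph n → Fin n → ℕ
deg {n} G v = countTrue (map (adj G v) (allFin n))

degIn : ∀ {n} → Graph n → Subset n → Fin n → ℕ
degIn {n} G S v = countTrue (map (λ u → adj G v u ∧ lookup S u) (allFin n))

data Walk {n} (G : Graph n) (P : Fin n → Set) : Fin n → Fin n → Set where
  here : ∀ {u} → P u → Walk G P u u
  step : ∀ {u w v} → P u → Adj G u w → Walk G P w v → Walk G P u v

Connected : ∀ {n} → Graph n → Set
Connected {n} G = ∀ (u v : Fin n) → Walk G (λ _ → ⊤) u v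

IsVertexCut : ∀ {n} → Graph n → Subset n → Set
IsVertexCut {n} G S =
  Σ (Fin n) λ u → Σ (Fin n) λ v → u ∉ S × v ∉ S × ¬ Walk G (λ x → x ∉ S) u v

csuc : ∀ {m} → Fin m → Fin m
csuc {suc m} i with suc (toℕ i) <? suc m
... | yes p = fromℕ< p
... | no _  = zero

HasCycle : ∀ {n} → Graph n → Set
HasCycle {n} G = Σ ℕ λ k → Σ (Fin (3 + k) → Fin n) λ c →
  Injective _≡_ _≡_ c × (∀ i → Adj G (c i) (c (csuc i)))

IsTree : ∀ {n} → Graph n → Set
IsTree G = Connected G × ¬ HasCycle G

IsHIT : ∀ {n} → Graph n → Set
IsHIT {n} Tr = IsTree Tr × (∀ (v : Fin n) → deg Tr v ≢ 2)

IsLeaf : ∀ {n} → Graph n → Fin n → Set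
IsLeaf Tr v = deg Tr v ≡ 1

-- plane embeddings of a tree, as rotation systems (combinatorial
-- embeddings): at every vertex v a cyclic permutation σ v of N(v).

iter : ∀ {A : Set} → (A → A) → ℕ → A → A
iter f zero x = x
iter f (suc k) x = f (iter f k x)

record Rotation {n} (Tr : Graph n) : Set where
  field
    σ      : Fin n → Fin n → Fin n
    closed : ∀ v u → Adj Tr v u → Adj Tr v (σ v u)
    cyclic : ∀ v u w → Adj Tr v u → Adj Tr v w → ∃ λ k → iter (σ v) k u ≡ w
open Rotation public

Dart : ℕ → Set
Dart n = Fin n × Fin n

-- face-tracing: the dart (u,v) is followed by (v, σ_v(u))
nextDart : ∀ {n} {Tr : Graph n} → Rotation Tr → Dart n → Dart n
nextDart ρ (u , v) = v , σ ρ v u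

-- b is the leaf following leaf a in the cyclic order of the leaves
-- determined by the embedding (the order in which the boundary walk of
-- the unique face visits the leaves)
NextLeaf : ∀ {n} {Tr : Graph n} → Rotation Tr → Fin n → Fin n → Set
NextLeaf {n} {Tr} ρ a b =
  IsLeaf Tr a × IsLeaf Tr b ×
  Σ (Dart n) λ d → Adj Tr (proj₁ d) (proj₂ d) × proj₂ d ≡ a ×
  Σ ℕ λ j → 1 ≤ j × proj₂ (iter (nextDart ρ) j d) ≡ b ×
  (∀ i → 1 ≤ i → i < j → ¬ IsLeaf Tr (proj₂ (iter (nextDart ρ) i d)))

-- H is a Halin graph: H = T ∪ C for a HIT T with ≥ 4 vertices (spanning
-- V(H)) with a plane embedding, and C the cycle through the leaves of T
-- in the cyclic order determined by the embedding
IsHalin : ∀ {n} → Graph n → Set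
IsHalin {n} H = 4 ≤ n × Σ (Graph n) λ Tr → IsHIT Tr × Σ (Rotation Tr) λ ρ →
  ∀ (u v : Fin n) →
    (Adj H u v → Adj Tr u v ⊎ NextLeaf ρ u v ⊎ NextLeaf ρ v u) ×
    (Adj Tr u v ⊎ NextLeaf ρ u v ⊎ NextLeaf ρ v u → Adj H u v)

HasSpanningHalin : ∀ {n} → Graph n → Set
HasSpanningHalin {n} G = Σ (Graph n) λ H →
  (∀ (u v : Fin n) → Adj H u v → Adj G u v) × IsHalin H

ℕ→ℚ : ℕ → ℚ
ℕ→ℚ k = + k / 1

NoSmallCut : ∀ {n} → ℚ → Graph n → Set
NoSmallCut {n} β G =
  ¬ (Σ (Subset n) λ S → ℕ→ℚ ∣ S ∣ Q.≤ ℕ→ℚ 5 * β * ℕ→ℚ n × IsVertexCut G S)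

NoSparsePart : ∀ {n} → ℚ → Graph n → Set
NoSparsePart {n} β G =
  ¬ (Σ (Subset n) λ V₁ →
      (½ - ℕ→ℚ 7 * β) * ℕ→ℚ n Q.≤ ℕ→ℚ ∣ V₁ ∣ ×
      (∀ v → v ∈ V₁ → ℕ→ℚ (degIn G V₁ v) Q.≤ β * ℕ→ℚ n))

{-# OPTIONS --safe #-}
-- A ladder is a sequence of rungs in which consecutive rungs are joined by a matching.  A ladder covering all
-- vertices but a few, closed up at both ends by triangles, is a Halin graph: its tree is the caterpillar whose
-- spine is one row, and the other row together with the extra vertices at the ends is the cycle of leaves.
--
-- Replacing β by a smaller 1/b, either any two vertex sets of size about n/2 have n²/g edges between them, or the
-- second hypothesis forces G to consist of two almost complete halves.
--
-- In the first case cover all but few vertices by disjoint copies ("tiles") of K_{t,t}.  This is possible for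
-- constant t: if many vertices are uncovered, their degrees force many of them to have many neighbours on both
-- sides of some tile, and by pigeonhole the tile can be replaced by smaller tiles covering more.  By expansion any
-- two rungs are connected by a short ladder through the tiles, so the tiles can be strung together.  The remaining
-- vertices are absorbed in pairs w, w': by expansion there are q and a tile such that w can take the place of q in
-- its tile, while q and w' fit opposite sides of the other one.
--
-- In the second case the same argument gives a spanning ladder of each half.  As G has no small vertex cut there are
-- disjoint edges between the halves, two of which join the ladders and one of which closes the cycle of leaves.

module Submission where

module SpanningHalin where

  open import Defs renaming (sym to adj-sym; irrefl to adj-irrefl)
  open import Data.Nat hiding (_/_)
  open import Data.Nat.Properties
  open import Data.Bool using (Bool; true; false; T; not; _∧_; _∨_; if_then_else_)
  open import Data.Bool.Properties using (T?; ∧-identityʳ; ∧-zeroʳ; ∧-comm; ∨-comm)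
  open import Data.Fin using (Fin)
  import Data.Fin as Fin
  open import Data.Fin.Properties using (toℕ-fromℕ<; toℕ-injective; toℕ-fromℕ; toℕ-inject₁; toℕ<n)
  open import Data.Nat.Divisibility using (_∣_; ∣1⇒≡1; ∣m+n∣m⇒∣n; ∣-refl; ∣m∣n⇒∣m+n; divides)
  open import Data.List hiding (last; head; tail; fromMaybe; lookup; allFin; all; any)
  import Data.List as L
  open import Data.List.Properties
  open import Data.List.Relation.Unary.All as All using (All; []; _∷_)
  open import Data.List.Relation.Unary.All.Properties using () renaming (++⁺ to ++⁺ᴬ)
  open import Data.List.Relation.Unary.Any using (here; there)
  open import Data.List.Relation.Unary.AllPairs using ([]; _∷_)
  open import Data.List.Relation.Unary.Unique.Propositional using (Unique)
  open import Data.List.Membership.Propositional using (_∈_; _∉_)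
  open import Data.List.Membership.Propositional.Properties using (∈-++⁺ˡ; ∈-++⁺ʳ; ∈-++⁻; ∈-∃++; ∈-upTo⁺; ∈-allFin)
  open import Data.Product using (Σ; ∃; _×_; _,_; proj₁; proj₂)
  open import Data.Sum using (_⊎_; inj₁; inj₂)
  open import Data.Empty using (⊥; ⊥-elim)
  open import Data.Unit using (⊤; tt)
  open import Function using (_∘_; id)
  open import Relation.Nullary using (¬_; Dec; yes; no; does)
  open import Relation.Binary.PropositionalEquality hiding ([_])
  open import Data.List.Relation.Binary.Permutation.Propositional using (_↭_; ↭-refl; ↭-sym; prep; swap; ↭-reflexive)
    renaming (refl to ↭refl; trans to ↭tr)
  open import Data.List.Relation.Binary.Permutation.Propositional.Properties
    using (++-commutativeMonoid; ↭-length; ∈-resp-↭; All-resp-↭; ++⁺; ++⁺ˡ; ++⁺ʳ; shift; ++-comm)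
  open import Data.Nat.Tactic.RingSolver using (solve; solve-∀)
  import Algebra.Solver.CommutativeMonoid as CMS
  open import Data.List.Relation.Unary.Unique.Propositional.Properties using (allFin⁺)
  open import Relation.Binary.Definitions using (tri<; tri≈; tri>)
  open import Data.Nat.DivMod using (_/_; m/n*n≤m; m≡m%n+[m/n]*n; m%n<n; m*n/n≡m; /-monoˡ-≤)
  open import Data.Fin.Subset.Properties using (anySubset?)
  import Data.Vec as Vec
  open import Data.Vec.Properties using (lookup∘tabulate; []=⇒lookup; lookup⇒[]=)
  open import Relation.Nullary.Decidable using (_×-dec_)
  open import Data.Fin.Subset using (Subset)
  import Data.Fin.Subset as Sub
  open import Data.Rational using (ℚ; 0ℚ; ½)
  import Data.Rational as Q
  import Data.Rational.Properties as QP
  import Data.Rational.Unnormalised as QU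
  import Data.Rational.Unnormalised.Properties as QUP
  import Data.Rational.Solver as QSolver
  module QS = QSolver.+-*-Solver
  import Data.Integer as ℤ
  import Data.Integer.Properties as ℤP
  import Data.Integer.Tactic.RingSolver as ℤRing

  -- Sums and counting over lists

  module PS {A : Set} = CMS (++-commutativeMonoid {A = A})
  open PS using (_⊕_; _⊜_) renaming (solve to psolve) public

  private variable 𝔸 𝔹 : Set

  -- A Farkas certificate: a ≤ b collects the hypotheses with their multipliers, and s is the slack.
  linear : ∀ {L R a b} s → a ≤ b → L + b + s ≡ R + a → L ≤ R
  linear {L} {R} {a} {b} s p q = +-cancelʳ-≤ a L R (≤-trans (+-monoʳ-≤ L p) (≤-trans (m≤m+n (L + b) s) (≤-reflexive q)))

  <-or-≥ : ∀ m n → m < n ⊎ n ≤ m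
  <-or-≥ m n with m <? n
  ... | yes p = inj₁ p
  ... | no p = inj₂ (≮⇒≥ p)

  b2n : Bool → ℕ
  b2n true = 1
  b2n false = 0

  ∑ : (𝔸 → ℕ) → List 𝔸 → ℕ
  ∑ f [] = 0
  ∑ f (x ∷ xs) = f x + ∑ f xs

  ∑-++ : ∀ (f : 𝔸 → ℕ) xs ys → ∑ f (xs ++ ys) ≡ ∑ f xs + ∑ f ys
  ∑-++ f [] ys = refl
  ∑-++ f (x ∷ xs) ys = trans (cong (f x +_) (∑-++ f xs ys)) (sym (+-assoc (f x) _ _))

  ∑-↭ : ∀ (f : 𝔸 → ℕ) {xs ys} → xs ↭ ys → ∑ f xs ≡ ∑ f ys
  ∑-↭ f ↭refl = refl
  ∑-↭ f (prep x p) = cong (f x +_) (∑-↭ f p)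
  ∑-↭ f (swap {xs} {ys} x y p) = begin
    f x + (f y + ∑ f xs) ≡⟨ cong (λ s → f x + (f y + s)) (∑-↭ f p) ⟩
    f x + (f y + ∑ f ys) ≡⟨ +-assoc (f x) (f y) _ ⟨
    f x + f y + ∑ f ys   ≡⟨ cong (_+ ∑ f ys) (+-comm (f x) (f y)) ⟩
    f y + f x + ∑ f ys   ≡⟨ +-assoc (f y) (f x) _ ⟩
    f y + (f x + ∑ f ys) ∎ where open ≡-Reasoning
  ∑-↭ f (↭tr p q) = trans (∑-↭ f p) (∑-↭ f q)

  ∑-mono : ∀ {f g : 𝔸 → ℕ} xs → (∀ {x} → x ∈ xs → f x ≤ g x) → ∑ f xs ≤ ∑ g xs
  ∑-mono [] h = z≤n
  ∑-mono (x ∷ xs) h = +-mono-≤ (h (here refl)) (∑-mono xs (h ∘ there))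

  ∑-cong : ∀ {f g : 𝔸 → ℕ} xs → (∀ x → f x ≡ g x) → ∑ f xs ≡ ∑ g xs
  ∑-cong [] h = refl
  ∑-cong (x ∷ xs) h = cong₂ _+_ (h x) (∑-cong xs h)

  ∑-+ : ∀ (f g : 𝔸 → ℕ) xs → ∑ (λ x → f x + g x) xs ≡ ∑ f xs + ∑ g xs
  ∑-+ f g [] = refl
  ∑-+ f g (x ∷ xs) rewrite ∑-+ f g xs = eq (f x) (g x) (∑ f xs) (∑ g xs)
    where
    eq : ∀ a b c d → a + b + (c + d) ≡ a + c + (b + d)
    eq = solve-∀

  ∑-* : ∀ k (f : 𝔸 → ℕ) xs → ∑ (λ x → k * f x) xs ≡ k * ∑ f xs
  ∑-* k f [] = sym (*-zeroʳ k)
  ∑-* k f (x ∷ xs) rewrite ∑-* k f xs = sym (*-distribˡ-+ k (f x) (∑ f xs))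

  ∑-const : ∀ k (xs : List 𝔸) → ∑ (λ _ → k) xs ≡ k * length xs
  ∑-const k [] = sym (*-zeroʳ k)
  ∑-const k (x ∷ xs) rewrite ∑-const k xs = sym (*-suc k (length xs))

  ∑-swap : ∀ (f : 𝔸 → 𝔹 → ℕ) xs ys → ∑ (λ x → ∑ (f x) ys) xs ≡ ∑ (λ y → ∑ (λ x → f x y) xs) ys
  ∑-swap f [] ys = sym (∑-const 0 ys)
  ∑-swap f (x ∷ xs) ys rewrite ∑-swap f xs ys = sym (∑-+ (f x) _ ys)

  ∑-concatMap : ∀ (f : 𝔹 → ℕ) (g : 𝔸 → List 𝔹) xs → ∑ f (concatMap g xs) ≡ ∑ (λ x → ∑ f (g x)) xs
  ∑-concatMap f g [] = refl
  ∑-concatMap f g (x ∷ xs) = trans (∑-++ f (g x) _) (cong (_ +_) (∑-concatMap f g xs))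

  ∑-< : ∀ (f g : 𝔸 → ℕ) xs → ∑ g xs < ∑ f xs → ∃ λ x → x ∈ xs × g x < f x
  ∑-< f g (x ∷ xs) p with <-or-≥ (g x) (f x)
  ... | inj₁ q = x , here refl , q
  ... | inj₂ q with <-or-≥ (∑ g xs) (∑ f xs)
  ...   | inj₁ r = let y , m , s = ∑-< f g xs r in y , there m , s
  ...   | inj₂ r = ⊥-elim (<⇒≱ p (+-mono-≤ q r))

  length≡∑ : ∀ (xs : List 𝔸) → length xs ≡ ∑ (λ _ → 1) xs
  length≡∑ xs = sym (trans (∑-const 1 xs) (*-identityˡ _))

  length-concatMap : ∀ (g : 𝔸 → List 𝔹) xs → length (concatMap g xs) ≡ ∑ (length ∘ g) xs
  length-concatMap g [] = refl
  length-concatMap g (x ∷ xs) = trans (length-++ (g x)) (cong (_ +_) (length-concatMap g xs))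

  cnt : (𝔸 → Bool) → List 𝔸 → ℕ
  cnt f = ∑ (b2n ∘ f)

  cnt≡countTrue : ∀ (f : 𝔸 → Bool) xs → countTrue (map f xs) ≡ cnt f xs
  cnt≡countTrue f [] = refl
  cnt≡countTrue f (x ∷ xs) with f x
  ... | true = cong suc (cnt≡countTrue f xs)
  ... | false = cnt≡countTrue f xs

  b2n≤1 : ∀ b → b2n b ≤ 1
  b2n≤1 true = ≤-refl
  b2n≤1 false = z≤n

  b2n-mono : ∀ {a b} → (T a → T b) → b2n a ≤ b2n b
  b2n-mono {true} {true} h = ≤-refl
  b2n-mono {true} {false} h = ⊥-elim (h tt)
  b2n-mono {false} h = z≤n

  b2n-F : ∀ {a} → ¬ T a → b2n a ≡ 0
  b2n-F {true} h = ⊥-elim (h tt)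
  b2n-F {false} h = refl

  cnt≤length : ∀ (f : 𝔸 → Bool) xs → cnt f xs ≤ length xs
  cnt≤length f xs = ≤-trans (∑-mono xs (λ {x} _ → b2n≤1 (f x))) (≤-reflexive (sym (length≡∑ xs)))

  cnt-mono : ∀ {f g : 𝔸 → Bool} xs → (∀ {x} → x ∈ xs → T (f x) → T (g x)) → cnt f xs ≤ cnt g xs
  cnt-mono xs h = ∑-mono xs (λ m → b2n-mono (h m))

  sel rej : (𝔸 → Bool) → List 𝔸 → List 𝔸
  sel f [] = []
  sel f (x ∷ xs) = if f x then x ∷ sel f xs else sel f xs
  rej f [] = []
  rej f (x ∷ xs) = if f x then rej f xs else x ∷ rej f xs

  sel-rej : ∀ (f : 𝔸 → Bool) xs → xs ↭ sel f xs ++ rej f xs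
  sel-rej f [] = ↭refl
  sel-rej f (x ∷ xs) with f x
  ... | true = prep x (sel-rej f xs)
  ... | false = ↭tr (prep x (sel-rej f xs)) (↭-sym (shift x (sel f xs) (rej f xs)))

  length-sel : ∀ (f : 𝔸 → Bool) xs → length (sel f xs) ≡ cnt f xs
  length-sel f [] = refl
  length-sel f (x ∷ xs) with f x
  ... | true = cong suc (length-sel f xs)
  ... | false = length-sel f xs

  ∈-sel⁻ : ∀ (f : 𝔸 → Bool) xs {x} → x ∈ sel f xs → x ∈ xs × T (f x)
  ∈-sel⁻ f (y ∷ xs) m with f y in eq
  ∈-sel⁻ f (y ∷ xs) (here refl) | true = here refl , subst T (sym eq) tt
  ∈-sel⁻ f (y ∷ xs) (there m) | true = let a , b = ∈-sel⁻ f xs m in there a , b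
  ∈-sel⁻ f (y ∷ xs) m | false = let a , b = ∈-sel⁻ f xs m in there a , b

  ∈-rej⁻ : ∀ (f : 𝔸 → Bool) xs {x} → x ∈ rej f xs → x ∈ xs × ¬ T (f x)
  ∈-rej⁻ f (y ∷ xs) m with f y in eq
  ∈-rej⁻ f (y ∷ xs) (here refl) | false = here refl , λ t → subst T eq t
  ∈-rej⁻ f (y ∷ xs) (there m) | false = let a , b = ∈-rej⁻ f xs m in there a , b
  ∈-rej⁻ f (y ∷ xs) m | true = let a , b = ∈-rej⁻ f xs m in there a , b

  ∈-sel⁺ : ∀ (f : 𝔸 → Bool) {xs x} → x ∈ xs → T (f x) → x ∈ sel f xs
  ∈-sel⁺ f {y ∷ xs} (here refl) t with f y
  ... | true = here refl
  ∈-sel⁺ f {y ∷ xs} (there m) t with f y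
  ... | true = there (∈-sel⁺ f m t)
  ... | false = ∈-sel⁺ f m t

  ∑-sel-rej : ∀ (g : 𝔸 → ℕ) (f : 𝔸 → Bool) xs → ∑ g xs ≡ ∑ g (sel f xs) + ∑ g (rej f xs)
  ∑-sel-rej g f xs = trans (∑-↭ g (sel-rej f xs)) (∑-++ g (sel f xs) (rej f xs))

  ∈⇒↭ : ∀ {x : 𝔸} {xs} → x ∈ xs → ∃ λ ys → xs ↭ x ∷ ys
  ∈⇒↭ m with ∈-∃++ m
  ... | ys , zs , refl = ys ++ zs , shift _ ys zs

  Unique-↭ : ∀ {xs ys : List 𝔸} → xs ↭ ys → Unique xs → Unique ys
  Unique-↭ ↭refl u = u
  Unique-↭ (prep x p) (a ∷ u) = All-resp-↭ p a ∷ Unique-↭ p u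
  Unique-↭ (swap x y p) ((a ∷ as) ∷ (bs ∷ u)) = ((λ e → a (sym e)) ∷ All-resp-↭ p bs) ∷ (All-resp-↭ p as ∷ Unique-↭ p u)
  Unique-↭ (↭tr p q) u = Unique-↭ q (Unique-↭ p u)

  Unique-++ˡ : ∀ (xs : List 𝔸) {ys} → Unique (xs ++ ys) → Unique xs
  Unique-++ˡ [] u = []
  Unique-++ˡ (x ∷ xs) (a ∷ u) = All.tabulate (λ m → All.lookup a (∈-++⁺ˡ m)) ∷ Unique-++ˡ xs u

  Unique-++ʳ : ∀ (xs : List 𝔸) {ys} → Unique (xs ++ ys) → Unique ys
  Unique-++ʳ [] u = u
  Unique-++ʳ (x ∷ xs) (a ∷ u) = Unique-++ʳ xs u

  Unique-disjoint : ∀ (xs : List 𝔸) {ys x} → Unique (xs ++ ys) → x ∈ xs → x ∈ ys → ⊥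
  Unique-disjoint (x ∷ xs) (a ∷ u) (here refl) m' = All.lookup a (∈-++⁺ʳ xs m') refl
  Unique-disjoint (x ∷ xs) (a ∷ u) (there m) m' = Unique-disjoint xs u m m'

  ∉⇒All≢ : ∀ {x : 𝔸} {xs} → x ∉ xs → All (x ≢_) xs
  ∉⇒All≢ h = All.tabulate λ m e → h (subst (_∈ _) (sym e) m)

  ⊆⇒↭ : ∀ {xs ys : List 𝔸} → Unique xs → (∀ {x} → x ∈ xs → x ∈ ys) → ∃ λ zs → ys ↭ xs ++ zs
  ⊆⇒↭ {xs = []} {ys} u h = ys , ↭refl
  ⊆⇒↭ {xs = x ∷ xs} {ys} (a ∷ u) h with ∈⇒↭ (h (here refl))
  ... | ys' , p with ⊆⇒↭ {xs = xs} {ys'} u h'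
    where
    h' : ∀ {y} → y ∈ xs → y ∈ ys'
    h' m with ∈-resp-↭ p (h (there m))
    ... | here refl = ⊥-elim (All.lookup a m refl)
    ... | there m' = m'
  ...   | zs , q = zs , ↭tr p (prep x q)

  ⊆⇒length≤ : ∀ {xs ys : List 𝔸} → Unique xs → (∀ {x} → x ∈ xs → x ∈ ys) → length xs ≤ length ys
  ⊆⇒length≤ {xs = xs} u h with ⊆⇒↭ u h
  ... | zs , p = ≤-trans (m≤m+n (length xs) (length zs)) (≤-reflexive (trans (sym (length-++ xs)) (sym (↭-length p))))

  Unique-sel : ∀ (f : 𝔸 → Bool) {xs} → Unique xs → Unique (sel f xs)
  Unique-sel f {xs} u = Unique-++ˡ (sel f xs) (Unique-↭ (sel-rej f xs) u)

  module _ {n : ℕ} where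
    open import Data.List.Membership.DecPropositional (Fin._≟_ {n}) public using (_∈?_)

    pick : ∀ (f : Fin n → Bool) {xs} (F : List (Fin n)) → Unique xs → length F < cnt f xs →
           ∃ λ x → x ∈ xs × T (f x) × x ∉ F
    pick f {xs} F u p with All.all? (λ x → x ∈? F) (sel f xs)
    ... | yes a = ⊥-elim (<⇒≱ p (subst (_≤ length F) (length-sel f xs) (⊆⇒length≤ (Unique-sel f u) (All.lookup a))))
    ... | no ¬a = go (sel f xs) (∈-sel⁻ f xs) ¬a
      where
      go : ∀ ys → (∀ {x} → x ∈ ys → x ∈ xs × T (f x)) → ¬ All (_∈ F) ys → ∃ λ x → x ∈ xs × T (f x) × x ∉ F
      go [] h na = ⊥-elim (na [])
      go (y ∷ ys) h na with y ∈? F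
      ... | no q = y , proj₁ (h (here refl)) , proj₂ (h (here refl)) , q
      ... | yes q = go ys (h ∘ there) (λ a → na (q ∷ a))

    pickAny : ∀ {xs} (F : List (Fin n)) → Unique xs → length F < length xs → ∃ λ x → x ∈ xs × x ∉ F
    pickAny {xs} F u p with pick (λ _ → true) F u (subst (length F <_) (length≡∑ xs) p)
    ... | x , m , _ , q = x , m , q

  -- Tiles, rungs and ladders with slots

  module Tiles {n : ℕ} (G : Graph n) where

    V Rung Tile : Set
    V = Fin n
    Rung = V × V
    Tile = List V × List V

    infix 4 _~_
    _~_ : V → V → Set
    _~_ = Adj G

    ~sym : ∀ {u v} → u ~ v → v ~ u
    ~sym {u} {v} = subst T (adj-sym G u v)

    ~irrefl : ∀ {v} → ¬ v ~ v
    ~irrefl {v} = subst T (adj-irrefl G v)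

    e : List V → List V → ℕ
    e X Y = ∑ (λ x → cnt (adj G x) Y) X

    e-sym : ∀ X Y → e X Y ≡ e Y X
    e-sym X Y = trans (∑-swap (λ x y → b2n (adj G x y)) X Y)
      (∑-cong Y (λ y → ∑-cong X (λ x → cong b2n (adj-sym G x y))))

    e-++ʳ : ∀ X Y Z → e X (Y ++ Z) ≡ e X Y + e X Z
    e-++ʳ X Y Z = trans (∑-cong X (λ x → ∑-++ _ Y Z)) (∑-+ _ _ X)

    e-↭ʳ : ∀ X {Y Z} → Y ↭ Z → e X Y ≡ e X Z
    e-↭ʳ X p = ∑-cong X (λ x → ∑-↭ _ p)

    e-concatMap : ∀ {A : Set} X (f : A → List V) as → e X (concatMap f as) ≡ ∑ (λ a → e X (f a)) as
    e-concatMap X f as = trans (∑-cong X (λ x → ∑-concatMap _ f as)) (∑-swap _ X as)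

    e≤ : ∀ X Y → e X Y ≤ length X * length Y
    e≤ X Y = ≤-trans (∑-mono X (λ {x} _ → cnt≤length (adj G x) Y))
      (≤-reflexive (trans (∑-const (length Y) X) (*-comm (length Y) (length X))))

    Complete : List V → List V → Set
    Complete X Y = ∀ {x y} → x ∈ X → y ∈ Y → x ~ y

    Good : Tile → Set
    Good (X , Y) = Complete X Y × length X ≡ length Y

    verts : Tile → List V
    verts (X , Y) = X ++ Y

    vertsT : List Tile → List V
    vertsT = concatMap verts

    bothSides : Tile → List Tile
    bothSides (X , Y) = (X , Y) ∷ (Y , X) ∷ []

    sides : List Tile → List Tile
    sides = concatMap bothSides

    U₁ U₂ : List Tile → List V
    U₁ = concatMap proj₁
    U₂ = concatMap proj₂

    length-sides : ∀ 𝒯 → length (sides 𝒯) ≡ 2 * length 𝒯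
    length-sides [] = refl
    length-sides (T ∷ 𝒯) rewrite length-sides 𝒯 = sym (*-suc 2 (length 𝒯))

    vertsT≡U₁ : ∀ 𝒯 → vertsT 𝒯 ≡ U₁ (sides 𝒯)
    vertsT≡U₁ [] = refl
    vertsT≡U₁ ((X , Y) ∷ 𝒯) rewrite vertsT≡U₁ 𝒯 = ++-assoc X Y _

    vertsT↭U₂ : ∀ 𝒯 → vertsT 𝒯 ↭ U₂ (sides 𝒯)
    vertsT↭U₂ [] = ↭refl
    vertsT↭U₂ ((X , Y) ∷ 𝒯) = ↭tr (++⁺ (++-comm X Y) (vertsT↭U₂ 𝒯)) (↭-reflexive (++-assoc Y X _))

    Oriented : Tile → Tile → Set
    Oriented (P , Q) T = T ≡ (P , Q) ⊎ T ≡ (Q , P)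

    ∈-sides : ∀ 𝒯 {o} → o ∈ sides 𝒯 → ∃ λ T → T ∈ 𝒯 × Oriented o T
    ∈-sides (T ∷ 𝒯) (here refl) = T , here refl , inj₁ refl
    ∈-sides (T ∷ 𝒯) (there (here refl)) = T , here refl , inj₂ refl
    ∈-sides (T ∷ 𝒯) (there (there m)) = let T' , m' , o = ∈-sides 𝒯 m in T' , there m' , o

    Good-swap : ∀ {X Y} → Good (X , Y) → Good (Y , X)
    Good-swap (c , l) = (λ y x → ~sym (c x y)) , sym l

    Good-oriented : ∀ {o T} → Oriented o T → Good T → Good o
    Good-oriented (inj₁ refl) g = g
    Good-oriented (inj₂ refl) g = Good-swap g

    Good-side : ∀ 𝒯 → All Good 𝒯 → ∀ {o} → o ∈ sides 𝒯 → Good o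
    Good-side 𝒯 g m = let T , m' , o = ∈-sides 𝒯 m in Good-oriented o (All.lookup g m')

    ∈-concatMap : ∀ {A : Set} (f : A → List V) {as a v} → a ∈ as → v ∈ f a → v ∈ concatMap f as
    ∈-concatMap f {a ∷ as} (here refl) m = ∈-++⁺ˡ m
    ∈-concatMap f {a ∷ as} (there i) m = ∈-++⁺ʳ (f a) (∈-concatMap f i m)

    ∈-concatMap⁻ : ∀ {A : Set} (f : A → List V) as {v} → v ∈ concatMap f as → ∃ λ a → a ∈ as × v ∈ f a
    ∈-concatMap⁻ f (a ∷ as) m with ∈-++⁻ (f a) m
    ... | inj₁ m' = a , here refl , m'
    ... | inj₂ m' = let b , i , j = ∈-concatMap⁻ f as m' in b , there i , j

    ∈-side₁ : ∀ 𝒯 {o v} → o ∈ sides 𝒯 → v ∈ proj₁ o → v ∈ vertsT 𝒯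
    ∈-side₁ 𝒯 i m = subst (_ ∈_) (sym (vertsT≡U₁ 𝒯)) (∈-concatMap proj₁ i m)

    ∈-side₂ : ∀ 𝒯 {o v} → o ∈ sides 𝒯 → v ∈ proj₂ o → v ∈ vertsT 𝒯
    ∈-side₂ 𝒯 i m = ∈-resp-↭ (↭-sym (vertsT↭U₂ 𝒯)) (∈-concatMap proj₂ i m)

    concatMap-↭ : ∀ {A : Set} (f : A → List V) {as bs} → as ↭ bs → concatMap f as ↭ concatMap f bs
    concatMap-↭ f ↭refl = ↭refl
    concatMap-↭ f (prep x p) = ++⁺ˡ (f x) (concatMap-↭ f p)
    concatMap-↭ f (swap {xs} {ys} x y p) = ↭tr
      (psolve 3 (λ a b c → a ⊕ (b ⊕ c) ⊜ b ⊕ (a ⊕ c)) ↭-refl (f x) (f y) (concatMap f xs))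
      (++⁺ˡ (f y) (++⁺ˡ (f x) (concatMap-↭ f p)))
    concatMap-↭ f (↭tr p q) = ↭tr (concatMap-↭ f p) (concatMap-↭ f q)

    concatMap-∷ : ∀ {A : Set} (f : A → List V) {as a} → a ∈ as → ∃ λ bs → concatMap f as ↭ f a ++ concatMap f bs
    concatMap-∷ f m with ∈⇒↭ m
    ... | bs , p = bs , concatMap-↭ f p

    Unique-side₁ : ∀ 𝒯 {o} → Unique (vertsT 𝒯) → o ∈ sides 𝒯 → Unique (proj₁ o)
    Unique-side₁ 𝒯 {o} u m with concatMap-∷ proj₁ m
    ... | bs , p = Unique-++ˡ (proj₁ o) (Unique-↭ (↭tr (↭-reflexive (vertsT≡U₁ 𝒯)) p) u)

    Unique-side₂ : ∀ 𝒯 {o} → Unique (vertsT 𝒯) → o ∈ sides 𝒯 → Unique (proj₂ o)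
    Unique-side₂ 𝒯 {o} u m with concatMap-∷ proj₂ m
    ... | bs , p = Unique-++ˡ (proj₂ o) (Unique-↭ (↭tr (vertsT↭U₂ 𝒯) p) u)

    Edge : Rung → Set
    Edge (a , b) = a ~ b

    -- The two rows of a ladder are not distinguished: consecutive rungs are joined by a matching.
    Link : Rung → Rung → Set
    Link (a , b) (c , d) = (a ~ c × b ~ d) ⊎ (a ~ d × b ~ c)

    Link-sym : ∀ {r s} → Link r s → Link s r
    Link-sym (inj₁ (p , q)) = inj₁ (~sym p , ~sym q)
    Link-sym (inj₂ (p , q)) = inj₂ (~sym q , ~sym p)

    Compat : Rung → Tile → Set
    Compat (a , b) (X , Y) =
      ((∀ {y} → y ∈ Y → a ~ y) × (∀ {x} → x ∈ X → b ~ x)) ⊎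
      ((∀ {y} → y ∈ Y → b ~ y) × (∀ {x} → x ∈ X → a ~ x))

    _⊑_ : Tile → Tile → Set
    (X' , Y') ⊑ (X , Y) = (∀ {x} → x ∈ X' → x ∈ X) × (∀ {y} → y ∈ Y' → y ∈ Y)

    InTile : Rung → Tile → Set
    InTile (x , y) (X , Y) = (x ∈ X × y ∈ Y) ⊎ (x ∈ Y × y ∈ X)

    InTile-oriented : ∀ {r o T} → Oriented o T → InTile r o → InTile r T
    InTile-oriented (inj₁ refl) i = i
    InTile-oriented (inj₂ refl) (inj₁ i) = inj₂ i
    InTile-oriented (inj₂ refl) (inj₂ i) = inj₁ i

    Compat-shrink : ∀ {r T T'} → T' ⊑ T → Compat r T → Compat r T'
    Compat-shrink (p , q) (inj₁ (f , g)) = inj₁ (f ∘ q , g ∘ p)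
    Compat-shrink (p , q) (inj₂ (f , g)) = inj₂ (f ∘ q , g ∘ p)

    Compat⇒Link : ∀ {r s T} → Compat r T → InTile s T → Link r s
    Compat⇒Link (inj₁ (f , g)) (inj₁ (x , y)) = inj₂ (f y , g x)
    Compat⇒Link (inj₁ (f , g)) (inj₂ (x , y)) = inj₁ (f x , g y)
    Compat⇒Link (inj₂ (f , g)) (inj₁ (x , y)) = inj₁ (g x , f y)
    Compat⇒Link (inj₂ (f , g)) (inj₂ (x , y)) = inj₂ (g y , f x)

    InTile⇒Compat : ∀ {s X Y} → Complete X Y → InTile s (X , Y) → Compat s (X , Y)
    InTile⇒Compat c (inj₁ (x , y)) = inj₁ ((λ y' → c x y') , (λ x' → ~sym (c x' y)))
    InTile⇒Compat c (inj₂ (x , y)) = inj₂ ((λ y' → c y y') , (λ x' → ~sym (c x' x)))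

    InTile⇒Edge : ∀ {s X Y} → Complete X Y → InTile s (X , Y) → Edge s
    InTile⇒Edge c (inj₁ (x , y)) = c x y
    InTile⇒Edge c (inj₂ (x , y)) = ~sym (c y x)

    InTile⇒Link : ∀ {r s X Y} → Complete X Y → InTile r (X , Y) → InTile s (X , Y) → Link r s
    InTile⇒Link c i j = Compat⇒Link (InTile⇒Compat c i) j

    -- A ladder from the first to the last rung.  Between two rungs complete to a tile there may be
    -- a slot, where (parts of) that tile can be inserted later.
    data Chain : Rung → List Tile → Rung → Set where
      end  : ∀ {r} → Edge r → Chain r [] r
      step : ∀ {r s 𝒯 t} → Edge r → Link r s → Chain s 𝒯 t → Chain r 𝒯 t
      slot : ∀ {r s T 𝒯 t} → Edge r → Link r s → Compat r T → Compat s T → Chain s 𝒯 t → Chain r (T ∷ 𝒯) t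

    cverts : ∀ {r 𝒯 t} → Chain r 𝒯 t → List V
    cverts {a , b} (end _) = a ∷ b ∷ []
    cverts {a , b} (step _ _ c) = a ∷ b ∷ cverts c
    cverts {a , b} (slot _ _ _ _ c) = a ∷ b ∷ cverts c

    data Pointwise⊑ : List Tile → List Tile → Set where
      [] : Pointwise⊑ [] []
      _∷_ : ∀ {T' T 𝒯' 𝒯} → T' ⊑ T → Pointwise⊑ 𝒯' 𝒯 → Pointwise⊑ (T' ∷ 𝒯') (T ∷ 𝒯)

    Pointwise⊑-length : ∀ {𝒯' 𝒯} → Pointwise⊑ 𝒯' 𝒯 → length 𝒯' ≡ length 𝒯
    Pointwise⊑-length [] = refl
    Pointwise⊑-length (_ ∷ p) = cong suc (Pointwise⊑-length p)

    Pointwise⊑-split : ∀ 𝒯₁ {𝒯₂ 𝒯'} → Pointwise⊑ 𝒯' (𝒯₁ ++ 𝒯₂) →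
      ∃ λ 𝒯₁' → ∃ λ 𝒯₂' → 𝒯' ≡ 𝒯₁' ++ 𝒯₂' × Pointwise⊑ 𝒯₁' 𝒯₁ × Pointwise⊑ 𝒯₂' 𝒯₂
    Pointwise⊑-split [] p = [] , _ , refl , [] , p
    Pointwise⊑-split (T ∷ 𝒯₁) (s ∷ p) with Pointwise⊑-split 𝒯₁ p
    ... | a , b , refl , p₁ , p₂ = _ , b , refl , s ∷ p₁ , p₂

    shrink : ∀ {r 𝒯 t 𝒯'} → Pointwise⊑ 𝒯' 𝒯 → (c : Chain r 𝒯 t) → Σ (Chain r 𝒯' t) λ c' → cverts c' ≡ cverts c
    shrink [] (end x) = end x , refl
    shrink p (step x l c) = let c' , q = shrink p c in step x l c' , cong (λ z → _ ∷ _ ∷ z) q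
    shrink (s ∷ p) (slot x l a b c) = let c' , q = shrink p c in
      slot x l (Compat-shrink s a) (Compat-shrink s b) c' , cong (λ z → _ ∷ _ ∷ z) q

    data Linked : Rung → List Rung → Rung → Set where
      link : ∀ {r s} → Link r s → Linked r [] s
      hop : ∀ {r m ms s} → Link r m → Edge m → Linked m ms s → Linked r (m ∷ ms) s

    flat : List Rung → List V
    flat [] = []
    flat ((a , b) ∷ rs) = a ∷ b ∷ flat rs

    prependLinked : ∀ {r ms s 𝒯 t} → Edge r → Linked r ms s → (d : Chain s 𝒯 t) →
      Σ (Chain r 𝒯 t) λ c → cverts c ≡ flat (r ∷ ms) ++ cverts d
    prependLinked x (link l) d = step x l d , refl
    prependLinked x (hop l x' ls) d = let c , q = prependLinked x' ls d in step x l c , cong (λ z → _ ∷ _ ∷ z) q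

    join : ∀ {r 𝒯 s ms s' 𝒯' t} (c : Chain r 𝒯 s) → Linked s ms s' → (d : Chain s' 𝒯' t) →
      Σ (Chain r (𝒯 ++ 𝒯') t) λ c' → cverts c' ≡ cverts c ++ flat ms ++ cverts d
    join (end x) ls d = prependLinked x ls d
    join (step x l c) ls d = let c' , q = join c ls d in step x l c' , cong (λ z → _ ∷ _ ∷ z) q
    join (slot x l a b c) ls d = let c' , q = join c ls d in slot x l a b c' , cong (λ z → _ ∷ _ ∷ z) q

    data Replace (T T' : Tile) : List Tile → List Tile → Set where
      here : ∀ {𝒯} → Replace T T' (T ∷ 𝒯) (T' ∷ 𝒯)
      there : ∀ {S 𝒯 𝒯'} → Replace T T' 𝒯 𝒯' → Replace T T' (S ∷ 𝒯) (S ∷ 𝒯')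

    replace : ∀ {T 𝒯} T' → T ∈ 𝒯 → ∃ λ 𝒯' → Replace T T' 𝒯 𝒯'
    replace T' (here refl) = _ , here
    replace T' (there m) = let 𝒯' , r = replace T' m in _ , there r

    Replace-All : ∀ {P : Tile → Set} {T T' 𝒯 𝒯'} → Replace T T' 𝒯 𝒯' → P T' → All P 𝒯 → All P 𝒯'
    Replace-All here p (_ ∷ a) = p ∷ a
    Replace-All (there r) p (q ∷ a) = q ∷ Replace-All r p a

    Replace-length : ∀ {T T' 𝒯 𝒯'} → Replace T T' 𝒯 𝒯' → length 𝒯' ≡ length 𝒯
    Replace-length here = refl
    Replace-length (there r) = cong suc (Replace-length r)

    Replace-verts : ∀ {T T' 𝒯 𝒯' B} → Replace T T' 𝒯 𝒯' → verts T ↭ B ++ verts T' → vertsT 𝒯 ↭ B ++ vertsT 𝒯'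
    Replace-verts {T' = T'} {B = B} (here {𝒯}) p = ↭tr (++⁺ʳ (vertsT 𝒯) p) (↭-reflexive (++-assoc B (verts T') _))
    Replace-verts {B = B} (there {S} {𝒯} {𝒯'} r) p = ↭tr (++⁺ˡ (verts S) (Replace-verts r p))
      (psolve 3 (λ a b c → a ⊕ (b ⊕ c) ⊜ b ⊕ (a ⊕ c)) ↭-refl (verts S) B (vertsT 𝒯'))

    appendSlot : ∀ {r s u T 𝒯 t} (b : Chain r [] s) → Link s u → Compat s T → Compat u T → (d : Chain u 𝒯 t) →
      Σ (Chain r (T ∷ 𝒯) t) λ c → cverts c ≡ cverts b ++ cverts d
    appendSlot (end x) l a a' d = slot x l a a' d , refl
    appendSlot (step x l' b) l a a' d = let c , q = appendSlot b l a a' d in step x l' c , cong (λ z → _ ∷ _ ∷ z) q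

    insert : ∀ {r 𝒯 t X Y T' 𝒯' p q} → Replace (X , Y) T' 𝒯 𝒯' → Complete X Y → T' ⊑ (X , Y) →
      InTile p (X , Y) → InTile q (X , Y) → (b : Chain p [] q) → (c : Chain r 𝒯 t) →
      Σ (Chain r 𝒯' t) λ c' → cverts c' ↭ cverts b ++ cverts c
    insert here co sh ip iq b (slot {r} {s} x l a a' c) with
      appendSlot b (Link-sym (Compat⇒Link a' iq)) (Compat-shrink sh (InTile⇒Compat co iq)) (Compat-shrink sh a') c
    ... | d , eq = step x (Compat⇒Link a ip) d ,
      ↭tr (prep _ (prep _ (↭-reflexive eq)))
          (psolve 3 (λ u v w → u ⊕ (v ⊕ w) ⊜ v ⊕ (u ⊕ w)) ↭-refl (_ ∷ _ ∷ []) (cverts b) (cverts c))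
    insert rp co sh ip iq b (step x l c) with insert rp co sh ip iq b c
    ... | d , eq = step x l d , ↭tr (prep _ (prep _ eq))
          (psolve 3 (λ u v w → u ⊕ (v ⊕ w) ⊜ v ⊕ (u ⊕ w)) ↭-refl (_ ∷ _ ∷ []) (cverts b) (cverts c))
    insert (there rp) co sh ip iq b (slot x l a a' c) with insert rp co sh ip iq b c
    ... | d , eq = slot x l a a' d , ↭tr (prep _ (prep _ eq))
          (psolve 3 (λ u v w → u ⊕ (v ⊕ w) ⊜ v ⊕ (u ⊕ w)) ↭-refl (_ ∷ _ ∷ []) (cverts b) (cverts c))

    fill : ∀ {r s t} X Y → Complete X Y → length X ≡ length Y → Edge r → Link r s →
      Compat r (X , Y) → Compat s (X , Y) → (d : Chain s [] t) →
      Σ (Chain r [] t) λ c → cverts c ↭ (proj₁ r ∷ proj₂ r ∷ []) ++ (X ++ Y) ++ cverts d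
    fill [] [] co eq x l a a' d = step x l d , ↭refl
    fill (v ∷ X) (w ∷ Y) co eq x l a a' d with
      fill X Y (λ i j → co (there i) (there j)) (suc-injective eq) (co (here refl) (here refl))
        (Link-sym (Compat⇒Link a' (inj₁ (here refl , here refl))))
        (Compat-shrink (there , there) (InTile⇒Compat co (inj₁ (here refl , here refl))))
        (Compat-shrink (there , there) a') d
    ... | c , p = step x (Compat⇒Link a (inj₁ (here refl , here refl))) c , prep _ (prep _
       (↭tr p (psolve 5 (λ v w x y d → (v ⊕ w) ⊕ ((x ⊕ y) ⊕ d) ⊜ ((v ⊕ x) ⊕ (w ⊕ y)) ⊕ d) ↭-refl
         (v ∷ []) (w ∷ []) X Y (cverts d))))

    flush : ∀ {r 𝒯 t} → All Good 𝒯 → (c : Chain r 𝒯 t) → Σ (Chain r [] t) λ c' → cverts c' ↭ cverts c ++ vertsT 𝒯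
    flush [] (end x) = end x , ↭-refl
    flush g (step x l c) = let c' , p = flush g c in step x l c' , prep _ (prep _ p)
    flush ((co , eq) ∷ g) (slot {T = X , Y} {𝒯} x l a a' c) with flush g c
    ... | d , p with fill X Y co eq x l a a' d
    ...   | c' , q = c' , ↭tr q (prep _ (prep _ (↭tr (++⁺ˡ (X ++ Y) p)
       (psolve 3 (λ u v w → u ⊕ (v ⊕ w) ⊜ v ⊕ (u ⊕ w)) ↭-refl (X ++ Y) (cverts c) (vertsT 𝒯)))))

  inᵇ : ∀ {n} → List (Fin n) → Fin n → Bool
  inᵇ F v = does (v ∈? F)

  inᵇ⁻ : ∀ {n} (F : List (Fin n)) {v} → T (inᵇ F v) → v ∈ F
  inᵇ⁻ F {v} t with v ∈? F
  ... | yes p = p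

  inᵇ⁺ : ∀ {n} (F : List (Fin n)) {v} → v ∈ F → T (inᵇ F v)
  inᵇ⁺ F {v} m with v ∈? F
  ... | yes p = tt
  ... | no q = q m

  T-∧⁻ : ∀ {a b} → T (a ∧ b) → T a × T b
  T-∧⁻ {true} {true} _ = tt , tt

  T-∧⁺ : ∀ {a b} → T a → T b → T (a ∧ b)
  T-∧⁺ {true} {true} _ _ = tt

  T-not⁻ : ∀ {a} → T (not a) → ¬ T a
  T-not⁻ {false} _ ()

  T-not⁺ : ∀ {a} → ¬ T a → T (not a)
  T-not⁺ {true} h = h tt
  T-not⁺ {false} h = tt

  cnt-∈ : ∀ {n} (F : List (Fin n)) {xs} → Unique xs → cnt (inᵇ F) xs ≤ length F
  cnt-∈ F {xs} u = subst (_≤ length F) (length-sel (inᵇ F) xs)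
    (⊆⇒length≤ (Unique-sel (inᵇ F) u) (λ m → inᵇ⁻ F (proj₂ (∈-sel⁻ (inᵇ F) xs m))))

  sel-inᵇ↭ : ∀ {n} {xs F : List (Fin n)} → Unique xs → Unique F → (∀ {v} → v ∈ F → v ∈ xs) → sel (inᵇ F) xs ↭ F
  sel-inᵇ↭ {xs = xs} {F} u uF F⊆ with ⊆⇒↭ {ys = sel (inᵇ F) xs} uF (λ m → ∈-sel⁺ (inᵇ F) (F⊆ m) (inᵇ⁺ F m))
  ... | [] , p = subst (sel (inᵇ F) xs ↭_) (++-identityʳ F) p
  ... | z ∷ zs , p = ⊥-elim (<⇒≱ (m<m+n (length F) (s≤s z≤n)) (subst (_≤ length F)
          (trans (↭-length p) (length-++ F))
          (⊆⇒length≤ (Unique-sel (inᵇ F) u) (λ m → inᵇ⁻ F (proj₂ (∈-sel⁻ (inᵇ F) xs m))))))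

  cnt-sel : ∀ (f g : 𝔸 → Bool) xs → cnt f (sel g xs) ≡ cnt (λ x → f x ∧ g x) xs
  cnt-sel f g [] = refl
  cnt-sel f g (x ∷ xs) with g x
  ... | true = cong₂ _+_ (cong b2n (sym (∧-identityʳ (f x)))) (cnt-sel f g xs)
  ... | false = trans (cnt-sel f g xs) (cong (λ b → b2n b + cnt (λ x → f x ∧ g x) xs) (sym (∧-zeroʳ (f x))))

  b2n-split : ∀ a b → b2n a ≤ b2n (a ∧ not b) + b2n b
  b2n-split true true = ≤-refl
  b2n-split true false = ≤-refl
  b2n-split false b = z≤n

  cnt-avoid : ∀ {n} (f : Fin n → Bool) (F : List (Fin n)) {xs} → Unique xs →
    cnt f xs ≤ cnt (λ v → f v ∧ not (inᵇ F v)) xs + length F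
  cnt-avoid f F {xs} u = ≤-trans (∑-mono xs (λ {v} _ → b2n-split (f v) (inᵇ F v)))
    (≤-trans (≤-reflexive (∑-+ _ _ xs)) (+-monoʳ-≤ _ (cnt-∈ F u)))

  sel-++ : ∀ (f : 𝔸 → Bool) xs ys → sel f (xs ++ ys) ≡ sel f xs ++ sel f ys
  sel-++ f [] ys = refl
  sel-++ f (x ∷ xs) ys with f x
  ... | true = cong (x ∷_) (sel-++ f xs ys)
  ... | false = sel-++ f xs ys

  length-sel-rej : ∀ (f : 𝔸 → Bool) xs → length xs ≡ length (sel f xs) + length (rej f xs)
  length-sel-rej f xs = trans (↭-length (sel-rej f xs)) (length-++ (sel f xs))

  ∈-take⁻ : ∀ k (xs : List 𝔸) {x} → x ∈ take k xs → x ∈ xs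
  ∈-take⁻ (suc k) (y ∷ xs) (here p) = here p
  ∈-take⁻ (suc k) (y ∷ xs) (there m) = there (∈-take⁻ k xs m)

  take-drop↭ : ∀ k (xs : List 𝔸) → xs ↭ take k xs ++ drop k xs
  take-drop↭ k xs = ↭-reflexive (sym (take++drop≡id k xs))

  excess : ∀ a b a' b' → a + a' ≡ b + b' → b' ≤ a' + (a + b)
  excess a b a' b' eq = linear {a = b + b'} {b = a + a'} (b + b) (≤-reflexive (sym eq)) (solve (a L.∷ b L.∷ a' L.∷ b' L.∷ L.[]))

  dropped : ∀ a b a' b' → a + a' ≡ b + b' → (a' ∸ (a' ⊓ b')) + (b' ∸ (a' ⊓ b')) ≤ a + b
  dropped a b a' b' eq with ≤-total a' b'
  ... | inj₁ p = subst (λ m → (a' ∸ m) + (b' ∸ m) ≤ a + b) (sym (m≤n⇒m⊓n≡m p))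
    (subst (λ k → k + (b' ∸ a') ≤ a + b) (sym (n∸n≡0 a')) (m≤n+o⇒m∸n≤o b' a' (excess a b a' b' eq)))
  ... | inj₂ p = subst (λ m → (a' ∸ m) + (b' ∸ m) ≤ a + b) (sym (m≥n⇒m⊓n≡n p))
    (subst (λ k → (a' ∸ b') + k ≤ a + b) (sym (n∸n≡0 b'))
      (subst₂ _≤_ (sym (+-identityʳ (a' ∸ b'))) (+-comm b a) (m≤n+o⇒m∸n≤o a' b' (excess b a b' a' (sym eq)))))

  shuffle₁ : ∀ (a b c d e f : List 𝔸) → (a ++ b ++ c) ++ d ++ e ++ f ↭ (a ++ d) ++ (c ++ f) ++ b ++ e
  shuffle₁ = psolve 6 (λ a b c d e f → (a ⊕ (b ⊕ c)) ⊕ (d ⊕ (e ⊕ f)) ⊜ (a ⊕ d) ⊕ ((c ⊕ f) ⊕ (b ⊕ e))) ↭-refl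

  shuffle₂ : ∀ (a b c d e f : List 𝔸) → (a ++ b ++ c) ++ d ++ e ++ f ↭ (a ++ d) ++ (b ++ e) ++ c ++ f
  shuffle₂ = psolve 6 (λ a b c d e f → (a ⊕ (b ⊕ c)) ⊕ (d ⊕ (e ⊕ f)) ⊜ (a ⊕ d) ⊕ ((b ⊕ e) ⊕ (c ⊕ f))) ↭-refl

  module Trim {n : ℕ} (G : Graph n) where
    open Tiles G

    record Trimmed (f : V → Bool) (𝒯 : List Tile) : Set where
      field
        𝒯' : List Tile
        W : List V
        smaller : Pointwise⊑ 𝒯' 𝒯
        good : All Good 𝒯'
        split : vertsT 𝒯 ↭ sel f (vertsT 𝒯) ++ W ++ vertsT 𝒯'
        few : length W ≤ length (sel f (vertsT 𝒯))

    trimTile : ∀ f X Y → Good (X , Y) → ∃ λ X' → ∃ λ Y' → ∃ λ W → (X' , Y') ⊑ (X , Y) × Good (X' , Y') ×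
      X ++ Y ↭ sel f (X ++ Y) ++ W ++ X' ++ Y' × length W ≤ length (sel f (X ++ Y))
    trimTile f X Y (co , eq) = X' , Y' , W , sh ,
      ((λ i j → co (proj₁ sh i) (proj₂ sh j)) , lenXY) , perm , lenW
      where
      RX RY X' Y' W : List V
      RX = rej f X
      RY = rej f Y
      m : ℕ
      m = length RX ⊓ length RY
      X' = take m RX
      Y' = take m RY
      W = drop m RX ++ drop m RY
      sh : (X' , Y') ⊑ (X , Y)
      sh = (λ i → proj₁ (∈-rej⁻ f X (∈-take⁻ m RX i))) , (λ i → proj₁ (∈-rej⁻ f Y (∈-take⁻ m RY i)))
      lenXY : length X' ≡ length Y'
      lenXY = trans (trans (length-take m RX) (m≤n⇒m⊓n≡m (m⊓n≤m (length RX) (length RY))))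
        (sym (trans (length-take m RY) (m≤n⇒m⊓n≡m (m⊓n≤n (length RX) (length RY)))))
      perm : X ++ Y ↭ sel f (X ++ Y) ++ W ++ X' ++ Y'
      perm rewrite sel-++ f X Y = ↭tr
        (++⁺ (↭tr (sel-rej f X) (++⁺ˡ (sel f X) (take-drop↭ m RX))) (↭tr (sel-rej f Y) (++⁺ˡ (sel f Y) (take-drop↭ m RY))))
        (shuffle₁ (sel f X) X' (drop m RX) (sel f Y) Y' (drop m RY))
      lenW : length W ≤ length (sel f (X ++ Y))
      lenW rewrite sel-++ f X Y | length-++ (sel f X) {sel f Y} | length-++ (drop m RX) {drop m RY}
        | length-drop m RX | length-drop m RY =
        dropped (length (sel f X)) (length (sel f Y)) (length RX) (length RY)
          (trans (sym (length-sel-rej f X)) (trans eq (length-sel-rej f Y)))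

    trim : ∀ f 𝒯 → All Good 𝒯 → Trimmed f 𝒯
    trim f [] [] = record { 𝒯' = [] ; W = [] ; smaller = [] ; good = [] ; split = ↭refl ; few = z≤n }
    trim f ((X , Y) ∷ 𝒯) (g ∷ gs) with trimTile f X Y g | trim f 𝒯 gs
    ... | X' , Y' , W , sh , g' , p , l | t = record
      { 𝒯' = (X' , Y') ∷ t.𝒯' ; W = W ++ t.W ; smaller = sh ∷ t.smaller ; good = g' ∷ t.good
      ; split = ↭tr (++⁺ p t.split) (↭tr (shuffle₂ (sel f (X ++ Y)) W (X' ++ Y') (sel f (vertsT 𝒯)) t.W (vertsT t.𝒯'))
          (++⁺ʳ _ (↭-reflexive (sym (sel-++ f (X ++ Y) (vertsT 𝒯))))))
      ; few = subst₂ _≤_ (sym (length-++ W)) (sym (trans (cong length (sel-++ f (X ++ Y) (vertsT 𝒯))) (length-++ (sel f (X ++ Y)))))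
          (+-mono-≤ l t.few) }
      where module t = Trimmed t

    removeBalanced : ∀ 𝒯 F → All Good 𝒯 → Unique (vertsT 𝒯) → Unique F → (∀ {v} → v ∈ F → v ∈ vertsT 𝒯) →
      ∃ λ 𝒯' → ∃ λ W → Pointwise⊑ 𝒯' 𝒯 × All Good 𝒯' × vertsT 𝒯 ↭ F ++ W ++ vertsT 𝒯' × length W ≤ length F
    removeBalanced 𝒯 F g u uF F⊆ = t.𝒯' , t.W , t.smaller , t.good , ↭tr t.split (++⁺ʳ _ sel↭F) ,
      subst (length t.W ≤_) (↭-length sel↭F) t.few
      where
      module t = Trimmed (trim (inᵇ F) 𝒯 g)
      sel↭F : sel (inᵇ F) (vertsT 𝒯) ↭ F
      sel↭F = sel-inᵇ↭ u uF F⊆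

  -- Connecting two rungs

  reorder₆ : ∀ {A : Set} (q x p' y y' p : A) F → q ∷ x ∷ p' ∷ y ∷ y' ∷ p ∷ F ↭ x ∷ y ∷ y' ∷ p ∷ p' ∷ q ∷ F
  reorder₆ q x p' y y' p = psolve 7
    (λ q x p' y y' p F → q ⊕ (x ⊕ (p' ⊕ (y ⊕ (y' ⊕ (p ⊕ F))))) ⊜ x ⊕ (y ⊕ (y' ⊕ (p ⊕ (p' ⊕ (q ⊕ F))))))
    ↭-refl [ q ] [ x ] [ p' ] [ y ] [ y' ] [ p ]

  module Density {n : ℕ} (G : Graph n) where
    open Tiles G
    open Trim G

    denseSides : ∀ c 𝒜 ℬ → c * (length (U₁ 𝒜) * length ℬ + length (U₁ ℬ) * length 𝒜) < e (U₁ 𝒜) (U₁ ℬ) →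
      ∃ λ P → ∃ λ Q → P ∈ 𝒜 × Q ∈ ℬ × c * (length (proj₁ P) + length (proj₁ Q)) < e (proj₁ P) (proj₁ Q)
    denseSides c 𝒜 ℬ h with ∑-< (λ P → ∑ (λ Q → e (proj₁ P) (proj₁ Q)) ℬ)
                               (λ P → ∑ (λ Q → c * (length (proj₁ P) + length (proj₁ Q))) ℬ) 𝒜
                               (subst₂ _<_ (sym outer) lhs h)
      where
      inner : ∀ p → ∑ (λ Q → c * (p + length (proj₁ Q))) ℬ ≡ c * (p * length ℬ + length (U₁ ℬ))
      inner p = trans (∑-* c _ ℬ) (cong (c *_) (trans (∑-+ (λ _ → p) _ ℬ)
        (cong₂ _+_ (∑-const p ℬ) (sym (length-concatMap proj₁ ℬ)))))
      outer : ∑ (λ P → ∑ (λ Q → c * (length (proj₁ P) + length (proj₁ Q))) ℬ) 𝒜 ≡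
              c * (length (U₁ 𝒜) * length ℬ + length (U₁ ℬ) * length 𝒜)
      outer = trans (∑-cong 𝒜 (λ P → inner (length (proj₁ P))))
        (trans (∑-* c _ 𝒜) (cong (c *_) (trans (∑-+ (λ P → length (proj₁ P) * length ℬ) _ 𝒜)
          (cong₂ _+_ (trans (∑-cong 𝒜 (λ P → *-comm (length (proj₁ P)) (length ℬ)))
                       (trans (∑-* (length ℬ) _ 𝒜) (trans (cong (length ℬ *_) (sym (length-concatMap proj₁ 𝒜)))
                         (*-comm (length ℬ) _))))
                     (∑-const _ 𝒜)))))
      lhs : e (U₁ 𝒜) (U₁ ℬ) ≡ ∑ (λ P → ∑ (λ Q → e (proj₁ P) (proj₁ Q)) ℬ) 𝒜
      lhs = trans (∑-concatMap _ proj₁ 𝒜) (∑-cong 𝒜 (λ P → e-concatMap (proj₁ P) proj₁ ℬ))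
    ... | P , i , h' with ∑-< (λ Q → e (proj₁ P) (proj₁ Q)) _ ℬ h'
    ...   | Q , j , h'' = P , Q , i , j , h''

    record Bridge (S S' : Tile) (D F : List V) : Set where
      field
        m₁ m₂ m₃ : Rung
        in₁ : InTile m₁ S
        in₃ : InTile m₃ S'
        edge₂ : Edge m₂
        link₁₂ : Link m₁ m₂
        link₂₃ : Link m₂ m₃
        fresh : Unique (flat (m₁ ∷ m₂ ∷ m₃ ∷ []) ++ F)
        inside : ∀ {v} → v ∈ flat (m₁ ∷ m₂ ∷ m₃ ∷ []) → v ∈ D

    -- A path y p y' p' between the sides P and Q gives the rungs {x , y}, {y' , p}, {p' , q} with x ∈ P* and q ∈ Q*.
    bridge : ∀ {P P* Q Q* D F} → Good (P , P*) → Good (Q , Q*) →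
      Unique P → Unique P* → Unique Q → Unique Q* → Unique F → length F ≤ 40 →
      (∀ {v} → v ∈ P → v ∈ D) → (∀ {v} → v ∈ P* → v ∈ D) → (∀ {v} → v ∈ Q → v ∈ D) → (∀ {v} → v ∈ Q* → v ∈ D) →
      100 * (length P + length Q) < e P Q → Bridge (P , P*) (Q , Q*) D F
    bridge {P} {P*} {Q} {Q*} {D} {F} (coP , lP) (coQ , lQ) uP uP* uQ uQ* uF lF P⊆ P*⊆ Q⊆ Q*⊆ dense =
      choose (∑-< (λ y → cnt (adj G y) B) (λ _ → 60) P' (subst (_< e P' B) (sym (∑-const 60 P')) dense'))
      where
      gq : V → Bool
      gq p = not (inᵇ F p) ∧ (50 <ᵇ cnt (adj G p) P)
      B R P' : List V
      B = sel gq Q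
      R = rej gq Q
      P' = rej (inᵇ F) P
      uR : Unique R
      uR = Unique-++ʳ B (Unique-↭ (sel-rej gq Q) uQ)
      bad : ∀ {p} → p ∈ R → cnt (adj G p) P ≤ 50 + length P * b2n (inᵇ F p)
      bad {p} m with inᵇ F p in eq
      ... | true = ≤-trans (cnt≤length (adj G p) P) (≤-trans (≤-reflexive (sym (*-identityʳ (length P)))) (m≤n+m _ 50))
      ... | false = ≤-trans (≮⇒≥ (λ lt → proj₂ (∈-rej⁻ gq Q m) (T-∧⁺ (subst (λ b → T (not b)) (sym eq) tt) (<⇒<ᵇ lt))))
                      (m≤m+n 50 _)
      eR : e P R ≤ 50 * length R + length P * 40
      eR = ≤-trans (≤-reflexive (e-sym P R)) (≤-trans (∑-mono R bad) (≤-trans (≤-reflexive (trans (∑-+ (λ _ → 50) _ R)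
             (cong₂ _+_ (∑-const 50 R) (∑-* (length P) _ R)))) (+-monoʳ-≤ (50 * length R)
             (*-monoʳ-≤ (length P) (≤-trans (cnt-∈ F uR) lF)))))
      eS : e (sel (inᵇ F) P) B ≤ length B * 40
      eS = ≤-trans (∑-mono (sel (inᵇ F) P) (λ {y} _ → cnt≤length (adj G y) B))
        (≤-trans (≤-reflexive (∑-const (length B) (sel (inᵇ F) P)))
          (*-monoʳ-≤ (length B) (≤-trans (≤-reflexive (length-sel (inᵇ F) P)) (≤-trans (cnt-∈ F uP) lF))))
      ePQ : e P Q ≡ e (sel (inᵇ F) P) B + e P' B + e P R
      ePQ = trans (e-↭ʳ P (sel-rej gq Q)) (trans (e-++ʳ P B R) (cong (_+ e P R) (∑-sel-rej _ (inᵇ F) P)))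
      arith : ∀ p q p' s b r x y z → q ≡ b + r → p ≡ s + p' → 100 * (p + q) < x + y + z → x ≤ b * 40 →
        z ≤ 50 * r + p * 40 → 60 * p' < y
      arith p q p' s b r x y z refl refl h hx hz = linear
        {a = suc (100 * (p + q)) + x + z} {b = x + y + z + b * 40 + (50 * r + p * 40)}
        (60 * s + 60 * b + 50 * r) (+-mono-≤ (+-mono-≤ h hx) hz) (lem p' s b r x y z)
        where
        lem : ∀ p' s b r x y z → suc (60 * p') + (x + y + z + b * 40 + (50 * r + (s + p') * 40)) + (60 * s + 60 * b + 50 * r) ≡
          y + (suc (100 * (s + p' + (b + r))) + x + z)
        lem = solve-∀
      dense' : 60 * length P' < e P' B
      dense' = arith (length P) (length Q) (length P') (length (sel (inᵇ F) P)) (length B) (length R)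
        (e (sel (inᵇ F) P) B) (e P' B) (e P R) (length-sel-rej gq Q) (length-sel-rej (inᵇ F) P)
        (subst (100 * (length P + length Q) <_) ePQ dense) eS eR
      choose : (∃ λ y' → y' ∈ P' × 60 < cnt (adj G y') B) → Bridge (P , P*) (Q , Q*) D F
      choose (y' , iy' , cy') = record
        { m₁ = x , y ; m₂ = y' , p ; m₃ = p' , q ; in₁ = inj₂ (ix , iy) ; in₃ = inj₁ (ip' , iq)
        ; edge₂ = ay'p ; link₁₂ = inj₁ (~sym (coP y'P ix) , ~sym apy) ; link₂₃ = inj₁ (ay'p' , coQ pQ iq)
        ; fresh = Unique-↭ (reorder₆ q x p' y y' p F)
            (∉⇒All≢ nq ∷ (∉⇒All≢ nx ∷ (∉⇒All≢ np' ∷ (∉⇒All≢ ny ∷ (∉⇒All≢ ny' ∷ (∉⇒All≢ np ∷ uF))))))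
        ; inside = λ { (here refl) → P*⊆ ix ; (there (here refl)) → P⊆ iy ; (there (there (here refl))) → P⊆ y'P
                     ; (there (there (there (here refl)))) → Q⊆ pQ ; (there (there (there (there (here refl))))) → Q⊆ ip'
                     ; (there (there (there (there (there (here refl)))))) → Q*⊆ iq }
        }
        where
        y'P = proj₁ (∈-rej⁻ (inᵇ F) P iy')
        y'F : y' ∉ F
        y'F m = proj₂ (∈-rej⁻ (inᵇ F) P iy') (inᵇ⁺ F m)
        cy'Q : 60 < cnt (adj G y') Q
        cy'Q = ≤-trans cy' (≤-trans (m≤m+n _ _) (≤-reflexive (sym (∑-sel-rej _ gq Q))))
        pk = pick (adj G y') F (Unique-sel gq uQ) (≤-trans (s≤s lF) (≤-trans (m≤n+m 41 20) cy'))
        p = proj₁ pk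
        pB = proj₁ (proj₂ pk)
        ay'p : y' ~ p
        ay'p = proj₁ (proj₂ (proj₂ pk))
        pQ : p ∈ Q
        pQ = proj₁ (∈-sel⁻ gq Q pB)
        np : p ∉ F
        np = proj₂ (proj₂ (proj₂ pk))
        cp : 50 < cnt (adj G p) P
        cp = <ᵇ⇒< 50 _ (proj₂ (T-∧⁻ {not (inᵇ F p)} (proj₂ (∈-sel⁻ gq Q pB))))
        ny' : y' ∉ p ∷ F
        ny' (here eq) = ~irrefl (subst (y' ~_) (sym eq) ay'p)
        ny' (there m) = y'F m
        yk = pick (adj G p) (y' ∷ p ∷ F) uP (≤-trans (s≤s (s≤s (s≤s lF))) (≤-trans (m≤n+m 43 8) cp))
        y = proj₁ yk
        iy = proj₁ (proj₂ yk)
        apy : p ~ y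
        apy = proj₁ (proj₂ (proj₂ yk))
        ny = proj₂ (proj₂ (proj₂ yk))
        p'k = pick (adj G y') (y ∷ y' ∷ p ∷ F) uQ (≤-trans (s≤s (s≤s (s≤s (s≤s lF)))) (≤-trans (m≤n+m 44 17) cy'Q))
        p' = proj₁ p'k
        ip' = proj₁ (proj₂ p'k)
        ay'p' : y' ~ p'
        ay'p' = proj₁ (proj₂ (proj₂ p'k))
        np' = proj₂ (proj₂ (proj₂ p'k))
        xk = pickAny (p' ∷ y ∷ y' ∷ p ∷ F) uP* (≤-trans (s≤s (s≤s (s≤s (s≤s (s≤s lF)))))
               (≤-trans (m≤n+m 45 6) (≤-trans cp (≤-trans (cnt≤length (adj G p) P) (≤-reflexive lP)))))
        x = proj₁ xk
        ix = proj₁ (proj₂ xk)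
        nx = proj₂ (proj₂ xk)
        qk = pickAny (x ∷ p' ∷ y ∷ y' ∷ p ∷ F) uQ* (≤-trans (s≤s (s≤s (s≤s (s≤s (s≤s (s≤s lF))))))
               (≤-trans (m≤n+m 46 15) (≤-trans cy'Q (≤-trans (cnt≤length (adj G y') Q) (≤-reflexive lQ)))))
        q = proj₁ qk
        iq = proj₁ (proj₂ qk)
        nq = proj₂ (proj₂ qk)

  module Connecting {n : ℕ} (G : Graph n) (Vs : List (Fin n)) (uVs : Unique Vs) (a z g : ℕ)
    (H1 : ∀ {v} → v ∈ Vs → a + 2 * z ≤ cnt (adj G v) Vs)
    (H2 : ∀ A A' B B' → Vs ↭ A ++ A' → Vs ↭ B ++ B' → a ≤ length A → a ≤ length B →
          length Vs * length Vs ≤ g * Tiles.e G A B)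
    where
    open Tiles G
    open Trim G
    open Density G

    N : ℕ
    N = length Vs

    module Avail (𝒯 : List Tile) (good : All Good 𝒯) (R : List V) (part : Vs ↭ vertsT 𝒯 ++ R) (few : length R ≤ z) where

      D : List V
      D = vertsT 𝒯
      O : List Tile
      O = sides 𝒯

      uD : Unique D
      uD = Unique-++ˡ D (Unique-↭ part uVs)

      D⊆ : ∀ {v} → v ∈ D → v ∈ Vs
      D⊆ m = ∈-resp-↭ (↭-sym part) (∈-++⁺ˡ m)

      |D|≤N : length D ≤ N
      |D|≤N = ≤-trans (m≤m+n _ _) (≤-reflexive (sym (trans (↭-length part) (length-++ D))))

      degD : ∀ {v} → v ∈ Vs → a + z ≤ cnt (adj G v) D
      degD {v} m = linear {a = (a + 2 * z) + cnt (adj G v) R} {b = (cnt (adj G v) D + cnt (adj G v) R) + z} 0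
        (+-mono-≤ (≤-trans (H1 m) (≤-reflexive (trans (∑-↭ _ part) (∑-++ _ D R))))
                  (≤-trans (cnt≤length (adj G v) R) few))
        (lem a z (cnt (adj G v) D) (cnt (adj G v) R))
        where
        lem : ∀ a z d r → a + z + (d + r + z) + 0 ≡ d + (a + 2 * z + r)
        lem = solve-∀

      complement : ∀ A A' → D ↭ A ++ A' → Vs ↭ A ++ (A' ++ R)
      complement A A' p = ↭tr part (↭tr (++⁺ʳ R p) (↭-reflexive (++-assoc A A' R)))

      record Landing (r : Rung) (c : ℕ) (F : List V) : Set where
        field
          S : Tile
          S∈ : S ∈ O
          big : c ≤ length (proj₁ S)
          m₁ m₂ : Rung
          edge₁ : Edge m₁
          in₂ : InTile m₂ S
          link₀₁ : Link r m₁
          link₁₂ : Link m₁ m₂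
          fresh : Unique (flat (m₁ ∷ m₂ ∷ []) ++ F)
          inside : ∀ {v} → v ∈ flat (m₁ ∷ m₂ ∷ []) → v ∈ D

      landing : ∀ {x y c F} → x ∈ Vs → y ∈ Vs → 100 ≤ c → 100 ≤ z → g * (c * (length O * N)) < N * N →
        Unique F → length F ≤ 40 → Landing (x , y) c F
      landing {x} {y} {c} {F} ix iy 100≤c 100≤z dense uF lF =
        choose (∑-< _ (λ _ → c * length O) B (subst (_< ∑ (λ q → cnt (adj G q) A) B) (sym (∑-const (c * length O) B)) d₂))
        where
        fy : V → Bool
        fy v = adj G y v ∧ not (inᵇ F v)
        A B : List V
        A = sel (adj G x) D
        B = sel fy D
        lA : a ≤ length A
        lA = ≤-trans (m≤m+n a z) (≤-trans (degD ix) (≤-reflexive (sym (length-sel (adj G x) D))))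
        lB : a ≤ length B
        lB = +-cancelʳ-≤ z a (length B) (≤-trans (degD iy) (≤-trans (cnt-avoid (adj G y) F uD)
          (+-mono-≤ (≤-reflexive (sym (length-sel fy D))) (≤-trans lF (≤-trans (m≤n+m 40 60) 100≤z)))))
        h : N * N ≤ g * e A B
        h = H2 A _ B _ (complement A (rej (adj G x) D) (sel-rej (adj G x) D)) (complement B (rej fy D) (sel-rej fy D)) lA lB
        d₁ : c * (length O * N) < e A B
        d₁ = *-cancelˡ-< g _ _ (<-≤-trans dense h)
        |B|≤N : length B ≤ N
        |B|≤N = ≤-trans (≤-reflexive (length-sel fy D)) (≤-trans (cnt≤length fy D) |D|≤N)
        d₂ : c * length O * length B < ∑ (λ q → cnt (adj G q) A) B
        d₂ = ≤-<-trans (≤-trans (*-monoʳ-≤ (c * length O) |B|≤N) (≤-reflexive (*-assoc c (length O) N)))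
               (<-≤-trans d₁ (≤-reflexive (e-sym A B)))
        expand : ∀ q → cnt (adj G q) A ≡ ∑ (λ S → cnt (λ v → adj G q v ∧ adj G x v) (proj₁ S)) O
        expand q = trans (cnt-sel (adj G q) (adj G x) D) (trans (cong (cnt _) (vertsT≡U₁ 𝒯)) (∑-concatMap _ proj₁ O))
        choose : (∃ λ q → q ∈ B × c * length O < cnt (adj G q) A) → Landing (x , y) c F
        choose (q , iq , hq) = choose' (∑-< _ (λ _ → c) O (subst₂ _<_ (sym (∑-const c O)) (expand q) hq))
          where
          iqD = proj₁ (∈-sel⁻ fy D iq)
          ayq : y ~ q
          ayq = proj₁ (T-∧⁻ {adj G y q} (proj₂ (∈-sel⁻ fy D iq)))
          nq : q ∉ F
          nq m = T-not⁻ (proj₂ (T-∧⁻ {adj G y q} (proj₂ (∈-sel⁻ fy D iq)))) (inᵇ⁺ F m)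
          choose' : (∃ λ S → S ∈ O × c < cnt (λ v → adj G q v ∧ adj G x v) (proj₁ S)) → Landing (x , y) c F
          choose' (S , iS , hS) = record
            { S = S ; S∈ = iS ; big = <⇒≤ c<S ; m₁ = p , q ; m₂ = p* , p₂ ; edge₁ = ~sym qp
            ; in₂ = inj₂ (ip* , ip₂) ; link₀₁ = inj₁ (xp , ayq) ; link₁₂ = inj₁ (proj₁ gS ip ip* , qp₂)
            ; fresh = Unique-↭ (psolve 5 (λ s p₂ p q F → s ⊕ (p₂ ⊕ (p ⊕ (q ⊕ F))) ⊜ p ⊕ (q ⊕ (s ⊕ (p₂ ⊕ F)))) ↭-refl
                 [ p* ] [ p₂ ] [ p ] [ q ] F) (∉⇒All≢ np* ∷ (∉⇒All≢ np₂ ∷ (∉⇒All≢ np ∷ (∉⇒All≢ nq ∷ uF))))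
            ; inside = λ { (here refl) → ∈-side₁ 𝒯 iS ip ; (there (here refl)) → iqD
                         ; (there (there (here refl))) → ∈-side₂ 𝒯 iS ip*
                         ; (there (there (there (here refl)))) → ∈-side₁ 𝒯 iS ip₂ } }
            where
            gS : Good S
            gS = Good-side 𝒯 good iS
            c<S : c < length (proj₁ S)
            c<S = <-≤-trans hS (cnt≤length _ (proj₁ S))
            pk = pick (λ v → adj G q v ∧ adj G x v) (q ∷ F) (Unique-side₁ 𝒯 uD iS)
              (≤-trans (s≤s (s≤s lF)) (≤-trans (m≤n+m 42 58) (≤-trans 100≤c (<⇒≤ hS))))
            p = proj₁ pk
            ip = proj₁ (proj₂ pk)
            qp : q ~ p
            qp = proj₁ (T-∧⁻ {adj G q p} (proj₁ (proj₂ (proj₂ pk))))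
            xp : x ~ p
            xp = proj₂ (T-∧⁻ {adj G q p} (proj₁ (proj₂ (proj₂ pk))))
            np = proj₂ (proj₂ (proj₂ pk))
            p₂k = pick (λ v → adj G q v ∧ adj G x v) (p ∷ q ∷ F) (Unique-side₁ 𝒯 uD iS)
              (≤-trans (s≤s (s≤s (s≤s lF))) (≤-trans (m≤n+m 43 57) (≤-trans 100≤c (<⇒≤ hS))))
            p₂ = proj₁ p₂k
            ip₂ = proj₁ (proj₂ p₂k)
            qp₂ : q ~ p₂
            qp₂ = proj₁ (T-∧⁻ {adj G q p₂} (proj₁ (proj₂ (proj₂ p₂k))))
            np₂ = proj₂ (proj₂ (proj₂ p₂k))
            p*k = pickAny (p₂ ∷ p ∷ q ∷ F) (Unique-side₂ 𝒯 uD iS)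
              (≤-trans (s≤s (s≤s (s≤s (s≤s lF)))) (≤-trans (m≤n+m 44 56) (≤-trans 100≤c (≤-trans (<⇒≤ c<S) (≤-reflexive (proj₂ gS))))))
            p* = proj₁ p*k
            ip* = proj₁ (proj₂ p*k)
            np* = proj₂ (proj₂ p*k)

      record Reach (P : List V) : Set where
        field
          𝒜 : List Tile
          rest : List V
          dense : ∀ {Q} → Q ∈ 𝒜 → Q ∈ O × 100 * (length P + length (proj₁ Q)) < e P (proj₁ Q)
          split : D ↭ U₁ 𝒜 ++ rest
          large : a ≤ length (U₁ 𝒜)
          few𝒜 : length 𝒜 ≤ length O

      reach : ∀ {S c w} → S ∈ O → c ≤ length (proj₁ S) → 1 ≤ c → 100 * length O + w ≤ z → 100 * N ≤ c * w → Reach (proj₁ S)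
      reach {S} {c} {w} iS c≤P 1≤c hz hN = record
        { 𝒜 = 𝒜 ; rest = U₁ (rej f O) ; split = spl ; large = lg
        ; dense = λ {Q} m → let i , t = ∈-sel⁻ f O m in i , <ᵇ⇒< _ _ t
        ; few𝒜 = ≤-trans (≤-reflexive (length-sel f O)) (cnt≤length f O) }
        where
        P : List V
        P = proj₁ S
        f : Tile → Bool
        f Q = 100 * (length P + length (proj₁ Q)) <ᵇ e P (proj₁ Q)
        𝒜 : List Tile
        𝒜 = sel f O
        spl : D ↭ U₁ 𝒜 ++ U₁ (rej f O)
        spl = ↭tr (↭-reflexive (vertsT≡U₁ 𝒯)) (↭tr (concatMap-↭ proj₁ (sel-rej f O)) (↭-reflexive (concatMap-++ proj₁ 𝒜 (rej f O))))
        low : length P * (a + z) ≤ e P D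
        low = ≤-trans (≤-reflexive (trans (*-comm (length P) (a + z)) (sym (∑-const (a + z) P))))
          (∑-mono P (λ m → degD (D⊆ (∈-side₁ 𝒯 iS m))))
        upS : ∑ (λ Q → e P (proj₁ Q)) 𝒜 ≤ length P * length (U₁ 𝒜)
        upS = ≤-trans (∑-mono 𝒜 (λ {Q} _ → e≤ P (proj₁ Q)))
          (≤-reflexive (trans (∑-* (length P) _ 𝒜) (cong (length P *_) (sym (length-concatMap proj₁ 𝒜)))))
        upR : ∑ (λ Q → e P (proj₁ Q)) (rej f O) ≤ 100 * (length P * length O + length D)
        upR = ≤-trans (∑-mono (rej f O) (λ m → ≮⇒≥ (λ lt → proj₂ (∈-rej⁻ f O m) (<⇒<ᵇ lt))))
          (≤-trans (≤-trans (m≤n+m _ (∑ (λ Q → 100 * (length P + length (proj₁ Q))) 𝒜)) (≤-reflexive (sym (∑-sel-rej _ f O))))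
          (≤-reflexive (trans (∑-* 100 _ O) (cong (100 *_) (trans (∑-+ (λ _ → length P) _ O)
            (cong₂ _+_ (∑-const (length P) O) (trans (sym (length-concatMap proj₁ O)) (cong length (sym (vertsT≡U₁ 𝒯))))))))))
        up : e P D ≤ length P * length (U₁ 𝒜) + 100 * (length P * length O + length D)
        up = ≤-trans (≤-reflexive (trans (cong (e P) (vertsT≡U₁ 𝒯)) (trans (e-concatMap P proj₁ O) (∑-sel-rej _ f O)))) (+-mono-≤ upS upR)
        arith : ∀ p u o d → p * (a + z) ≤ p * u + 100 * (p * o + d) → d ≤ N → c ≤ p → 100 * o + w ≤ z → u < a → p ≤ 0
        arith p u o d h h₁ h₂ h₃ h₄ = linear
          {a = p * (a + z) + 100 * d + 100 * N + c * w + p * (100 * o + w) + p * suc u}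
          {b = p * u + 100 * (p * o + d) + 100 * N + c * w + p * w + p * z + p * a} 0
          (+-mono-≤ (+-mono-≤ (+-mono-≤ (+-mono-≤ (+-mono-≤ h (*-monoʳ-≤ 100 h₁)) hN) (*-monoˡ-≤ w h₂)) (*-monoʳ-≤ p h₃)) (*-monoʳ-≤ p h₄))
          (lem p u o d a z N (c * w) w)
          where
          lem : ∀ p u o d a z N cw w → p + (p * u + 100 * (p * o + d) + 100 * N + cw + p * w + p * z + p * a) + 0 ≡
            0 + (p * (a + z) + 100 * d + 100 * N + cw + p * (100 * o + w) + p * (1 + u))
          lem = solve-∀
        lg : a ≤ length (U₁ 𝒜)
        lg with <-or-≥ (length (U₁ 𝒜)) a
        ... | inj₂ h = h
        ... | inj₁ lt = ⊥-elim (<⇒≱ (≤-trans 1≤c c≤P) (arith (length P) (length (U₁ 𝒜)) (length O) (length D) (≤-trans low up) |D|≤N c≤P hz lt))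

      densePair : ∀ {P Q} (r : Reach P) (s : Reach Q) → g * (200 * (length O * N)) < N * N →
        ∃ λ S → ∃ λ S' → S ∈ Reach.𝒜 r × S' ∈ Reach.𝒜 s × 100 * (length (proj₁ S) + length (proj₁ S')) < e (proj₁ S) (proj₁ S')
      densePair r s hg = denseSides 100 r.𝒜 s.𝒜 (≤-<-trans bound (*-cancelˡ-< g _ _ (<-≤-trans hg h)))
        where
        module r = Reach r
        module s = Reach s
        h : N * N ≤ g * e (U₁ r.𝒜) (U₁ s.𝒜)
        h = H2 (U₁ r.𝒜) (r.rest ++ R) (U₁ s.𝒜) (s.rest ++ R) (complement (U₁ r.𝒜) r.rest r.split) (complement (U₁ s.𝒜) s.rest s.split) r.large s.large
        sz : ∀ {P} (r : Reach P) → length (U₁ (Reach.𝒜 r)) ≤ N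
        sz r = ≤-trans (≤-trans (m≤m+n _ _) (≤-reflexive (sym (trans (↭-length (Reach.split r)) (length-++ (U₁ (Reach.𝒜 r))))))) |D|≤N
        bound : 100 * (length (U₁ r.𝒜) * length s.𝒜 + length (U₁ s.𝒜) * length r.𝒜) ≤ 200 * (length O * N)
        bound = ≤-trans (*-monoʳ-≤ 100 (+-mono-≤ (*-mono-≤ (sz r) s.few𝒜) (*-mono-≤ (sz s) r.few𝒜)))
          (≤-reflexive (lem N (length O)))
          where
          lem : ∀ n o → 100 * (n * o + n * o) ≡ 200 * (o * n)
          lem = solve-∀

      bridgeSides : ∀ {S S' F} → S ∈ O → S' ∈ O → Unique F → length F ≤ 40 →
        100 * (length (proj₁ S) + length (proj₁ S')) < e (proj₁ S) (proj₁ S') → Bridge S S' D F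
      bridgeSides i j uF lF d = bridge (Good-side 𝒯 good i) (Good-side 𝒯 good j)
        (Unique-side₁ 𝒯 uD i) (Unique-side₂ 𝒯 uD i) (Unique-side₁ 𝒯 uD j) (Unique-side₂ 𝒯 uD j) uF lF
        (∈-side₁ 𝒯 i) (∈-side₂ 𝒯 i) (∈-side₁ 𝒯 j) (∈-side₂ 𝒯 j) d

      record Connection (r s : Rung) : Set where
        field
          ms : List Rung
          𝒯' : List Tile
          W : List V
          linked : Linked r ms s
          smaller : Pointwise⊑ 𝒯' 𝒯
          good' : All Good 𝒯'
          split : D ↭ flat ms ++ W ++ vertsT 𝒯'
          length-ms : length (flat ms) ≡ 26
          few' : length W ≤ 26

      module Assemble {r s : Rung} {c : ℕ} (l₁ : Landing r c []) (l₂ : Landing s c (flat (Landing.m₁ l₁ ∷ Landing.m₂ l₁ ∷ []) ++ []))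
        {S S' : Tile} (S∈ : S ∈ O) (S'∈ : S' ∈ O) where
        module l₁ = Landing l₁
        module l₂ = Landing l₂
        a₁ a₂ : List V
        a₁ = flat (l₁.m₁ ∷ l₁.m₂ ∷ [])
        a₂ = flat (l₂.m₁ ∷ l₂.m₂ ∷ [])

        module _ (b₁ : Bridge l₁.S S D (a₂ ++ a₁ ++ [])) where
          module b₁ = Bridge b₁
          c₁ : List V
          c₁ = flat (b₁.m₁ ∷ b₁.m₂ ∷ b₁.m₃ ∷ [])

          module _ (b₂ : Bridge S S' D (c₁ ++ a₂ ++ a₁ ++ [])) where
            module b₂ = Bridge b₂
            c₂ : List V
            c₂ = flat (b₂.m₁ ∷ b₂.m₂ ∷ b₂.m₃ ∷ [])

            module _ (b₃ : Bridge S' l₂.S D (c₂ ++ c₁ ++ a₂ ++ a₁ ++ [])) where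
              module b₃ = Bridge b₃
              c₃ F : List V
              c₃ = flat (b₃.m₁ ∷ b₃.m₂ ∷ b₃.m₃ ∷ [])
              F = c₃ ++ c₂ ++ c₁ ++ a₂ ++ a₁ ++ []
              ms : List Rung
              ms = l₁.m₁ ∷ l₁.m₂ ∷ b₁.m₁ ∷ b₁.m₂ ∷ b₁.m₃ ∷ b₂.m₁ ∷ b₂.m₂ ∷ b₂.m₃ ∷ b₃.m₁ ∷ b₃.m₂ ∷ b₃.m₃ ∷ l₂.m₂ ∷ l₂.m₁ ∷ []
              lnk : ∀ {Q r s} → Q ∈ O → InTile r Q → InTile s Q → Link r s
              lnk i p q = InTile⇒Link (proj₁ (Good-side 𝒯 good i)) p q
              edg : ∀ {Q r} → Q ∈ O → InTile r Q → Edge r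
              edg i p = InTile⇒Edge (proj₁ (Good-side 𝒯 good i)) p
              lk : Linked r ms s
              lk = hop l₁.link₀₁ l₁.edge₁ (hop l₁.link₁₂ (edg l₁.S∈ l₁.in₂)
                (hop (lnk l₁.S∈ l₁.in₂ b₁.in₁) (edg l₁.S∈ b₁.in₁) (hop b₁.link₁₂ b₁.edge₂ (hop b₁.link₂₃ (edg S∈ b₁.in₃)
                (hop (lnk S∈ b₁.in₃ b₂.in₁) (edg S∈ b₂.in₁) (hop b₂.link₁₂ b₂.edge₂ (hop b₂.link₂₃ (edg S'∈ b₂.in₃)
                (hop (lnk S'∈ b₂.in₃ b₃.in₁) (edg S'∈ b₃.in₁) (hop b₃.link₁₂ b₃.edge₂ (hop b₃.link₂₃ (edg l₂.S∈ b₃.in₃)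
                (hop (lnk l₂.S∈ b₃.in₃ l₂.in₂) (edg l₂.S∈ l₂.in₂) (hop (Link-sym l₂.link₁₂) l₂.edge₁ (link (Link-sym l₂.link₀₁))))))))))))))
              reorder : ∀ (a c₁ c₂ c₃ b₂ b₁ : List V) → a ++ c₁ ++ c₂ ++ c₃ ++ b₂ ++ b₁ ↭ c₃ ++ c₂ ++ c₁ ++ (b₁ ++ b₂) ++ a ++ []
              reorder = psolve 6 (λ a c₁ c₂ c₃ b₂ b₁ → a ⊕ (c₁ ⊕ (c₂ ⊕ (c₃ ⊕ (b₂ ⊕ b₁)))) ⊜ c₃ ⊕ (c₂ ⊕ (c₁ ⊕ ((b₁ ⊕ b₂) ⊕ (a ⊕ PS.id))))) ↭-refl
              ms↭F : flat ms ↭ F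
              ms↭F = reorder a₁ c₁ c₂ c₃ (flat (l₂.m₂ ∷ [])) (flat (l₂.m₁ ∷ []))
              F⊆ : ∀ {v} → v ∈ F → v ∈ D
              F⊆ m with ∈-++⁻ c₃ m
              ... | inj₁ m = b₃.inside m
              ... | inj₂ m with ∈-++⁻ c₂ m
              ...   | inj₁ m = b₂.inside m
              ...   | inj₂ m with ∈-++⁻ c₁ m
              ...     | inj₁ m = b₁.inside m
              ...     | inj₂ m with ∈-++⁻ a₂ m
              ...       | inj₁ m = l₂.inside m
              ...       | inj₂ m with ∈-++⁻ a₁ m
              ...         | inj₁ m = l₁.inside m
              connection : Connection r s
              connection with removeBalanced 𝒯 F good uD b₃.fresh F⊆
              ... | 𝒯' , W , sm , gd , sp , fw = record
                { ms = ms ; 𝒯' = 𝒯' ; W = W ; linked = lk ; smaller = sm ; good' = gd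
                ; split = ↭tr sp (++⁺ʳ _ (↭-sym ms↭F)) ; length-ms = refl ; few' = fw }

            step₃ : 100 * (length (proj₁ l₂.S) + length (proj₁ S')) < e (proj₁ l₂.S) (proj₁ S') → Connection r s
            step₃ d = connection (bridgeSides S'∈ l₂.S∈ b₂.fresh (m≤m+n 20 20)
              (subst₂ _<_ (cong (100 *_) (+-comm (length (proj₁ l₂.S)) (length (proj₁ S')))) (e-sym (proj₁ l₂.S) (proj₁ S')) d))

          step₂ : 100 * (length (proj₁ S) + length (proj₁ S')) < e (proj₁ S) (proj₁ S') →
            100 * (length (proj₁ l₂.S) + length (proj₁ S')) < e (proj₁ l₂.S) (proj₁ S') → Connection r s
          step₂ d = step₃ (bridgeSides S∈ S'∈ b₁.fresh (m≤m+n 14 26) d)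

        step₁ : 100 * (length (proj₁ l₁.S) + length (proj₁ S)) < e (proj₁ l₁.S) (proj₁ S) →
          100 * (length (proj₁ S) + length (proj₁ S')) < e (proj₁ S) (proj₁ S') →
          100 * (length (proj₁ l₂.S) + length (proj₁ S')) < e (proj₁ l₂.S) (proj₁ S') → Connection r s
        step₁ d = step₂ (bridgeSides l₁.S∈ S∈ l₂.fresh (m≤m+n 8 32) d)

      connect : ∀ {x y x' y' c w} → x ∈ Vs → y ∈ Vs → x' ∈ Vs → y' ∈ Vs → 200 ≤ c → 100 ≤ z →
        g * (c * (length O * N)) < N * N → 100 * length O + w ≤ z → 100 * N ≤ c * w → Connection (x , y) (x' , y')
      connect {x} {y} {x'} {y'} {c} {w} ix iy ix' iy' 200≤c 100≤z hg hz hN = withFirst (landing ix iy 100≤c 100≤z hg [] z≤n)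
        where
        100≤c : 100 ≤ c
        100≤c = ≤-trans (m≤n+m 100 100) 200≤c
        1≤c : 1 ≤ c
        1≤c = ≤-trans (s≤s z≤n) 100≤c
        hg' : g * (200 * (length O * N)) < N * N
        hg' = ≤-<-trans (*-monoʳ-≤ g (*-monoˡ-≤ (length O * N) 200≤c)) hg
        finish : (l₁ : Landing (x , y) c []) (l₂ : Landing (x' , y') c (flat (Landing.m₁ l₁ ∷ Landing.m₂ l₁ ∷ []) ++ []))
          (r₁ : Reach (proj₁ (Landing.S l₁))) (r₂ : Reach (proj₁ (Landing.S l₂))) →
          (∃ λ S → ∃ λ S' → S ∈ Reach.𝒜 r₁ × S' ∈ Reach.𝒜 r₂ ×
            100 * (length (proj₁ S) + length (proj₁ S')) < e (proj₁ S) (proj₁ S')) → Connection (x , y) (x' , y')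
        finish l₁ l₂ r₁ r₂ (S , S' , i , j , d) = Assemble.step₁ l₁ l₂ (proj₁ (Reach.dense r₁ i)) (proj₁ (Reach.dense r₂ j))
                (proj₂ (Reach.dense r₁ i)) d (proj₂ (Reach.dense r₂ j))
        withReach : (l₁ : Landing (x , y) c []) (l₂ : Landing (x' , y') c (flat (Landing.m₁ l₁ ∷ Landing.m₂ l₁ ∷ []) ++ [])) →
          Reach (proj₁ (Landing.S l₁)) → Reach (proj₁ (Landing.S l₂)) → Connection (x , y) (x' , y')
        withReach l₁ l₂ r₁ r₂ = finish l₁ l₂ r₁ r₂ (densePair r₁ r₂ hg')
        withBoth : (l₁ : Landing (x , y) c []) → Landing (x' , y') c (flat (Landing.m₁ l₁ ∷ Landing.m₂ l₁ ∷ []) ++ []) →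
          Connection (x , y) (x' , y')
        withBoth l₁ l₂ = withReach l₁ l₂ (reach {w = w} (Landing.S∈ l₁) (Landing.big l₁) 1≤c hz hN)
          (reach {w = w} (Landing.S∈ l₂) (Landing.big l₂) 1≤c hz hN)
        withFirst : Landing (x , y) c [] → Connection (x , y) (x' , y')
        withFirst l₁ = withBoth l₁ (landing ix' iy' 100≤c 100≤z hg (Landing.fresh l₁) (m≤m+n 4 36))

  -- Absorbing vertices into tiles

  pickMany : ∀ {n} (f : Fin n → Bool) {xs} k F → Unique xs → Unique F → k + length F ≤ cnt f xs →
    ∃ λ ys → length ys ≡ k × (∀ {y} → y ∈ ys → y ∈ xs × T (f y)) × Unique (ys ++ F)
  pickMany f zero F u uF h = [] , refl , (λ ()) , uF
  pickMany f (suc k) F u uF h with pickMany f k F u uF (<⇒≤ h)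
  ... | ys , l , p , uy with pick f (ys ++ F) u (subst (λ m → suc m ≤ _) (sym (trans (length-++ ys) (cong (_+ length F) l))) h)
  ...   | y , iy , fy , ny = y ∷ ys , cong suc l , (λ { (here refl) → iy , fy ; (there m) → p m }) , (∉⇒All≢ ny ∷ uy)

  pickSome : ∀ {n} {xs : List (Fin n)} k F → Unique xs → Unique F → k + length F ≤ length xs →
    ∃ λ ys → length ys ≡ k × (∀ {y} → y ∈ ys → y ∈ xs) × Unique (ys ++ F)
  pickSome {xs = xs} k F u uF h with pickMany (λ _ → true) k F u uF (≤-trans h (≤-reflexive (length≡∑ xs)))
  ... | ys , l , p , uy = ys , l , (λ m → proj₁ (p m)) , uy

  module Blocks {n : ℕ} (G : Graph n) where
    open Tiles G

    Replace-side : ∀ {X Y X' Y' BX BY 𝒯 𝒯' S k} → Replace (X , Y) (X' , Y') 𝒯 𝒯' → X ↭ BX ++ X' → Y ↭ BY ++ Y' →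
      length BX ≤ k → length BY ≤ k → S ∈ sides 𝒯 →
      ∃ λ S' → S' ∈ sides 𝒯' × (∀ f → cnt f (proj₁ S) ≤ k + cnt f (proj₁ S')) × (∀ f → cnt f (proj₂ S) ≤ k + cnt f (proj₂ S'))
    Replace-side {X} {Y} {X'} {Y'} {BX} {BY} {k = k} r pX pY lX lY m = go r m
      where
      loss : ∀ Z Z' BZ → Z ↭ BZ ++ Z' → length BZ ≤ k → ∀ f → cnt f Z ≤ k + cnt f Z'
      loss Z Z' BZ p l f = ≤-trans (≤-reflexive (trans (∑-↭ _ p) (∑-++ _ BZ Z')))
        (+-monoˡ-≤ (cnt f Z') (≤-trans (cnt≤length f BZ) l))
      same : ∀ Z f → cnt f Z ≤ k + cnt f Z
      same Z f = m≤n+m (cnt f Z) k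
      go : ∀ {𝒯 𝒯' S} → Replace (X , Y) (X' , Y') 𝒯 𝒯' → S ∈ sides 𝒯 →
        ∃ λ S' → S' ∈ sides 𝒯' × (∀ f → cnt f (proj₁ S) ≤ k + cnt f (proj₁ S')) × (∀ f → cnt f (proj₂ S) ≤ k + cnt f (proj₂ S'))
      go here (here refl) = _ , here refl , loss X X' BX pX lX , loss Y Y' BY pY lY
      go here (there (here refl)) = _ , there (here refl) , loss Y Y' BY pY lY , loss X X' BX pX lX
      go {S = S} here (there (there m)) = S , there (there m) , same (proj₁ S) , same (proj₂ S)
      go {S = S} (there r) (here refl) = S , here refl , same (proj₁ S) , same (proj₂ S)
      go {S = S} (there r) (there (here refl)) = S , there (here refl) , same (proj₁ S) , same (proj₂ S)
      go (there r) (there (there m)) with go r m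
      ... | S' , m' , p , q = S' , there (there m') , p , q

    record Update (P Q : List V) {r t : Rung} {𝒯 : List Tile} (c : Chain r 𝒯 t) (BP BQ new : List V) : Set where
      field
        𝒯' : List Tile
        c' : Chain r 𝒯' t
        good' : All Good 𝒯'
        same-length : length 𝒯' ≡ length 𝒯
        tiles : vertsT 𝒯 ↭ (BP ++ BQ) ++ vertsT 𝒯'
        chain : cverts c' ↭ new ++ cverts c
        side : ∀ {S k} → S ∈ sides 𝒯 → length BP ≤ k → length BQ ≤ k →
          ∃ λ S' → S' ∈ sides 𝒯' × (∀ f → cnt f (proj₁ S) ≤ k + cnt f (proj₁ S')) × (∀ f → cnt f (proj₂ S) ≤ k + cnt f (proj₂ S'))

    sub⇒ : ∀ {P B P' : List V} → P ↭ B ++ P' → ∀ {v} → v ∈ P' → v ∈ P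
    sub⇒ {B = B} p m = ∈-resp-↭ (↭-sym p) (∈-++⁺ʳ B m)

    update : ∀ {P Q P' Q' BP BQ r t 𝒯 p q} (c : Chain r 𝒯 t) → All Good 𝒯 → (P , Q) ∈ sides 𝒯 →
      P ↭ BP ++ P' → Q ↭ BQ ++ Q' → length BP ≡ length BQ →
      InTile p (P , Q) → InTile q (P , Q) → (b : Chain p [] q) → Update P Q c BP BQ (cverts b)
    update {P} {Q} {P'} {Q'} {BP} {BQ} {𝒯 = 𝒯} c good i pP pQ leq ip iq b with ∈-sides 𝒯 i
    ... | .(P , Q) , iT , inj₁ refl with replace (P' , Q') iT
    ...   | 𝒯' , rp with insert rp (proj₁ (Good-side 𝒯 good i)) (sub⇒ pP , sub⇒ pQ) ip iq b c
    ...     | c' , eq = record { 𝒯' = 𝒯' ; c' = c' ; good' = Replace-All rp g' good ; same-length = Replace-length rp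
              ; tiles = Replace-verts rp (↭tr (++⁺ pP pQ) (psolve 4 (λ a b c d → (a ⊕ b) ⊕ (c ⊕ d) ⊜ (a ⊕ c) ⊕ (b ⊕ d)) ↭-refl BP P' BQ Q'))
              ; chain = eq ; side = λ m l l' → Replace-side rp pP pQ l l' m }
      where
      g = Good-side 𝒯 good i
      g' : Good (P' , Q')
      g' = (λ x y → proj₁ g (sub⇒ pP x) (sub⇒ pQ y)) , +-cancelˡ-≡ (length BP) _ _
        (trans (sym (trans (↭-length pP) (length-++ BP))) (trans (proj₂ g) (trans (trans (↭-length pQ) (length-++ BQ)) (cong (_+ length Q') (sym leq)))))
    update {P} {Q} {P'} {Q'} {BP} {BQ} {𝒯 = 𝒯} c good i pP pQ leq ip iq b | .(Q , P) , iT , inj₂ refl with replace (Q' , P') iT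
    ...   | 𝒯' , rp with insert rp (proj₁ (Good-swap (Good-side 𝒯 good i))) (sub⇒ pQ , sub⇒ pP) (InTile-oriented (inj₂ refl) ip) (InTile-oriented (inj₂ refl) iq) b c
    ...     | c' , eq = record { 𝒯' = 𝒯' ; c' = c' ; good' = Replace-All rp g' good ; same-length = Replace-length rp
              ; tiles = Replace-verts rp (↭tr (++⁺ pQ pP) (psolve 4 (λ a b c d → (c ⊕ d) ⊕ (a ⊕ b) ⊜ (a ⊕ c) ⊕ (d ⊕ b)) ↭-refl BP P' BQ Q'))
              ; chain = eq ; side = λ m l l' → Replace-side rp pQ pP l' l m }
      where
      g = Good-swap (Good-side 𝒯 good i)
      g' : Good (Q' , P')
      g' = (λ x y → proj₁ g (sub⇒ pQ x) (sub⇒ pP y)) , +-cancelˡ-≡ (length BQ) _ _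
        (trans (sym (trans (↭-length pQ) (length-++ BQ))) (trans (proj₂ g) (trans (trans (↭-length pP) (length-++ BP)) (cong (_+ length P') leq))))

    record Exchanged {P Q : List V} (w q : V) {r t : Rung} {𝒯 : List Tile} (c : Chain r 𝒯 t) : Set where
      field
        {BP BQ new} : List V
        updated : Update P Q c BP (q ∷ BQ) new
        length-BP : length BP ≡ 3
        length-BQ : length BQ ≡ 2
        new↭ : new ↭ w ∷ BP ++ BQ

    Some : (V → Set) → ℕ → List V → Set
    Some K k F = ∃ λ ys → length ys ≡ k × (∀ {y} → y ∈ ys → K y) × Unique (ys ++ F)

    -- q leaves the side Q of the tile (P , Q), and w takes its place.
    exchange : ∀ {P Q w q r t 𝒯} (c : Chain r 𝒯 t) → All Good 𝒯 → Unique (vertsT 𝒯) → (P , Q) ∈ sides 𝒯 →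
      q ∈ Q → 3 ≤ cnt (adj G w) P → Exchanged {P} {Q} w q c
    exchange {P} {Q} {w} {q} {𝒯 = 𝒯} c good u i iq hw =
      go (pickMany (adj G w) 3 [] (Unique-side₁ 𝒯 u i) [] hw)
         (pickSome 2 (q ∷ []) (Unique-side₂ 𝒯 u i) ([] ∷ []) (≤-trans hw (≤-trans (cnt≤length (adj G w) P) (≤-reflexive (proj₂ (Good-side 𝒯 good i))))))
      where
      go : Some (λ y → y ∈ P × w ~ y) 3 [] → Some (_∈ Q) 2 (q ∷ []) → Exchanged {P} {Q} w q c
      go (y₁ ∷ y₂ ∷ y₃ ∷ [] , refl , py , uy) (x₁ ∷ x₂ ∷ [] , refl , px , ux) = record
        { updated = update {BP = y₁ ∷ y₂ ∷ y₃ ∷ []} {BQ = q ∷ x₁ ∷ x₂ ∷ []} c good i (proj₂ sP) (proj₂ sQ) refl (inj₂ (ix₁ , iy₁)) (inj₂ (ix₂ , iy₃)) b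
        ; length-BP = refl ; length-BQ = refl ; new↭ = perm [ x₁ ] [ y₁ ] [ w ] [ y₂ ] [ x₂ ] [ y₃ ] }
        where
        perm : ∀ (x₁ y₁ w y₂ x₂ y₃ : List V) → x₁ ++ y₁ ++ w ++ y₂ ++ x₂ ++ y₃ ↭ w ++ y₁ ++ y₂ ++ y₃ ++ x₁ ++ x₂
        perm = psolve 6 (λ x₁ y₁ w y₂ x₂ y₃ → x₁ ⊕ (y₁ ⊕ (w ⊕ (y₂ ⊕ (x₂ ⊕ y₃)))) ⊜ w ⊕ (y₁ ⊕ (y₂ ⊕ (y₃ ⊕ (x₁ ⊕ x₂))))) ↭-refl
        sP : ∃ λ P' → P ↭ (y₁ ∷ y₂ ∷ y₃ ∷ []) ++ P'
        sP = ⊆⇒↭ uy (λ m → proj₁ (py m))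
        sQ : ∃ λ Q' → Q ↭ (q ∷ x₁ ∷ x₂ ∷ []) ++ Q'
        sQ = ⊆⇒↭ (Unique-↭ (shift q (x₁ ∷ x₂ ∷ []) []) ux) (λ { (here refl) → iq ; (there m) → px m })
        co : Complete P Q
        co = proj₁ (Good-side 𝒯 good i)
        ix₁ = px (here refl)
        ix₂ = px (there (here refl))
        iy₁ = proj₁ (py (here refl))
        iy₂ = proj₁ (py (there (here refl)))
        iy₃ = proj₁ (py (there (there (here refl))))
        b : Chain (x₁ , y₁) [] (x₂ , y₃)
        b = step {s = w , y₂} (~sym (co iy₁ ix₁)) (inj₂ (~sym (co iy₂ ix₁) , ~sym (proj₂ (py (here refl)))))
           (step {s = x₂ , y₃} (proj₂ (py (there (here refl)))) (inj₂ (proj₂ (py (there (there (here refl)))) , co iy₂ ix₂))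
           (end (~sym (co iy₃ ix₂))))

    record Added {P Q : List V} (p q : V) {r t : Rung} {𝒯 : List Tile} (c : Chain r 𝒯 t) : Set where
      field
        {BP BQ new} : List V
        updated : Update P Q c BP BQ new
        length-BP : length BP ≡ 5
        length-BQ : length BQ ≡ 5
        new↭ : new ↭ p ∷ q ∷ BP ++ BQ

    -- p joins the side P and q the side Q of the tile (P , Q).
    addPair : ∀ {P Q p q r t 𝒯} (c : Chain r 𝒯 t) → All Good 𝒯 → Unique (vertsT 𝒯) → (P , Q) ∈ sides 𝒯 →
      5 ≤ cnt (adj G p) Q → 5 ≤ cnt (adj G q) P → Added {P} {Q} p q c
    addPair {P} {Q} {p} {q} {𝒯 = 𝒯} c good u i hp hq =
      go₁ (pickMany (adj G q) 3 [] (Unique-side₁ 𝒯 u i) [] (≤-trans (m≤n+m 3 2) hq))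
          (pickMany (adj G p) 3 [] (Unique-side₂ 𝒯 u i) [] (≤-trans (m≤n+m 3 2) hp))
      where
      go₂ : ∀ v₁ v₂ v₃ y₁ y₂ y₃ → (∀ {v} → v ∈ v₁ ∷ v₂ ∷ v₃ ∷ [] → v ∈ P × q ~ v) → (∀ {y} → y ∈ y₁ ∷ y₂ ∷ y₃ ∷ [] → y ∈ Q × p ~ y) →
        Some (_∈ P) 2 (v₁ ∷ v₂ ∷ v₃ ∷ []) → Some (_∈ Q) 2 (y₁ ∷ y₂ ∷ y₃ ∷ []) → Added {P} {Q} p q c
      go₂ v₁ v₂ v₃ y₁ y₂ y₃ pv py (x₁ ∷ x₂ ∷ [] , refl , px , ux) (u₁ ∷ u₂ ∷ [] , refl , pu , uu) = record
        { updated = update {BP = x₁ ∷ x₂ ∷ v₁ ∷ v₂ ∷ v₃ ∷ []} {BQ = u₁ ∷ u₂ ∷ y₁ ∷ y₂ ∷ y₃ ∷ []} c good i (proj₂ sP) (proj₂ sQ) refl (inj₁ (ix₁ , iy₁)) (inj₁ (iv₃ , iu₂)) b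
        ; length-BP = refl ; length-BQ = refl ; new↭ = perm }
        where
        sP : ∃ λ P' → P ↭ (x₁ ∷ x₂ ∷ v₁ ∷ v₂ ∷ v₃ ∷ []) ++ P'
        sP = ⊆⇒↭ ux (λ { (here refl) → px (here refl) ; (there (here refl)) → px (there (here refl)) ; (there (there m)) → proj₁ (pv m) })
        sQ : ∃ λ Q' → Q ↭ (u₁ ∷ u₂ ∷ y₁ ∷ y₂ ∷ y₃ ∷ []) ++ Q'
        sQ = ⊆⇒↭ uu (λ { (here refl) → pu (here refl) ; (there (here refl)) → pu (there (here refl)) ; (there (there m)) → proj₁ (py m) })
        co : Complete P Q
        co = proj₁ (Good-side 𝒯 good i)
        ix₁ = px (here refl)
        ix₂ = px (there (here refl))
        iu₁ = pu (here refl)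
        iu₂ = pu (there (here refl))
        iy₁ = proj₁ (py (here refl))
        iy₂ = proj₁ (py (there (here refl)))
        iy₃ = proj₁ (py (there (there (here refl))))
        iv₁ = proj₁ (pv (here refl))
        iv₂ = proj₁ (pv (there (here refl)))
        iv₃ = proj₁ (pv (there (there (here refl))))
        b : Chain (x₁ , y₁) [] (v₃ , u₂)
        b = step {s = p , y₂} (co ix₁ iy₁) (inj₂ (co ix₁ iy₂ , ~sym (proj₂ (py (here refl)))))
           (step {s = x₂ , y₃} (proj₂ (py (there (here refl)))) (inj₂ (proj₂ (py (there (there (here refl)))) , ~sym (co ix₂ iy₂)))
           (step {s = v₁ , u₁} (co ix₂ iy₃) (inj₂ (co ix₂ iu₁ , ~sym (co iv₁ iy₃)))
           (step {s = v₂ , q} (co iv₁ iu₁) (inj₂ (~sym (proj₂ (pv (here refl))) , ~sym (co iv₂ iu₁)))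
           (step {s = v₃ , u₂} (~sym (proj₂ (pv (there (here refl))))) (inj₂ (co iv₂ iu₂ , proj₂ (pv (there (there (here refl))))))
           (end (co iv₃ iu₂))))))
        perm : cverts b ↭ p ∷ q ∷ (x₁ ∷ x₂ ∷ v₁ ∷ v₂ ∷ v₃ ∷ []) ++ (u₁ ∷ u₂ ∷ y₁ ∷ y₂ ∷ y₃ ∷ [])
        perm = ↭tr (blocks₁ [ x₁ ] [ y₁ ] [ p ] [ y₂ ] [ x₂ ] [ y₃ ] (v₁ ∷ u₁ ∷ v₂ ∷ q ∷ v₃ ∷ u₂ ∷ []))
              (↭tr (++⁺ˡ (p ∷ x₁ ∷ x₂ ∷ y₁ ∷ y₂ ∷ y₃ ∷ []) (blocks₂ [ v₁ ] [ u₁ ] [ v₂ ] [ q ] [ v₃ ] [ u₂ ]))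
                (blocks₃ [ p ] (x₁ ∷ x₂ ∷ []) (y₁ ∷ y₂ ∷ y₃ ∷ []) [ q ] (v₁ ∷ v₂ ∷ v₃ ∷ []) (u₁ ∷ u₂ ∷ [])))
          where
          blocks₁ : ∀ (x₁ y₁ p y₂ x₂ y₃ r : List V) → x₁ ++ y₁ ++ p ++ y₂ ++ x₂ ++ y₃ ++ r ↭ p ++ x₁ ++ x₂ ++ y₁ ++ y₂ ++ y₃ ++ r
          blocks₁ = psolve 7 (λ x₁ y₁ p y₂ x₂ y₃ r → x₁ ⊕ (y₁ ⊕ (p ⊕ (y₂ ⊕ (x₂ ⊕ (y₃ ⊕ r))))) ⊜ p ⊕ (x₁ ⊕ (x₂ ⊕ (y₁ ⊕ (y₂ ⊕ (y₃ ⊕ r)))))) ↭-refl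
          blocks₂ : ∀ (v₁ u₁ v₂ q v₃ u₂ : List V) → v₁ ++ u₁ ++ v₂ ++ q ++ v₃ ++ u₂ ↭ q ++ v₁ ++ v₂ ++ v₃ ++ u₁ ++ u₂
          blocks₂ = psolve 6 (λ v₁ u₁ v₂ q v₃ u₂ → v₁ ⊕ (u₁ ⊕ (v₂ ⊕ (q ⊕ (v₃ ⊕ u₂)))) ⊜ q ⊕ (v₁ ⊕ (v₂ ⊕ (v₃ ⊕ (u₁ ⊕ u₂))))) ↭-refl
          blocks₃ : ∀ (p x y q v u : List V) → p ++ x ++ y ++ q ++ v ++ u ↭ p ++ q ++ (x ++ v) ++ (u ++ y)
          blocks₃ = psolve 6 (λ p x y q v u → p ⊕ (x ⊕ (y ⊕ (q ⊕ (v ⊕ u)))) ⊜ p ⊕ (q ⊕ ((x ⊕ v) ⊕ (u ⊕ y)))) ↭-refl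

      go₁ : Some (λ v → v ∈ P × q ~ v) 3 [] → Some (λ y → y ∈ Q × p ~ y) 3 [] → Added {P} {Q} p q c
      go₁ (v₁ ∷ v₂ ∷ v₃ ∷ [] , refl , pv , uv) (y₁ ∷ y₂ ∷ y₃ ∷ [] , refl , py , uy) = go₂ v₁ v₂ v₃ y₁ y₂ y₃ pv py
        (pickSome 2 (v₁ ∷ v₂ ∷ v₃ ∷ []) (Unique-side₁ 𝒯 u i) uv (≤-trans hq (cnt≤length (adj G q) P)))
        (pickSome 2 (y₁ ∷ y₂ ∷ y₃ ∷ []) (Unique-side₂ 𝒯 u i) uy (≤-trans hp (cnt≤length (adj G p) Q)))

  shuffle₃ : ∀ {A : Set} (C w w' W B q B' E E' D : List A) →
    C ++ (w ++ w' ++ W) ++ (B ++ q ++ B') ++ (E ++ E') ++ D ↭ ((q ++ w' ++ E ++ E') ++ (w ++ B ++ B') ++ C) ++ W ++ D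
  shuffle₃ = psolve 10 (λ C w w' W B q B' E E' D →
    C ⊕ ((w ⊕ (w' ⊕ W)) ⊕ ((B ⊕ (q ⊕ B')) ⊕ ((E ⊕ E') ⊕ D))) ⊜ ((q ⊕ (w' ⊕ (E ⊕ E'))) ⊕ ((w ⊕ (B ⊕ B')) ⊕ C)) ⊕ (W ⊕ D)) ↭-refl

  module Absorbing {n : ℕ} (G : Graph n) (Vs : List (Fin n)) (uVs : Unique Vs) (a z g : ℕ)
    (H1 : ∀ {v} → v ∈ Vs → a + 2 * z ≤ cnt (adj G v) Vs)
    (H2 : ∀ A A' B B' → Vs ↭ A ++ A' → Vs ↭ B ++ B' → a ≤ length A → a ≤ length B →
          length Vs * length Vs ≤ g * Tiles.e G A B)
    where
    open Tiles G
    open Blocks G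
    open Connecting G Vs uVs a z g H1 H2

    module Fitting (𝒯 : List Tile) (good : All Good 𝒯) (R : List V) (part : Vs ↭ vertsT 𝒯 ++ R) (few : length R ≤ z)
      (few𝒯 : 20 * length (sides 𝒯) ≤ z) (sparse : g * (20 * (length (sides 𝒯) * N)) < N * N) where
      open Avail 𝒯 good R part few

      fit : V → Tile → Bool
      fit w S = 20 ≤ᵇ cnt (adj G w) (proj₁ S)

      fits : V → List Tile
      fits w = sel (fit w) O

      split-fits : ∀ w → D ↭ U₂ (fits w) ++ U₂ (rej (fit w) O)
      split-fits w = ↭tr (vertsT↭U₂ 𝒯) (↭tr (concatMap-↭ proj₂ (sel-rej (fit w) O)) (↭-reflexive (concatMap-++ proj₂ (fits w) (rej (fit w) O))))

      many-fits : ∀ {w} → w ∈ Vs → a ≤ length (U₂ (fits w))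
      many-fits {w} iw = +-cancelʳ-≤ z a _ (≤-trans (degD iw) (≤-trans (≤-reflexive count) (+-mono-≤ lower upper)))
        where
        count : cnt (adj G w) D ≡ ∑ (λ S → cnt (adj G w) (proj₁ S)) (fits w) + ∑ (λ S → cnt (adj G w) (proj₁ S)) (rej (fit w) O)
        count = trans (cong (cnt (adj G w)) (vertsT≡U₁ 𝒯)) (trans (∑-concatMap _ proj₁ O) (∑-sel-rej _ (fit w) O))
        lower : ∑ (λ S → cnt (adj G w) (proj₁ S)) (fits w) ≤ length (U₂ (fits w))
        lower = ≤-trans (∑-mono (fits w) (λ {S} m → ≤-trans (cnt≤length _ (proj₁ S))
          (≤-reflexive (proj₂ (Good-side 𝒯 good (proj₁ (∈-sel⁻ (fit w) O m))))))) (≤-reflexive (sym (length-concatMap proj₂ (fits w))))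
        upper : ∑ (λ S → cnt (adj G w) (proj₁ S)) (rej (fit w) O) ≤ z
        upper = ≤-trans (∑-mono (rej (fit w) O) (λ {S} m → <⇒≤ (≰⇒> (λ le → proj₂ (∈-rej⁻ (fit w) O m) (≤⇒≤ᵇ le)))))
          (≤-trans (≤-reflexive (∑-const 20 (rej (fit w) O))) (≤-trans (*-monoʳ-≤ 20 (≤-trans (m≤n+m _ (length (fits w)))
            (≤-reflexive (sym (length-sel-rej (fit w) O))))) few𝒯))

      -- w can replace some q, and q and w' then fit opposite sides of a common tile.
      findExchange : ∀ {w w'} → w ∈ Vs → w' ∈ Vs → ∃ λ S → ∃ λ S' → ∃ λ q → S ∈ O × S' ∈ O × q ∈ proj₂ S ×
        20 ≤ cnt (adj G w) (proj₁ S) × 20 ≤ cnt (adj G w') (proj₁ S') × 20 ≤ cnt (adj G q) (proj₂ S')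
      findExchange {w} {w'} iw iw' = go₁ (∑-< (λ q → cnt (adj G q) (U₂ (fits w'))) (λ _ → 20 * length O) (U₂ (fits w)) dense)
        where
        h : N * N ≤ g * e (U₂ (fits w)) (U₂ (fits w'))
        h = H2 (U₂ (fits w)) (U₂ (rej (fit w) O) ++ R) (U₂ (fits w')) (U₂ (rej (fit w') O) ++ R)
          (complement (U₂ (fits w)) _ (split-fits w)) (complement (U₂ (fits w')) _ (split-fits w')) (many-fits iw) (many-fits iw')
        small : length (U₂ (fits w)) ≤ N
        small = ≤-trans (≤-trans (m≤m+n _ _) (≤-reflexive (sym (trans (↭-length (split-fits w)) (length-++ (U₂ (fits w))))))) |D|≤N
        dense : ∑ (λ _ → 20 * length O) (U₂ (fits w)) < e (U₂ (fits w)) (U₂ (fits w'))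
        dense = ≤-<-trans (≤-trans (≤-reflexive (∑-const (20 * length O) (U₂ (fits w))))
          (≤-trans (*-monoʳ-≤ (20 * length O) small) (≤-reflexive (*-assoc 20 (length O) N))))
          (*-cancelˡ-< g _ _ (<-≤-trans sparse h))
        Result : Set
        Result = ∃ λ S → ∃ λ S' → ∃ λ q → S ∈ O × S' ∈ O × q ∈ proj₂ S ×
          20 ≤ cnt (adj G w) (proj₁ S) × 20 ≤ cnt (adj G w') (proj₁ S') × 20 ≤ cnt (adj G q) (proj₂ S')
        go₃ : ∀ {q S'} → S' ∈ fits w' → 20 < cnt (adj G q) (proj₂ S') → (∃ λ S → S ∈ fits w × q ∈ proj₂ S) → Result
        go₃ {q} {S'} iS' hS' (S , iS , iqS) = S , S' , q , proj₁ (∈-sel⁻ (fit w) O iS) , proj₁ (∈-sel⁻ (fit w') O iS') , iqS ,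
                ≤ᵇ⇒≤ 20 _ (proj₂ (∈-sel⁻ (fit w) O iS)) , ≤ᵇ⇒≤ 20 _ (proj₂ (∈-sel⁻ (fit w') O iS')) , <⇒≤ hS'
        go₂ : ∀ {q} → q ∈ U₂ (fits w) → (∃ λ S' → S' ∈ fits w' × 20 < cnt (adj G q) (proj₂ S')) → Result
        go₂ iq (S' , iS' , hS') = go₃ iS' hS' (∈-concatMap⁻ proj₂ (fits w) iq)
        go₁ : (∃ λ q → q ∈ U₂ (fits w) × 20 * length O < cnt (adj G q) (U₂ (fits w'))) → Result
        go₁ (q , iq , hq) = go₂ iq (∑-< (λ S' → cnt (adj G q) (proj₂ S')) (λ _ → 20) (fits w') hq')
          where
          hq' : ∑ (λ _ → 20) (fits w') < ∑ (λ S' → cnt (adj G q) (proj₂ S')) (fits w')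
          hq' = ≤-<-trans (≤-trans (≤-reflexive (∑-const 20 (fits w'))) (*-monoʳ-≤ 20 (≤-trans (≤-reflexive (length-sel (fit w') O)) (cnt≤length (fit w') O))))
              (<-≤-trans hq (≤-reflexive (∑-concatMap _ proj₂ (fits w'))))

    record State (r t : Rung) (W : List V) (k m : ℕ) : Set where
      field
        𝒯 : List Tile
        chain : Chain r 𝒯 t
        good : All Good 𝒯
        number : length 𝒯 ≡ k
        part : Vs ↭ cverts chain ++ W ++ vertsT 𝒯
        length-chain : length (cverts chain) ≡ m

    module _ {r t : Rung} {k : ℕ} (few𝒯 : 20 * (2 * k) ≤ z) (sparse : g * (20 * (2 * k * N)) < N * N) where

      absorbPair : ∀ {w w' W m} → State r t (w ∷ w' ∷ W) k m → m + 9 * (2 + length W) ≤ z → State r t W k (18 + m)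
      absorbPair {w} {w'} {W} {m} s hz = withExchange (findExchange (∈-resp-↭ (↭-sym part) (∈-++⁺ʳ (cverts chain) (here refl)))
                                          (∈-resp-↭ (↭-sym part) (∈-++⁺ʳ (cverts chain) (there (here refl)))))
        where
        open State s
        R : List V
        R = cverts chain ++ w ∷ w' ∷ W
        few : length R ≤ z
        few = ≤-trans (≤-reflexive (trans (length-++ (cverts chain)) (cong (_+ (2 + length W)) length-chain)))
          (≤-trans (+-monoʳ-≤ m (m≤n*m (2 + length W) 9)) hz)
        part' : Vs ↭ vertsT 𝒯 ++ R
        part' = ↭tr part (psolve 3 (λ a b c → a ⊕ (b ⊕ c) ⊜ c ⊕ (a ⊕ b)) ↭-refl (cverts chain) (w ∷ w' ∷ W) (vertsT 𝒯))
        sides-k : length (sides 𝒯) ≡ 2 * k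
        sides-k = trans (length-sides 𝒯) (cong (2 *_) number)
        open Fitting 𝒯 good R part' few (subst (λ o → 20 * o ≤ z) (sym sides-k) few𝒯)
          (subst (λ o → g * (20 * (o * N)) < N * N) (sym sides-k) sparse)
        open Avail 𝒯 good R part' few using (O; uD)

        combine : ∀ {P Q q} (x : Exchanged {P} {Q} w q chain) → (∃ λ S → (S ∈ sides (Update.𝒯' (Exchanged.updated x))) ×
          Added {proj₁ S} {proj₂ S} q w' (Update.c' (Exchanged.updated x))) → State r t W k (18 + m)
        combine {q = q} x (S , iS , y) = record
          { 𝒯 = u₂.𝒯' ; chain = u₂.c' ; good = u₂.good' ; number = trans u₂.same-length (trans u₁.same-length number)
          ; part = ↭tr part (↭tr (++⁺ˡ (cverts chain) (++⁺ˡ (w ∷ w' ∷ W) (↭tr u₁.tiles (++⁺ˡ _ u₂.tiles))))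
              (↭tr (shuffle₃ (cverts chain) [ w ] [ w' ] W x.BP [ q ] x.BQ y.BP y.BQ (vertsT u₂.𝒯')) (++⁺ʳ _ (↭-sym c₂↭))))
          ; length-chain = trans (↭-length c₂↭) len }
          where
          module x = Exchanged x
          module y = Added y
          module u₁ = Update x.updated
          module u₂ = Update y.updated
          c₂↭ : cverts u₂.c' ↭ ((q ∷ w' ∷ y.BP ++ y.BQ) ++ (w ∷ x.BP ++ x.BQ) ++ cverts chain)
          c₂↭ = ↭tr u₂.chain (++⁺ y.new↭ (↭tr u₁.chain (++⁺ʳ _ x.new↭)))
          len : length ((q ∷ w' ∷ y.BP ++ y.BQ) ++ (w ∷ x.BP ++ x.BQ) ++ cverts chain) ≡ 18 + m
          len = trans (length-++ (q ∷ w' ∷ y.BP ++ y.BQ)) (cong₂ _+_ (cong (2 +_) (trans (length-++ y.BP) (cong₂ _+_ y.length-BP y.length-BQ)))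
            (trans (length-++ (w ∷ x.BP ++ x.BQ)) (cong₂ _+_ (cong suc (trans (length-++ x.BP) (cong₂ _+_ x.length-BP x.length-BQ))) length-chain)))

        withAdded : ∀ {P Q q S'} → Exchanged {P} {Q} w q chain → S' ∈ O → 20 ≤ cnt (adj G w') (proj₁ S') → 20 ≤ cnt (adj G q) (proj₂ S') →
          State r t W k (18 + m)
        withAdded {q = q} x iS' hw' hq with Update.side (Exchanged.updated x) {k = 3} iS' (≤-reflexive (Exchanged.length-BP x))
                                     (≤-reflexive (cong suc (Exchanged.length-BQ x)))
        ... | S₁ , iS₁ , l₁ , l₂ = combine x (S₁ , iS₁ , addPair (Update.c' (Exchanged.updated x)) (Update.good' (Exchanged.updated x))
            (Unique-++ʳ _ (Unique-↭ (Update.tiles (Exchanged.updated x)) uD)) iS₁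
            (≤-trans (m≤n+m 5 12) (+-cancelˡ-≤ 3 17 _ (≤-trans hq (l₂ _)))) (≤-trans (m≤n+m 5 12) (+-cancelˡ-≤ 3 17 _ (≤-trans hw' (l₁ _)))))

        withExchange : (∃ λ S → ∃ λ S' → ∃ λ q → S ∈ O × S' ∈ O × q ∈ proj₂ S ×
          20 ≤ cnt (adj G w) (proj₁ S) × 20 ≤ cnt (adj G w') (proj₁ S') × 20 ≤ cnt (adj G q) (proj₂ S')) → State r t W k (18 + m)
        withExchange (S , S' , q , iS , iS' , iq , hw , hw' , hq) =
          withAdded (exchange chain good uD iS iq (≤-trans (m≤n+m 3 17) hw)) iS' hw' hq

      absorbAll : ∀ W {m} → 2 ∣ length W → State r t W k m → m + 9 * length W ≤ z → ∃ λ m' → State r t [] k m'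
      absorbAll [] ev s hz = _ , s
      absorbAll (w ∷ []) ev s hz with () ← ∣1⇒≡1 ev
      absorbAll (w ∷ w' ∷ W) {m} ev s hz = absorbAll W (∣m+n∣m⇒∣n ev ∣-refl) (absorbPair s hz)
        (≤-trans (≤-reflexive (lem m (length W))) hz)
        where
        lem : ∀ m l → 18 + m + 9 * l ≡ m + 9 * (2 + l)
        lem = solve-∀

    finish : ∀ {r t k m} → State r t [] k m → Σ (Chain r [] t) λ c → Vs ↭ cverts c
    finish s = let c , p = flush good chain in c , ↭tr part (↭-sym p)
      where open State s

  -- Stringing the tiles together

  module Stringing {n : ℕ} (G : Graph n) (Vs : List (Fin n)) (uVs : Unique Vs) (a z g : ℕ)
    (H1 : ∀ {v} → v ∈ Vs → a + 2 * z ≤ cnt (adj G v) Vs)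
    (H2 : ∀ A A' B B' → Vs ↭ A ++ A' → Vs ↭ B ++ B' → a ≤ length A → a ≤ length B →
          length Vs * length Vs ≤ g * Tiles.e G A B)
    where
    open Tiles G
    open Connecting G Vs uVs a z g H1 H2
    open Absorbing G Vs uVs a z g H1 H2 using (State)

    Replace-mid : ∀ {T T'} 𝒯a {𝒯b} → Replace T T' (𝒯a ++ T ∷ 𝒯b) (𝒯a ++ T' ∷ 𝒯b)
    Replace-mid [] = here
    Replace-mid (_ ∷ 𝒯a) = there (Replace-mid 𝒯a)

    All-mid : ∀ {P : Tile → Set} {T} 𝒯a {𝒯b} → All P (𝒯a ++ T ∷ 𝒯b) → P T
    All-mid [] (p ∷ _) = p
    All-mid (_ ∷ 𝒯a) (_ ∷ ps) = All-mid 𝒯a ps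

    All-drop : ∀ {P : Tile → Set} {T} 𝒯a {𝒯b} → All P (𝒯a ++ T ∷ 𝒯b) → All P (𝒯a ++ 𝒯b)
    All-drop [] (_ ∷ ps) = ps
    All-drop (_ ∷ 𝒯a) (p ∷ ps) = p ∷ All-drop 𝒯a ps

    length-mid : ∀ {T : Tile} 𝒯a {𝒯b} → length (𝒯a ++ T ∷ 𝒯b) ≡ suc (length (𝒯a ++ 𝒯b))
    length-mid [] = refl
    length-mid (_ ∷ 𝒯a) = cong suc (length-mid 𝒯a)

    vertsT-mid : ∀ T 𝒯a 𝒯b → vertsT (𝒯a ++ T ∷ 𝒯b) ↭ verts T ++ vertsT (𝒯a ++ 𝒯b)
    vertsT-mid T [] 𝒯b = ↭refl
    vertsT-mid T (S ∷ 𝒯a) 𝒯b = ↭tr (++⁺ˡ (verts S) (vertsT-mid T 𝒯a 𝒯b))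
      (psolve 3 (λ a b c → a ⊕ (b ⊕ c) ⊜ b ⊕ (a ⊕ c)) ↭-refl (verts S) (verts T) (vertsT (𝒯a ++ 𝒯b)))

    record Partial (r f : Rung) (l K m : ℕ) : Set where
      field
        last : Rung
        last₁∈ : proj₁ last ∈ Vs
        last₂∈ : proj₂ last ∈ Vs
        𝒯a 𝒯b : List Tile
        chain : Chain r 𝒯a last
        good : All Good (𝒯a ++ 𝒯b)
        number : length (𝒯a ++ 𝒯b) ≤ K
        number-b : length 𝒯b ≡ l
        W : List V
        part : Vs ↭ cverts chain ++ W ++ vertsT (𝒯a ++ 𝒯b) ++ flat (f ∷ [])
        cost : length (cverts chain) + 9 * length W ≤ m

    sides-bound : ∀ {𝒯 K} → length 𝒯 ≤ K → length (sides 𝒯) ≤ 2 * K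
    sides-bound {𝒯} h = ≤-trans (≤-reflexive (length-sides 𝒯)) (*-monoʳ-≤ 2 h)

    module _ {r : Rung} {f₁ f₂ : V} {K c w : ℕ} (200≤c : 200 ≤ c) (100≤z : 100 ≤ z)
      (hg : g * (c * (2 * K * N)) < N * N) (hz : 100 * (2 * K) + w ≤ z) (hN : 100 * N ≤ c * w) where

      connectTo : ∀ 𝒯 (good : All Good 𝒯) R (part : Vs ↭ vertsT 𝒯 ++ R) (few : length R ≤ z) → length 𝒯 ≤ K →
        ∀ {x y x' y'} → x ∈ Vs → y ∈ Vs → x' ∈ Vs → y' ∈ Vs → Avail.Connection 𝒯 good R part few (x , y) (x' , y')
      connectTo 𝒯 good R part few h ix iy ix' iy' = Avail.connect 𝒯 good R part few {w = w} ix iy ix' iy' 200≤c 100≤z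
        (≤-<-trans (*-monoʳ-≤ g (*-monoʳ-≤ c (*-monoˡ-≤ N (sides-bound {𝒯} h)))) hg)
        (≤-trans (+-monoˡ-≤ w (*-monoʳ-≤ 100 (sides-bound {𝒯} h))) hz) hN

      R-bound : ∀ {C W Q : List V} {m} → length C + 9 * length W ≤ m → m + 6 ≤ z → length Q ≤ 6 → length (C ++ W ++ Q) ≤ z
      R-bound {C} {W} {Q} {m} h h' hQ = ≤-trans (≤-reflexive (trans (length-++ C) (cong (length C +_) (length-++ W))))
        (≤-trans (linear {a = length C + 9 * length W + length Q} {b = m + 6} (8 * length W) (+-mono-≤ h hQ) (lem (length C) (length W) (length Q) m)) h')
        where
        lem : ∀ c w q m → c + (w + q) + (m + 6) + 8 * w ≡ m + 6 + (c + 9 * w + q)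
        lem = solve-∀

      dropTile : ∀ {l m} (s : Partial r (f₁ , f₂) (suc l) K m) → (∀ {T 𝒯b'} → Partial.𝒯b s ≡ T ∷ 𝒯b' → length (verts T) ≤ 2) →
        Partial r (f₁ , f₂) l K (18 + m)
      dropTile record { 𝒯a = 𝒯a ; 𝒯b = T ∷ 𝒯b ; chain = chain ; good = good ; number = nb ; number-b = nb' ; W = W ; part = part ; cost = cost ; last₁∈ = i₁ ; last₂∈ = i₂ } h =
        record { 𝒯a = 𝒯a ; 𝒯b = 𝒯b ; chain = chain ; good = All-drop 𝒯a good
          ; number = ≤-trans (n≤1+n _) (≤-trans (≤-reflexive (sym (length-mid 𝒯a))) nb) ; number-b = suc-injective nb'
          ; W = W ++ verts T
          ; part = ↭tr part (++⁺ˡ (cverts chain) (↭tr (++⁺ˡ W (++⁺ʳ (f₁ ∷ f₂ ∷ []) (vertsT-mid T 𝒯a 𝒯b)))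
              (psolve 4 (λ w t v f → w ⊕ ((t ⊕ v) ⊕ f) ⊜ (w ⊕ t) ⊕ (v ⊕ f)) ↭-refl W (verts T) (vertsT (𝒯a ++ 𝒯b)) (f₁ ∷ f₂ ∷ []))))
          ; cost = ≤-trans (≤-reflexive (cong (λ k → length (cverts chain) + 9 * k) (length-++ W)))
              (linear {a = length (cverts chain) + 9 * length W + 9 * length (verts T)} 0 (+-mono-≤ cost (*-monoʳ-≤ 9 (h refl)))
                (lem (length (cverts chain)) (length W) (length (verts T)) _))
          ; last₁∈ = i₁ ; last₂∈ = i₂ }
        where
        lem : ∀ c w t m → c + 9 * (w + t) + (m + 9 * 2) + 0 ≡ 18 + m + (c + 9 * w + 9 * t)
        lem = solve-∀

      assocT : ∀ 𝒯a (T : Tile) 𝒯b → 𝒯a ++ T ∷ 𝒯b ≡ (𝒯a ++ T ∷ []) ++ 𝒯b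
      assocT 𝒯a T 𝒯b = sym (++-assoc 𝒯a (T ∷ []) 𝒯b)

      shuffle₄ : ∀ (C W Q F ms W' V' : List V) → (ms ++ W' ++ V') ++ C ++ W ++ Q ++ F ↭ (C ++ ms ++ Q) ++ (W' ++ W) ++ V' ++ F
      shuffle₄ = psolve 7 (λ C W Q F ms W' V' → (ms ⊕ (W' ⊕ V')) ⊕ (C ⊕ (W ⊕ (Q ⊕ F))) ⊜ (C ⊕ (ms ⊕ Q)) ⊕ ((W' ⊕ W) ⊕ (V' ⊕ F))) ↭-refl

      module Extend {l m : ℕ} {last : Rung} (i₁ : proj₁ last ∈ Vs) (i₂ : proj₂ last ∈ Vs) (𝒯a 𝒯b : List Tile) (x₁ x₂ y₁ y₂ : V) (X Y : List V)
        (chain : Chain r 𝒯a last) (good : All Good (𝒯a ++ (x₁ ∷ x₂ ∷ X , y₁ ∷ y₂ ∷ Y) ∷ 𝒯b))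
        (nb : length (𝒯a ++ (x₁ ∷ x₂ ∷ X , y₁ ∷ y₂ ∷ Y) ∷ 𝒯b) ≤ K) (nb' : length 𝒯b ≡ l) (W : List V)
        (part : Vs ↭ cverts chain ++ W ++ vertsT (𝒯a ++ (x₁ ∷ x₂ ∷ X , y₁ ∷ y₂ ∷ Y) ∷ 𝒯b) ++ flat ((f₁ , f₂) ∷ []))
        (cost : length (cverts chain) + 9 * length W ≤ m) (hm : m + 6 ≤ z) where

        𝒯 : List Tile
        𝒯 = 𝒯a ++ (X , Y) ∷ 𝒯b
        Q F R : List V
        Q = x₁ ∷ y₁ ∷ x₂ ∷ y₂ ∷ []
        F = f₁ ∷ f₂ ∷ []
        R = cverts chain ++ W ++ (Q ++ F)
        gT : Good (x₁ ∷ x₂ ∷ X , y₁ ∷ y₂ ∷ Y)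
        gT = All-mid 𝒯a good
        good' : All Good 𝒯
        good' = Replace-All (Replace-mid 𝒯a) ((λ i j → proj₁ gT (there (there i)) (there (there j))) ,
          suc-injective (suc-injective (proj₂ gT))) good
        vT : vertsT (𝒯a ++ (x₁ ∷ x₂ ∷ X , y₁ ∷ y₂ ∷ Y) ∷ 𝒯b) ↭ Q ++ vertsT 𝒯
        vT = Replace-verts (Replace-mid 𝒯a) (psolve 6 (λ x₁ x₂ X y₁ y₂ Y → (x₁ ⊕ (x₂ ⊕ X)) ⊕ (y₁ ⊕ (y₂ ⊕ Y)) ⊜ (x₁ ⊕ (y₁ ⊕ (x₂ ⊕ y₂))) ⊕ (X ⊕ Y))
          ↭-refl [ x₁ ] [ x₂ ] X [ y₁ ] [ y₂ ] Y)
        part' : Vs ↭ vertsT 𝒯 ++ R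
        part' = ↭tr part (↭tr (++⁺ˡ (cverts chain) (++⁺ˡ W (++⁺ʳ F vT)))
          (psolve 5 (λ c w q v f → c ⊕ (w ⊕ ((q ⊕ v) ⊕ f)) ⊜ v ⊕ (c ⊕ (w ⊕ (q ⊕ f)))) ↭-refl (cverts chain) W Q (vertsT 𝒯) F))
        few : length R ≤ z
        few = R-bound {cverts chain} {W} {Q ++ F} cost hm ≤-refl
        inVs : ∀ {v} → v ∈ Q → v ∈ Vs
        inVs i = ∈-resp-↭ (↭-sym part') (∈-++⁺ʳ (vertsT 𝒯) (∈-++⁺ʳ (cverts chain) (∈-++⁺ʳ W (∈-++⁺ˡ i))))
        open Avail 𝒯 good' R part' few using (Connection)
        con : Connection last (x₁ , y₁)
        con = connectTo 𝒯 good' R part' few (≤-trans (≤-reflexive (trans (length-mid 𝒯a) (sym (length-mid 𝒯a)))) nb)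
          i₁ i₂ (inVs (here refl)) (inVs (there (here refl)))

        assemble : (k : Connection last (x₁ , y₁)) → ∀ 𝒯a' T' 𝒯b' → Avail.Connection.𝒯' k ≡ 𝒯a' ++ T' ∷ 𝒯b' → Pointwise⊑ 𝒯a' 𝒯a →
          T' ⊑ (X , Y) → Pointwise⊑ 𝒯b' 𝒯b → Partial r (f₁ , f₂) l K (264 + m)
        assemble k 𝒯a' T' 𝒯b' refl pa pT pb = record
          { last = x₂ , y₂ ; last₁∈ = inVs (there (there (here refl))) ; last₂∈ = inVs (there (there (there (here refl))))
          ; 𝒯a = 𝒯a' ++ T' ∷ [] ; 𝒯b = 𝒯b' ; chain = proj₁ joined
          ; good = subst (All Good) (assocT 𝒯a' T' 𝒯b') k.good'
          ; number = ≤-trans (≤-reflexive (trans (cong length (sym (assocT 𝒯a' T' 𝒯b'))) (Pointwise⊑-length k.smaller)))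
              (≤-trans (≤-reflexive (trans (length-mid 𝒯a) (sym (length-mid 𝒯a)))) nb)
          ; number-b = trans (Pointwise⊑-length pb) nb'
          ; W = k.W ++ W
          ; part = subst₂ (λ c 𝒯 → Vs ↭ c ++ (k.W ++ W) ++ vertsT 𝒯 ++ F) (sym cv) (assocT 𝒯a' T' 𝒯b')
              (↭tr part' (↭tr (++⁺ʳ R k.split) (shuffle₄ (cverts chain) W Q F (flat k.ms) k.W (vertsT (𝒯a' ++ T' ∷ 𝒯b')))))
          ; cost = ≤-trans (≤-reflexive (cong₂ (λ a b → a + 9 * b) (trans (cong length cv) (trans (length-++ (cverts chain))
                (cong (length (cverts chain) +_) (trans (length-++ (flat k.ms)) (cong (_+ 4) k.length-ms))))) (length-++ k.W)))
              (linear {a = length (cverts chain) + 9 * length W + 9 * length k.W} 0 (+-mono-≤ cost (*-monoʳ-≤ 9 k.few'))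
                (lem (length (cverts chain)) (length W) (length k.W) m)) }
          where
          module k = Avail.Connection k
          lem : ∀ c w k m → c + 30 + 9 * (k + w) + (m + 9 * 26) + 0 ≡ 264 + m + (c + 9 * w + 9 * k)
          lem = solve-∀
          tail : Chain (x₁ , y₁) (T' ∷ []) (x₂ , y₂)
          tail = slot (proj₁ gT (here refl) (here refl)) (inj₂ (proj₁ gT (here refl) (there (here refl)) , ~sym (proj₁ gT (there (here refl)) (here refl))))
            (Compat-shrink sh (InTile⇒Compat (proj₁ gT) (inj₁ (here refl , here refl))))
            (Compat-shrink sh (InTile⇒Compat (proj₁ gT) (inj₁ (there (here refl) , there (here refl)))))
            (end (proj₁ gT (there (here refl)) (there (here refl))))
            where
            sh : T' ⊑ (x₁ ∷ x₂ ∷ X , y₁ ∷ y₂ ∷ Y)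
            sh = (λ i → there (there (proj₁ pT i))) , (λ i → there (there (proj₂ pT i)))
          shrunk = shrink pa chain
          joined = join (proj₁ shrunk) k.linked tail
          cv : cverts (proj₁ joined) ≡ cverts chain ++ flat k.ms ++ Q
          cv = trans (proj₂ joined) (cong (_++ flat k.ms ++ Q) (proj₂ shrunk))

        split : (k : Connection last (x₁ , y₁)) → (∃ λ 𝒯₁' → ∃ λ 𝒯₂' → Avail.Connection.𝒯' k ≡ 𝒯₁' ++ 𝒯₂' × Pointwise⊑ 𝒯₁' 𝒯a × Pointwise⊑ 𝒯₂' ((X , Y) ∷ 𝒯b)) →
          Partial r (f₁ , f₂) l K (264 + m)
        split k (𝒯a' , T' ∷ 𝒯b' , eq , pa , pT ∷ pb) = assemble k 𝒯a' T' 𝒯b' eq pa pT pb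

        extended : Partial r (f₁ , f₂) l K (264 + m)
        extended = split con (Pointwise⊑-split 𝒯a (Avail.Connection.smaller con))

      weaken : ∀ {l m m'} → m ≤ m' → Partial r (f₁ , f₂) l K m → Partial r (f₁ , f₂) l K m'
      weaken h s = record { Partial s ; cost = ≤-trans (Partial.cost s) h }

      extend : ∀ {l m} → Partial r (f₁ , f₂) (suc l) K m → m + 6 ≤ z → Partial r (f₁ , f₂) l K (264 + m)
      extend s@record { 𝒯b = ([] , []) ∷ _ } hm = weaken (+-monoˡ-≤ _ (m≤m+n 18 246)) (dropTile s (λ { refl → z≤n }))
      extend s@record { 𝒯b = (x ∷ [] , y ∷ []) ∷ _ } hm = weaken (+-monoˡ-≤ _ (m≤m+n 18 246)) (dropTile s (λ { refl → ≤-refl }))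
      extend record { 𝒯a = 𝒯a ; 𝒯b = (x₁ ∷ x₂ ∷ X , y₁ ∷ y₂ ∷ Y) ∷ 𝒯b ; chain = chain ; good = good ; number = nb ; number-b = nb' ; W = W ; part = part ; cost = cost ; last₁∈ = i₁ ; last₂∈ = i₂ } hm =
        Extend.extended i₁ i₂ 𝒯a 𝒯b x₁ x₂ y₁ y₂ X Y chain good nb (suc-injective nb') W part cost hm
      extend s@record { 𝒯a = 𝒯a ; 𝒯b = ([] , y ∷ Y) ∷ _ ; good = good } hm with () ← proj₂ (All-mid 𝒯a good)
      extend s@record { 𝒯a = 𝒯a ; 𝒯b = (x ∷ X , []) ∷ _ ; good = good } hm with () ← proj₂ (All-mid 𝒯a good)
      extend s@record { 𝒯a = 𝒯a ; 𝒯b = (x ∷ [] , y ∷ y' ∷ Y) ∷ _ ; good = good } hm with () ← proj₂ (All-mid 𝒯a good)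
      extend s@record { 𝒯a = 𝒯a ; 𝒯b = (x ∷ x' ∷ X , y ∷ []) ∷ _ ; good = good } hm with () ← proj₂ (All-mid 𝒯a good)

      record Strung (m : ℕ) : Set where
        field
          k k' : ℕ
          W : List V
          state : State r (f₁ , f₂) W k k'
          k≤ : k ≤ K
          cost : k' + 9 * length W ≤ m

      close : ∀ {m} → Edge (f₁ , f₂) → Partial r (f₁ , f₂) 0 K m → m + 6 ≤ z → Strung (264 + m)
      close {m} ef record { last = last ; 𝒯a = 𝒯a ; 𝒯b = [] ; chain = chain ; good = good ; number = nb ; W = W ; part = part ; cost = cost ; last₁∈ = i₁ ; last₂∈ = i₂ } hm = go con
        where
        F R : List V
        F = f₁ ∷ f₂ ∷ []
        R = cverts chain ++ W ++ F
        good' : All Good 𝒯a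
        good' = subst (All Good) (++-identityʳ 𝒯a) good
        part' : Vs ↭ vertsT 𝒯a ++ R
        part' = ↭tr (subst (λ 𝒯 → Vs ↭ cverts chain ++ W ++ vertsT 𝒯 ++ F) (++-identityʳ 𝒯a) part)
          (psolve 4 (λ c w v f → c ⊕ (w ⊕ (v ⊕ f)) ⊜ v ⊕ (c ⊕ (w ⊕ f))) ↭-refl (cverts chain) W (vertsT 𝒯a) F)
        few : length R ≤ z
        few = R-bound {cverts chain} {W} {F} cost hm (m≤m+n 2 4)
        nb' : length 𝒯a ≤ K
        nb' = subst (λ 𝒯 → length 𝒯 ≤ K) (++-identityʳ 𝒯a) nb
        inVs : ∀ {v} → v ∈ F → v ∈ Vs
        inVs i = ∈-resp-↭ (↭-sym part') (∈-++⁺ʳ (vertsT 𝒯a) (∈-++⁺ʳ (cverts chain) (∈-++⁺ʳ W i)))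
        open Avail 𝒯a good' R part' few using (Connection)
        con : Connection last (f₁ , f₂)
        con = connectTo 𝒯a good' R part' few nb' i₁ i₂ (inVs (here refl)) (inVs (there (here refl)))
        go : Connection last (f₁ , f₂) → Strung (264 + m)
        go k = record { k = length k.𝒯' ; k' = length (cverts (subst (λ 𝒯 → Chain r 𝒯 (f₁ , f₂)) eqT (proj₁ joined))) ; W = k.W ++ W
          ; state = record { 𝒯 = k.𝒯' ; chain = subst (λ 𝒯 → Chain r 𝒯 (f₁ , f₂)) eqT (proj₁ joined) ; good = k.good' ; number = refl
            ; part = subst (λ c → Vs ↭ c ++ (k.W ++ W) ++ vertsT k.𝒯') (sym cv) (↭tr part' (↭tr (++⁺ʳ R k.split)
                (shuffle₅ (cverts chain) W F (flat k.ms) k.W (vertsT k.𝒯'))))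
            ; length-chain = refl }
          ; k≤ = ≤-trans (≤-reflexive (Pointwise⊑-length k.smaller)) nb'
          ; cost = ≤-trans (≤-reflexive (cong₂ (λ a b → a + 9 * b) (trans (cong length cv) (trans (length-++ (cverts chain))
                (cong (length (cverts chain) +_) (trans (length-++ (flat k.ms)) (cong (_+ 2) k.length-ms))))) (length-++ k.W)))
              (linear {a = length (cverts chain) + 9 * length W + 9 * length k.W} 2 (+-mono-≤ cost (*-monoʳ-≤ 9 k.few'))
                (lem (length (cverts chain)) (length W) (length k.W) m)) }
          where
          module k = Avail.Connection k
          lem : ∀ c w k m → c + 28 + 9 * (k + w) + (m + 9 * 26) + 2 ≡ 264 + m + (c + 9 * w + 9 * k)
          lem = solve-∀
          shuffle₅ : ∀ (C W F ms W' V' : List V) → (ms ++ W' ++ V') ++ C ++ W ++ F ↭ (C ++ ms ++ F) ++ (W' ++ W) ++ V'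
          shuffle₅ = psolve 6 (λ C W F ms W' V' → (ms ⊕ (W' ⊕ V')) ⊕ (C ⊕ (W ⊕ F)) ⊜ (C ⊕ (ms ⊕ F)) ⊕ ((W' ⊕ W) ⊕ V')) ↭-refl
          shrunk = shrink k.smaller chain
          joined = join (proj₁ shrunk) k.linked (end {r = f₁ , f₂} ef)
          eqT : k.𝒯' ++ [] ≡ k.𝒯'
          eqT = ++-identityʳ k.𝒯'
          cverts-subst : ∀ {𝒯 𝒯' r t} (eq : 𝒯 ≡ 𝒯') (c : Chain r 𝒯 t) → cverts (subst (λ 𝒯 → Chain r 𝒯 t) eq c) ≡ cverts c
          cverts-subst refl c = refl
          cv : cverts (subst (λ 𝒯 → Chain r 𝒯 (f₁ , f₂)) eqT (proj₁ joined)) ≡ cverts chain ++ flat k.ms ++ F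
          cv = trans (cverts-subst eqT (proj₁ joined)) (trans (proj₂ joined) (cong (_++ flat k.ms ++ F) (proj₂ shrunk)))

      stringAll : ∀ l {m} → Edge (f₁ , f₂) → Partial r (f₁ , f₂) l K m → m + 264 * l + 6 ≤ z → Strung (264 + (m + 264 * l))
      stringAll zero {m} ef s h = subst (λ k → Strung (264 + k)) (sym (+-identityʳ m)) (close ef s (subst (λ k → k + 6 ≤ z) (+-identityʳ m) h))
      stringAll (suc l) {m} ef s h = subst (λ k → Strung (264 + k)) eq
        (stringAll l ef (extend s (≤-trans (+-monoˡ-≤ 6 (m≤m+n m (264 * suc l))) h)) (subst (λ k → k + 6 ≤ z) (sym eq) h))
        where
        eq : 264 + m + 264 * l ≡ m + 264 * suc l
        eq = lem m l
          where
          lem : ∀ m l → 264 + m + 264 * l ≡ m + 264 * (1 + l)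
          lem = solve-∀

  -- Almost covering by complete bipartite tiles

  findᵇ∈ : ∀ {A : Set} (f : A → Bool) xs → (∃ λ x → x ∈ xs × T (f x)) ⊎ (∀ {x} → x ∈ xs → ¬ T (f x))
  findᵇ∈ f [] = inj₂ λ ()
  findᵇ∈ f (x ∷ xs) with T? (f x)
  ... | yes p = inj₁ (x , here refl , p)
  ... | no p with findᵇ∈ f xs
  ...   | inj₁ (y , m , q) = inj₁ (y , there m , q)
  ...   | inj₂ h = inj₂ λ { (here refl) → p ; (there m) → h m }

  coverThreshold : ℕ → ℕ → ℕ
  coverThreshold k t = 8 * k * k * K + 16 * k * K + 16 * k * (24 * k * t)
    where
    K : ℕ
    K = t * 2 ^ (24 * k * t) + 24 * k * t

  coverRounds : ℕ → ℕ
  coverRounds k = 16 * k * (24 * k + 1)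

  module Tiling {n : ℕ} (G : Graph n) where
    open Tiles G

    pigeon : ∀ X j m U → 1 ≤ m → (∀ {u} → u ∈ U → j ≤ cnt (adj G u) X) → m * 2 ^ length X ≤ length U →
      ∃ λ X₁ → ∃ λ X₂ → ∃ λ U₁ → ∃ λ U₂ → X ↭ X₁ ++ X₂ × length X₁ ≡ j × U ↭ U₁ ++ U₂ × length U₁ ≡ m × Complete X₁ U₁
    pigeon X zero m U 1≤m h l = [] , X , take m U , drop m U , ↭refl , refl , take-drop↭ m U ,
      trans (length-take m U) (m≤n⇒m⊓n≡m (≤-trans (m≤m*n m (2 ^ length X) ⦃ m^n≢0 2 (length X) ⦄) l)) , λ ()
    pigeon [] (suc j) m [] 1≤m h l = ⊥-elim (<⇒≱ 1≤m (≤-trans (≤-reflexive (sym (*-identityʳ m))) l))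
    pigeon [] (suc j) m (u ∷ U) 1≤m h l with () ← h (here refl)
    pigeon (x ∷ X) (suc j) m U 1≤m h l = go (<-or-≥ (length (sel f U)) (m * 2 ^ length X))
      where
      Result : Set
      Result = ∃ λ X₁ → ∃ λ X₂ → ∃ λ U₁ → ∃ λ U₂ → x ∷ X ↭ X₁ ++ X₂ × length X₁ ≡ suc j × U ↭ U₁ ++ U₂ × length U₁ ≡ m × Complete X₁ U₁
      f : V → Bool
      f u = adj G u x
      hs : ∀ {u} → u ∈ sel f U → j ≤ cnt (adj G u) X
      hs i = let m , t = ∈-sel⁻ f U i in ≤-pred (≤-trans (h m) (+-monoˡ-≤ (cnt (adj G _) X) (b2n≤1 (adj G _ x))))
      hr : ∀ {u} → u ∈ rej f U → suc j ≤ cnt (adj G u) X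
      hr {u} i = let m , t = ∈-rej⁻ f U i in subst (λ k → suc j ≤ k + cnt (adj G u) X) (b2n-F t) (h m)
      go : length (sel f U) < m * 2 ^ length X ⊎ m * 2 ^ length X ≤ length (sel f U) → Result
      go (inj₂ p) with pigeon X j m (sel f U) 1≤m hs p
      ... | X₁ , X₂ , U₁ , U₂ , pX , lX , pU , lU , co = x ∷ X₁ , X₂ , U₁ , U₂ ++ rej f U , prep x pX , cong suc lX ,
        ↭tr (sel-rej f U) (↭tr (++⁺ʳ (rej f U) pU) (↭-reflexive (++-assoc U₁ U₂ _))) , lU , co'
        where
        co' : Complete (x ∷ X₁) U₁
        co' (here refl) i = ~sym (proj₂ (∈-sel⁻ f U (∈-resp-↭ (↭-sym pU) (∈-++⁺ˡ i))))
        co' (there k) i = co k i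
      go (inj₁ p) with pigeon X (suc j) m (rej f U) 1≤m hr (+-cancelˡ-≤ (length (sel f U)) _ _ (≤-trans (+-monoˡ-≤ _ (<⇒≤ p))
            (≤-trans (≤-reflexive (lem m (2 ^ length X))) (≤-trans l (≤-reflexive (length-sel-rej f U))))))
        where
        lem : ∀ m p → m * p + m * p ≡ m * (2 * p)
        lem = solve-∀
      ... | X₁ , X₂ , U₁ , U₂ , pX , lX , pU , lU , co = X₁ , x ∷ X₂ , U₁ , U₂ ++ sel f U ,
        ↭tr (prep x pX) (↭-sym (shift x X₁ X₂)) , lX ,
        ↭tr (sel-rej f U) (↭tr (++-comm (sel f U) (rej f U)) (↭tr (++⁺ʳ (sel f U) pU) (↭-reflexive (++-assoc U₁ U₂ _)))) , lU , co

    rich : ℕ → List V → V → Bool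
    rich t' X u = t' ≤ᵇ cnt (adj G u) X

    record Extracted (t' : ℕ) (X U : List V) : Set where
      field
        Xˢ Xʳ Uˢ Uʳ : List V
        split-X : X ↭ Xˢ ++ Xʳ
        length-Xˢ : length Xˢ ≡ t'
        split-U : U ↭ Uˢ ++ Uʳ
        length-Uˢ : length Uˢ ≡ t'
        complete : Complete Xˢ Uˢ

    extract : ∀ t' X U → 1 ≤ t' → t' * 2 ^ length X ≤ cnt (rich t' X) U → Extracted t' X U
    extract t' X U 1≤t' h with pigeon X t' t' (sel (rich t' X) U) 1≤t' (λ {u} i → ≤ᵇ⇒≤ t' _ (proj₂ (∈-sel⁻ (rich t' X) U i)))
                                (≤-trans h (≤-reflexive (sym (length-sel (rich t' X) U))))
    ... | X₁ , X₂ , U₁ , U₂ , pX , lX , pU , lU , co = record { Xˢ = X₁ ; Xʳ = X₂ ; Uˢ = U₁ ; Uʳ = U₂ ++ rej (rich t' X) U ; split-X = pX ; length-Xˢ = lX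
      ; split-U = ↭tr (sel-rej (rich t' X) U) (↭tr (++⁺ʳ _ pU) (↭-reflexive (++-assoc U₁ U₂ _))) ; length-Uˢ = lU ; complete = co }

    poor-bound : ∀ t' X U K → cnt (rich t' X) U ≤ K → e U X ≤ length U * t' + K * length X
    poor-bound t' X U K h = ≤-trans (∑-mono U (λ {u} _ → each u)) (≤-trans (≤-reflexive (trans (∑-+ (λ _ → t') _ U)
      (cong₂ _+_ (trans (∑-const t' U) (*-comm t' (length U))) (∑-* (length X) _ U)))) (+-monoʳ-≤ (length U * t')
      (≤-trans (*-monoʳ-≤ (length X) h) (≤-reflexive (*-comm (length X) K)))))
      where
      each : ∀ u → cnt (adj G u) X ≤ t' + length X * b2n (rich t' X u)
      each u with rich t' X u in eq
      ... | true = ≤-trans (cnt≤length (adj G u) X) (≤-trans (≤-reflexive (sym (*-identityʳ (length X)))) (m≤n+m _ t'))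
      ... | false = ≤-trans (<⇒≤ (≰⇒> (λ le → subst T eq (≤⇒≤ᵇ le)))) (m≤m+n t' _)

    Sized : ℕ → Tile → Set
    Sized t T = Good T × length (proj₁ T) ≡ t

    splitTile : ∀ m t X Y → Good (X , Y) → length X ≡ m * t → ∃ λ 𝒯 → All (Sized t) 𝒯 × X ++ Y ↭ vertsT 𝒯
    splitTile zero t [] [] g l = [] , [] , ↭refl
    splitTile zero t [] (y ∷ Y) (_ , ()) l
    splitTile (suc m) t X Y (co , eq) l with splitTile m t (drop t X) (drop t Y) g' lX'
      where
      g' : Good (drop t X , drop t Y)
      g' = (λ i j → co (∈-resp-↭ (↭-sym (take-drop↭ t X)) (∈-++⁺ʳ (take t X) i)) (∈-resp-↭ (↭-sym (take-drop↭ t Y)) (∈-++⁺ʳ (take t Y) j))) ,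
        trans (length-drop t X) (trans (cong (_∸ t) eq) (sym (length-drop t Y)))
      lX' : length (drop t X) ≡ m * t
      lX' = trans (length-drop t X) (trans (cong (_∸ t) l) (m+n∸m≡n t (m * t)))
    ... | 𝒯 , s , p = (take t X , take t Y) ∷ 𝒯 , ((g'' , lX) ∷ s) ,
      ↭tr (++⁺ (take-drop↭ t X) (take-drop↭ t Y)) (↭tr (psolve 4 (λ a b c d → (a ⊕ b) ⊕ (c ⊕ d) ⊜ (a ⊕ c) ⊕ (b ⊕ d)) ↭-refl
        (take t X) (drop t X) (take t Y) (drop t Y)) (++⁺ˡ (take t X ++ take t Y) p))
      where
      t≤X : t ≤ length X
      t≤X = ≤-trans (m≤m+n t (m * t)) (≤-reflexive (sym l))
      lX : length (take t X) ≡ t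
      lX = trans (length-take t X) (m≤n⇒m⊓n≡m t≤X)
      g'' : Good (take t X , take t Y)
      g'' = (λ i j → co (∈-take⁻ t X i) (∈-take⁻ t Y j)) ,
        trans lX (sym (trans (length-take t Y) (m≤n⇒m⊓n≡m (≤-trans t≤X (≤-reflexive eq)))))

    splitTiles : ∀ m t 𝒯 → All (Sized (m * t)) 𝒯 → ∃ λ 𝒯' → All (Sized t) 𝒯' × vertsT 𝒯 ↭ vertsT 𝒯'
    splitTiles m t [] [] = [] , [] , ↭refl
    splitTiles m t ((X , Y) ∷ 𝒯) ((g , l) ∷ s) with splitTile m t X Y g l | splitTiles m t 𝒯 s
    ... | 𝒯₁ , s₁ , p₁ | 𝒯₂ , s₂ , p₂ = 𝒯₁ ++ 𝒯₂ , ++⁺ᴬ s₁ s₂ , ↭tr (++⁺ p₁ p₂) (↭-reflexive (sym (concatMap-++ verts 𝒯₁ 𝒯₂)))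

    vertsT-length : ∀ {t} 𝒯 → All (Sized t) 𝒯 → length (vertsT 𝒯) ≡ 2 * t * length 𝒯
    vertsT-length {t} [] [] = sym (*-zeroʳ (2 * t))
    vertsT-length {t} ((X , Y) ∷ 𝒯) (((_ , eq) , l) ∷ s) = trans (length-++ (X ++ Y)) (trans (cong₂ _+_
      (trans (length-++ X) (cong₂ _+_ l (trans (sym eq) l))) (vertsT-length 𝒯 s)) (lem t (length 𝒯)))
      where
      lem : ∀ t l → t + t + 2 * t * l ≡ 2 * t * (1 + l)
      lem = solve-∀

    module Round (Vs : List V) (k t' : ℕ) (1≤t' : 1 ≤ t') (1≤k : 1 ≤ k)
      (H3 : ∀ U U' → Vs ↭ U ++ U' → length Vs ≤ k * length U →
        8 * k * (length U * length Vs) ≤ 16 * k * e U Vs + length U * length Vs) where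

      N M t K : ℕ
      N = length Vs
      M = 24 * k
      t = M * t'
      K = t' * 2 ^ t + t

      record Config : Set where
        field
          U : List V
          old new : List Tile
          sized-old : All (Sized t) old
          sized-new : All (Sized t') new
          part : Vs ↭ U ++ vertsT old ++ vertsT new

      open Config

      -- Each improvement covers 2 t' more vertices and breaks up at most one old tile; the potential does not increase,
      -- so a large part of U is covered before the new tiles become noticeable.
      potential : Config → ℕ
      potential c = length (vertsT (new c)) + (M + 1) * length (U c)

      Improved : Config → Set
      Improved c = ∃ λ c' → length (U c') < length (U c) × potential c' ≤ potential c

      improvableTile : List V → Tile → Bool
      improvableTile U (X , Y) = (K ≤ᵇ cnt (rich t' X) U) ∧ (K ≤ᵇ cnt (rich t' Y) U)

      K≥ : ∀ {X : List V} → length X ≡ t → t' * 2 ^ length X ≤ K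
      K≥ h = ≤-trans (≤-reflexive (cong (λ l → t' * 2 ^ l) h)) (m≤m+n (t' * 2 ^ t) t)

      t'≤t : t' ≤ t
      t'≤t = m≤n*m t' M ⦃ >-nonZero (≤-trans 1≤k (m≤n*m k 24)) ⦄

      shuffle₆ : ∀ (W₁ W₂ R X₁ X₂ Y₁ Y₂ O V' : List V) → (W₁ ++ W₂ ++ R) ++ (((X₁ ++ X₂) ++ (Y₁ ++ Y₂)) ++ O) ++ V' ↭
        R ++ O ++ (X₁ ++ W₁) ++ (Y₁ ++ W₂) ++ (X₂ ++ Y₂) ++ V'
      shuffle₆ = psolve 9 (λ W₁ W₂ R X₁ X₂ Y₁ Y₂ O V' → (W₁ ⊕ (W₂ ⊕ R)) ⊕ ((((X₁ ⊕ X₂) ⊕ (Y₁ ⊕ Y₂)) ⊕ O) ⊕ V') ⊜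
        R ⊕ (O ⊕ ((X₁ ⊕ W₁) ⊕ ((Y₁ ⊕ W₂) ⊕ ((X₂ ⊕ Y₂) ⊕ V'))))) ↭-refl

      cancelPrefix : ∀ {A₁ A₂ B₁ B₂ : List V} → length A₁ ≡ length B₁ → length (A₁ ++ A₂) ≡ length (B₁ ++ B₂) → length A₂ ≡ length B₂
      cancelPrefix {A₁} {A₂} {B₁} {B₂} h p = +-cancelˡ-≡ (length A₁) _ _
        (trans (sym (length-++ A₁)) (trans p (trans (length-++ B₁) (cong (_+ length B₂) (sym h)))))

      module ImproveTile (U : List V) (X Y : List V) (O new : List Tile) (sO : All (Sized t) O) (sN : All (Sized t') new) (sT : Sized t (X , Y))
        (part : Vs ↭ U ++ (verts (X , Y) ++ vertsT O) ++ vertsT new) where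

        fromExtracted : (x : Extracted t' X U) → Extracted t' Y (Extracted.Uʳ x) →
          ∃ λ c' → length (Config.U c') < length U × potential c' ≤ length (vertsT new) + (M + 1) * length U
        fromExtracted x y = record { U = y.Uʳ ; old = O ; new = 𝒯' ; sized-old = sO ; sized-new = sN' ; part = part' } , fewer , pot
          where
          module x = Extracted x
          module y = Extracted y
          co : Complete X Y
          co = proj₁ (proj₁ sT)
          remainder : ∃ λ 𝒯 → All (Sized t') 𝒯 × x.Xʳ ++ y.Xʳ ↭ vertsT 𝒯
          remainder = splitTile (M ∸ 1) t' x.Xʳ y.Xʳ
            ((λ i j → co (∈-resp-↭ (↭-sym x.split-X) (∈-++⁺ʳ x.Xˢ i)) (∈-resp-↭ (↭-sym y.split-X) (∈-++⁺ʳ y.Xˢ j))) ,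
             cancelPrefix {x.Xˢ} {x.Xʳ} {y.Xˢ} {y.Xʳ} (trans x.length-Xˢ (sym y.length-Xˢ)) (trans (sym (↭-length x.split-X)) (trans (proj₂ (proj₁ sT)) (↭-length y.split-X))))
            (trans (sym (m+n∸m≡n (length x.Xˢ) _)) (trans (cong₂ _∸_ (trans (sym (length-++ x.Xˢ)) (trans (sym (↭-length x.split-X)) (proj₂ sT))) x.length-Xˢ)
              (trans (cong (M * t' ∸_) (sym (*-identityˡ t'))) (sym (*-distribʳ-∸ t' M 1)))))
          𝒯' : List Tile
          𝒯' = (x.Xˢ , x.Uˢ) ∷ (y.Xˢ , y.Uˢ) ∷ (proj₁ remainder ++ new)
          sN' : All (Sized t') 𝒯'
          sN' = ((x.complete , trans x.length-Xˢ (sym x.length-Uˢ)) , x.length-Xˢ) ∷ ((y.complete , trans y.length-Xˢ (sym y.length-Uˢ)) , y.length-Xˢ) ∷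
            ++⁺ᴬ (proj₁ (proj₂ remainder)) sN
          vN : vertsT 𝒯' ↭ (x.Xˢ ++ x.Uˢ) ++ (y.Xˢ ++ y.Uˢ) ++ (x.Xʳ ++ y.Xʳ) ++ vertsT new
          vN = ++⁺ˡ (x.Xˢ ++ x.Uˢ) (++⁺ˡ (y.Xˢ ++ y.Uˢ) (↭tr (↭-reflexive (concatMap-++ verts (proj₁ remainder) new))
            (++⁺ʳ (vertsT new) (↭-sym (proj₂ (proj₂ remainder))))))
          part' : Vs ↭ y.Uʳ ++ vertsT O ++ vertsT 𝒯'
          part' = ↭tr part (↭tr (++⁺ (↭tr x.split-U (++⁺ˡ x.Uˢ y.split-U)) (++⁺ʳ (vertsT new) (++⁺ʳ (vertsT O) (++⁺ x.split-X y.split-X))))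
            (↭tr (shuffle₆ x.Uˢ y.Uˢ y.Uʳ x.Xˢ x.Xʳ y.Xˢ y.Xʳ (vertsT O) (vertsT new)) (++⁺ˡ y.Uʳ (++⁺ˡ (vertsT O) (↭-sym vN)))))
          lenU : length U ≡ t' + (t' + length y.Uʳ)
          lenU = trans (↭-length x.split-U) (trans (length-++ x.Uˢ) (cong₂ _+_ x.length-Uˢ
            (trans (↭-length y.split-U) (trans (length-++ y.Uˢ) (cong (_+ length y.Uʳ) y.length-Uˢ)))))
          fewer : length y.Uʳ < length U
          fewer = ≤-trans (+-monoˡ-≤ (length y.Uʳ) 1≤t') (≤-trans (m≤n+m _ t') (≤-reflexive (sym lenU)))
          lenR : length (x.Xʳ ++ y.Xʳ) + (t' + t') ≡ t + t
          lenR = trans (lem (length x.Xˢ) (length y.Xˢ)) (cong₂ _+_ (trans (sym (trans (↭-length x.split-X) (length-++ x.Xˢ))) (proj₂ sT))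
              (trans (sym (trans (↭-length y.split-X) (length-++ y.Xˢ))) (trans (sym (proj₂ (proj₁ sT))) (proj₂ sT))))
            where
            lem : ∀ a b → length (x.Xʳ ++ y.Xʳ) + (t' + t') ≡ (length x.Xˢ + length x.Xʳ) + (length y.Xˢ + length y.Xʳ)
            lem _ _ rewrite length-++ x.Xʳ {y.Xʳ} | x.length-Xˢ | y.length-Xˢ = lem' (length x.Xʳ) (length y.Xʳ) t'
              where
              lem' : ∀ a b t → a + b + (t + t) ≡ t + a + (t + b)
              lem' = solve-∀
          lenN : length (vertsT 𝒯') ≡ t + t + (t' + t') + length (vertsT new)
          lenN = trans (↭-length vN) (trans (length-++ (x.Xˢ ++ x.Uˢ)) (trans (cong₂ _+_ (trans (length-++ x.Xˢ) (cong₂ _+_ x.length-Xˢ x.length-Uˢ))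
            (trans (length-++ (y.Xˢ ++ y.Uˢ)) (cong₂ _+_ (trans (length-++ y.Xˢ) (cong₂ _+_ y.length-Xˢ y.length-Uˢ)) (length-++ (x.Xʳ ++ y.Xʳ)))))
            (trans (lem t' (length (x.Xʳ ++ y.Xʳ)) (length (vertsT new))) (cong (λ s → s + (t' + t') + length (vertsT new)) lenR))))
            where
            lem : ∀ t r n → t + t + (t + t + (r + n)) ≡ r + (t + t) + (t + t) + n
            lem = solve-∀
          pot : length (vertsT 𝒯') + (M + 1) * length y.Uʳ ≤ length (vertsT new) + (M + 1) * length U
          pot = ≤-reflexive (trans (cong (_+ (M + 1) * length y.Uʳ) lenN) (trans (lem M t' (length (vertsT new)) (length y.Uʳ))
            (cong (λ s → length (vertsT new) + (M + 1) * s) (sym lenU))))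
            where
            lem : ∀ M t v u → M * t + M * t + (t + t) + v + (M + 1) * u ≡ v + (M + 1) * (t + (t + u))
            lem = solve-∀

        improve : K ≤ cnt (rich t' X) U → K ≤ cnt (rich t' Y) U →
          ∃ λ c' → length (Config.U c') < length U × potential c' ≤ length (vertsT new) + (M + 1) * length U
        improve hX hY = go (extract t' X U 1≤t' (≤-trans (K≥ {X} (proj₂ sT)) hX))
          where
          go : Extracted t' X U → _
          go x = fromExtracted x (extract t' Y (Extracted.Uʳ x) 1≤t'
            (+-cancelʳ-≤ t _ _ (≤-trans (≤-reflexive (cong (λ l → t' * 2 ^ l + t) (trans (sym (proj₂ (proj₁ sT))) (proj₂ sT))))
              (≤-trans hY (≤-trans (≤-reflexive (trans (∑-↭ _ (Extracted.split-U x)) (∑-++ _ (Extracted.Uˢ x) _)))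
                (≤-trans (+-monoˡ-≤ _ (≤-trans (cnt≤length _ (Extracted.Uˢ x)) (≤-trans (≤-reflexive (Extracted.length-Uˢ x)) t'≤t)))
                  (≤-reflexive (+-comm t _))))))))

      improveTile : ∀ c {S} → S ∈ old c → T (improvableTile (U c) S) → Improved c
      improveTile c {X , Y} iS h = go (∈⇒↭ iS)
        where
        go : (∃ λ O → old c ↭ (X , Y) ∷ O) → Improved c
        go (O , p) = ImproveTile.improve (U c) X Y O (new c) (All.tail sO) (sized-new c) (All.head sO)
          (↭tr (part c) (++⁺ˡ (U c) (++⁺ʳ (vertsT (new c)) (concatMap-↭ verts p))))
          (≤ᵇ⇒≤ K _ (proj₁ (T-∧⁻ h))) (≤ᵇ⇒≤ K _ (proj₂ (T-∧⁻ {K ≤ᵇ cnt (rich t' X) (U c)} h)))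
          where
          sO = All-resp-↭ p (sized-old c)

      improveBlock : ∀ c {X U'} → U c ↭ X ++ U' → length X ≡ t → K ≤ cnt (rich t' X) (U c) → Improved c
      improveBlock c {X} {U'} p lX h = go (extract t' X U' 1≤t' (+-cancelʳ-≤ t _ _
          (≤-trans (≤-reflexive (cong (λ l → t' * 2 ^ l + t) lX)) (≤-trans h
            (≤-trans (≤-reflexive (trans (∑-↭ _ p) (∑-++ _ X U'))) (≤-trans (+-monoˡ-≤ _ (≤-trans (cnt≤length _ X) (≤-reflexive lX))) (≤-reflexive (+-comm t _))))))))
        where
        go : Extracted t' X U' → Improved c
        go x = record { U = x.Xʳ ++ x.Uʳ ; old = old c ; new = (x.Xˢ , x.Uˢ) ∷ new c ; sized-old = sized-old c
            ; sized-new = ((x.complete , trans x.length-Xˢ (sym x.length-Uˢ)) , x.length-Xˢ) ∷ sized-new c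
            ; part = ↭tr (part c) (↭tr (++⁺ʳ _ (↭tr p (++⁺ x.split-X x.split-U))) (shuffle x.Xˢ x.Xʳ x.Uˢ x.Uʳ (vertsT (old c)) (vertsT (new c)))) } ,
          ≤-trans (+-monoˡ-≤ _ (≤-trans 1≤t' (m≤m+n t' t'))) (≤-reflexive (sym lenU)) ,
          (begin
            length ((x.Xˢ ++ x.Uˢ) ++ vertsT (new c)) + (M + 1) * length (x.Xʳ ++ x.Uʳ)
              ≡⟨ cong (_+ (M + 1) * length (x.Xʳ ++ x.Uʳ)) (trans (length-++ (x.Xˢ ++ x.Uˢ)) (cong (_+ length (vertsT (new c))) (trans (length-++ x.Xˢ) (cong₂ _+_ x.length-Xˢ x.length-Uˢ)))) ⟩
            t' + t' + length (vertsT (new c)) + (M + 1) * length (x.Xʳ ++ x.Uʳ)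
              ≤⟨ linear (M * (t' + t')) ≤-refl (lem M (t' + t') (length (vertsT (new c))) (length (x.Xʳ ++ x.Uʳ))) ⟩
            length (vertsT (new c)) + (M + 1) * (t' + t' + length (x.Xʳ ++ x.Uʳ))
              ≡⟨ cong (λ s → length (vertsT (new c)) + (M + 1) * s) (sym lenU) ⟩
            potential c ∎)
          where
          open ≤-Reasoning
          module x = Extracted x
          lem : ∀ M t v u → t + v + (M + 1) * u + 0 + M * t ≡ v + (M + 1) * (t + u) + 0
          lem = solve-∀
          shuffle : ∀ (X₁ X₂ U₁ U₂ O V' : List V) → ((X₁ ++ X₂) ++ U₁ ++ U₂) ++ O ++ V' ↭ (X₂ ++ U₂) ++ O ++ (X₁ ++ U₁) ++ V'
          shuffle = psolve 6 (λ X₁ X₂ U₁ U₂ O V' → ((X₁ ⊕ X₂) ⊕ (U₁ ⊕ U₂)) ⊕ (O ⊕ V') ⊜ (X₂ ⊕ U₂) ⊕ (O ⊕ ((X₁ ⊕ U₁) ⊕ V'))) ↭-refl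
          lenU : length (U c) ≡ t' + t' + length (x.Xʳ ++ x.Uʳ)
          lenU = trans (↭-length p) (trans (length-++ X) (trans (cong₂ _+_ (trans (↭-length x.split-X) (length-++ x.Xˢ)) (trans (↭-length x.split-U) (length-++ x.Uˢ)))
            (trans (cong₂ (λ a b → a + length x.Xʳ + (b + length x.Uʳ)) x.length-Xˢ x.length-Uˢ) (trans (lem' t' (length x.Xʳ) (length x.Uʳ))
              (cong (t' + t' +_) (sym (length-++ x.Xʳ)))))))
            where
            lem' : ∀ t a b → t + a + (t + b) ≡ t + t + (a + b)
            lem' = solve-∀

      blocks : ∀ (c : Config) m B B' → length B ≤ m * t → U c ↭ B ++ B' →
        Improved c ⊎ (t * e (U c) B ≤ length B * (length (U c) * t' + K * t) + t * (t * length (U c)))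
      blocks c zero [] B' l p = inj₂ (≤-trans (≤-reflexive (trans (cong (t *_) (trans (∑-const 0 (U c)) refl)) (*-zeroʳ t))) z≤n)
      blocks c (suc m) B B' l p = go (<-or-≥ (length B) t)
        where
        u : ℕ
        u = length (U c)
        Y : ℕ
        Y = u * t' + K * t
        go : length B < t ⊎ t ≤ length B → Improved c ⊎ (t * e (U c) B ≤ length B * Y + t * (t * u))
        go (inj₁ lt) = inj₂ (≤-trans (*-monoʳ-≤ t (≤-trans (e≤ (U c) B) (≤-trans (*-monoʳ-≤ u (<⇒≤ lt)) (≤-reflexive (*-comm u t))))) (m≤n+m _ (length B * Y)))
        go (inj₂ le) = go' (<-or-≥ (cnt (rich t' X) (U c)) K)
          where
          X B₁ : List V
          X = take t B
          B₁ = drop t B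
          lX : length X ≡ t
          lX = trans (length-take t B) (m≤n⇒m⊓n≡m le)
          pX : U c ↭ X ++ (B₁ ++ B')
          pX = ↭tr p (↭tr (++⁺ʳ B' (take-drop↭ t B)) (↭-reflexive (++-assoc X B₁ B')))
          lB₁ : length B₁ ≤ m * t
          lB₁ = ≤-trans (≤-reflexive (length-drop t B)) (≤-trans (∸-monoˡ-≤ t l) (≤-reflexive (m+n∸m≡n t (m * t))))
          rest : Improved c ⊎ (t * e (U c) B₁ ≤ length B₁ * Y + t * (t * u))
          rest = blocks c m B₁ (X ++ B') lB₁ (↭tr pX (psolve 3 (λ a b c → a ⊕ (b ⊕ c) ⊜ b ⊕ (a ⊕ c)) ↭-refl X B₁ B'))
          combine : cnt (rich t' X) (U c) < K → t * e (U c) B₁ ≤ length B₁ * Y + t * (t * u) → t * e (U c) B ≤ length B * Y + t * (t * u)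
          combine lt h = begin
            t * e (U c) B                       ≡⟨ cong (t *_) (trans (e-↭ʳ (U c) (take-drop↭ t B)) (e-++ʳ (U c) X B₁)) ⟩
            t * (e (U c) X + e (U c) B₁)        ≡⟨ *-distribˡ-+ t (e (U c) X) (e (U c) B₁) ⟩
            t * e (U c) X + t * e (U c) B₁      ≤⟨ +-mono-≤ (*-monoʳ-≤ t (poor-bound t' X (U c) K (<⇒≤ lt))) h ⟩
            t * (u * t' + K * length X) + (length B₁ * Y + t * (t * u)) ≡⟨ cong (λ l → t * (u * t' + K * l) + (length B₁ * Y + t * (t * u))) lX ⟩
            t * Y + (length B₁ * Y + t * (t * u)) ≡⟨ +-assoc (t * Y) _ _ ⟨
            t * Y + length B₁ * Y + t * (t * u) ≡⟨ cong (_+ t * (t * u)) (*-distribʳ-+ Y t (length B₁)) ⟨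
            (t + length B₁) * Y + t * (t * u)   ≡⟨ cong (λ l → l * Y + t * (t * u)) (trans (cong (_+ length B₁) (sym lX)) (trans (sym (length-++ X)) (sym (↭-length (take-drop↭ t B))))) ⟩
            length B * Y + t * (t * u) ∎
            where open ≤-Reasoning
          go' : cnt (rich t' X) (U c) < K ⊎ K ≤ cnt (rich t' X) (U c) → Improved c ⊎ (t * e (U c) B ≤ length B * Y + t * (t * u))
          go' (inj₂ h) = inj₁ (improveBlock c {X} {B₁ ++ B'} pX lX h)
          go' (inj₁ lt) with rest
          ... | inj₁ i = inj₁ i
          ... | inj₂ h = inj₂ (combine lt h)

      oldTiles : ∀ (U : List V) 𝒯 → All (Sized t) 𝒯 → (∀ {S} → S ∈ 𝒯 → ¬ T (improvableTile U S)) →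
        2 * t * e U (vertsT 𝒯) ≤ length (vertsT 𝒯) * (length U * (t + t') + K * t)
      oldTiles U [] [] h = ≤-trans (≤-reflexive (trans (cong (2 * t *_) (∑-const 0 U)) (*-zeroʳ (2 * t)))) z≤n
      oldTiles U ((X , Y) ∷ 𝒯) (((co , eq) , l) ∷ s) h = begin
        2 * t * e U ((X ++ Y) ++ vertsT 𝒯)               ≡⟨ cong (2 * t *_) (e-++ʳ U (X ++ Y) (vertsT 𝒯)) ⟩
        2 * t * (e U (X ++ Y) + e U (vertsT 𝒯))          ≡⟨ *-distribˡ-+ (2 * t) (e U (X ++ Y)) _ ⟩
        2 * t * e U (X ++ Y) + 2 * t * e U (vertsT 𝒯)    ≤⟨ +-mono-≤ (*-monoʳ-≤ (2 * t) tile) (oldTiles U 𝒯 s (h ∘ there)) ⟩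
        2 * t * Z + length (vertsT 𝒯) * Z                ≡⟨ *-distribʳ-+ Z (2 * t) _ ⟨
        (2 * t + length (vertsT 𝒯)) * Z                  ≡⟨ cong (λ k → (k + length (vertsT 𝒯)) * Z) (sym lXY) ⟩
        (length (X ++ Y) + length (vertsT 𝒯)) * Z        ≡⟨ cong (_* Z) (sym (length-++ (X ++ Y))) ⟩
        length ((X ++ Y) ++ vertsT 𝒯) * Z ∎
        where
        open ≤-Reasoning
        Z : ℕ
        Z = length U * (t + t') + K * t
        lY : length Y ≡ t
        lY = trans (sym eq) l
        lXY : length (X ++ Y) ≡ 2 * t
        lXY = trans (length-++ X) (cong₂ _+_ l (trans lY (sym (+-identityʳ t))))
        full : ∀ A → length A ≡ t → e U A ≤ length U * t
        full A lA = ≤-trans (e≤ U A) (≤-reflexive (cong (length U *_) lA))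
        poor : ∀ A → length A ≡ t → cnt (rich t' A) U < K → e U A ≤ length U * t' + K * t
        poor A lA lt = ≤-trans (poor-bound t' A U K (<⇒≤ lt)) (≤-reflexive (cong (λ k → length U * t' + K * k) lA))
        regroup : ∀ u t t' k → u * t + (u * t' + k) ≡ u * (t + t') + k
        regroup = solve-∀
        split : e U (X ++ Y) ≡ e U X + e U Y
        split = e-++ʳ U X Y
        tile : e U (X ++ Y) ≤ Z
        tile with <-or-≥ (cnt (rich t' X) U) K | <-or-≥ (cnt (rich t' Y) U) K
        ... | inj₁ p | _ = ≤-trans (≤-reflexive (trans split (+-comm (e U X) (e U Y)))) (≤-trans (+-mono-≤ (full Y lY) (poor X l p)) (≤-reflexive (regroup (length U) t t' (K * t))))
        ... | inj₂ _ | inj₁ p = ≤-trans (≤-reflexive split) (≤-trans (+-mono-≤ (full X l) (poor Y lY p)) (≤-reflexive (regroup (length U) t t' (K * t))))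
        ... | inj₂ p | inj₂ q = ⊥-elim (h (here refl) (T-∧⁺ (≤⇒≤ᵇ p) (≤⇒≤ᵇ q)))

      threshold : ℕ
      threshold = 8 * k * k * K + 16 * k * K + 16 * k * t

      impossible : ∀ u v ν E₁ E₂ E₃ → 1 ≤ u → 1 ≤ N → t * E₁ ≤ u * (u * t' + K * t) + t * (t * u) → 2 * t * E₂ ≤ v * (u * (t + t') + K * t) → E₃ ≤ u * ν →
        8 * k * (u * N) ≤ 16 * k * (E₁ + (E₂ + E₃)) + u * N → u + (v + ν) ≡ N → N ≤ k * u → 16 * k * ν ≤ N → threshold ≤ N → ⊥
      impossible u v ν E₁ E₂ E₃ 1≤u 1≤N h₁ h₂ h₃ h₄ h₅ h₆ h₇ h₈ = <⇒≱ 0<uNt (m+m≤m⇒ final)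
        where
        0<uNt : 0 < u * N * t
        0<uNt = *-mono-≤ (*-mono-≤ 1≤u 1≤N) (≤-trans 1≤t' t'≤t)
        m+m≤m⇒ : ∀ {m} → 8 * m ≤ 4 * m → m ≤ 0
        m+m≤m⇒ {m} h = linear {a = 8 * m} {b = 4 * m} (3 * m) h (lem m)
          where
          lem : ∀ m → m + 4 * m + 3 * m ≡ 0 + 8 * m
          lem = solve-∀
        stageA : 8 * k * (u * N) * t ≤ 8 * k * (2 * (u * (u * t' + K * t) + t * (t * u)) + v * (u * (t + t') + K * t)) + 16 * k * t * (u * ν) + u * N * t
        stageA = linear {a = t * (8 * k * (u * N)) + 16 * k * (t * E₁) + 8 * k * (2 * t * E₂) + 16 * k * t * E₃}
            {b = t * (16 * k * (E₁ + (E₂ + E₃)) + u * N) + 16 * k * (u * (u * t' + K * t) + t * (t * u)) + 8 * k * (v * (u * (t + t') + K * t)) + 16 * k * t * (u * ν)} 0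
          (+-mono-≤ (+-mono-≤ (+-mono-≤ (*-monoʳ-≤ t h₄) (*-monoʳ-≤ (16 * k) h₁)) (*-monoʳ-≤ (8 * k) h₂)) (*-monoʳ-≤ (16 * k * t) h₃))
          (lem k (u * N) t (u * (u * t' + K * t) + t * (t * u)) (v * (u * (t + t') + K * t)) (u * ν) E₁ E₂ E₃)
          where
          lem : ∀ k uN t A B C E₁ E₂ E₃ → 8 * k * uN * t + (t * (16 * k * (E₁ + (E₂ + E₃)) + uN) + 16 * k * A + 8 * k * B + 16 * k * t * C) + 0 ≡
            8 * k * (2 * A + B) + 16 * k * t * C + uN * t + (t * (8 * k * uN) + 16 * k * (t * E₁) + 8 * k * (2 * t * E₂) + 16 * k * t * E₃)
          lem = solve-∀
        t-eq : 24 * (k * t') ≡ t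
        t-eq = sym (*-assoc 24 k t')
        -- v is eliminated with u + v ≤ N
        stageB : 8 * k * u * u * t ≤ 16 * k * (u * N) * t' + 16 * k * u * K * t + 16 * k * t * t * u + 8 * k * N * (K * t) + 16 * k * t * (u * ν) + u * N * t
        stageB = linear {a = 8 * k * (u * N) * t} {b = 8 * k * (2 * (u * (u * t' + K * t) + t * (t * u)) + v * (u * (t + t') + K * t)) + 16 * k * t * (u * ν) + u * N * t}
            (8 * k * (u * v * t' + 2 * u * ν * t' + u * t * ν + u * K * t + ν * (K * t))) stageA
            (subst (λ N → 8 * k * u * u * t + (8 * k * (2 * (u * (u * t' + K * t) + t * (t * u)) + v * (u * (t + t') + K * t)) + 16 * k * t * (u * ν) + u * N * t) +
                (8 * k * (u * v * t' + 2 * u * ν * t' + u * t * ν + u * K * t + ν * (K * t))) ≡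
               16 * k * (u * N) * t' + 16 * k * u * K * t + 16 * k * t * t * u + 8 * k * N * (K * t) + 16 * k * t * (u * ν) + u * N * t + 8 * k * (u * N) * t) h₅
              (lem k u v ν t t' K))
          where
          lem : ∀ k u v ν t t' K → 8 * k * u * u * t + (8 * k * (2 * (u * (u * t' + K * t) + t * (t * u)) + v * (u * (t + t') + K * t)) + 16 * k * t * (u * ν) + u * (u + (v + ν)) * t) +
                (8 * k * (u * v * t' + 2 * u * ν * t' + u * t * ν + u * K * t + ν * (K * t))) ≡
               16 * k * (u * (u + (v + ν))) * t' + 16 * k * u * K * t + 16 * k * t * t * u + 8 * k * (u + (v + ν)) * (K * t) + 16 * k * t * (u * ν) + u * (u + (v + ν)) * t + 8 * k * (u * (u + (v + ν))) * t
          lem = solve-∀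
        final : 8 * (u * N * t) ≤ 4 * (u * N * t)
        final = linear
          {a = 8 * k * u * u * t + u * N * (24 * (k * t')) + 8 * k * (K * t) * N + u * t * (16 * k * ν) + u * t * threshold + 8 * u * t * N}
          {b = 16 * k * (u * N) * t' + 16 * k * u * K * t + 16 * k * t * t * u + 8 * k * N * (K * t) + 16 * k * t * (u * ν) + u * N * t
               + u * N * t + 8 * k * (K * t) * (k * u) + u * t * N + u * t * N + 8 * u * t * (k * u)}
          (8 * (u * N * (k * t')))
          (+-mono-≤ (+-mono-≤ (+-mono-≤ (+-mono-≤ (+-mono-≤ stageB (*-monoʳ-≤ (u * N) (≤-reflexive t-eq))) (*-monoʳ-≤ (8 * k * (K * t)) h₆)) (*-monoʳ-≤ (u * t) h₇)) (*-monoʳ-≤ (u * t) h₈)) (*-monoʳ-≤ (8 * u * t) h₆))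
          (lem k u N ν t t' K)
          where
          lem : ∀ k u N ν t t' K → 8 * (u * N * t) + (16 * k * (u * N) * t' + 16 * k * u * K * t + 16 * k * t * t * u + 8 * k * N * (K * t) + 16 * k * t * (u * ν) + u * N * t
               + u * N * t + 8 * k * (K * t) * (k * u) + u * t * N + u * t * N + 8 * u * t * (k * u)) + (8 * (u * N * (k * t'))) ≡
             4 * (u * N * t) + (8 * k * u * u * t + u * N * (24 * (k * t')) + 8 * k * (K * t) * N + u * t * (16 * k * ν) + u * t * (8 * k * k * K + 16 * k * K + 16 * k * t) + 8 * u * t * N)
          lem = solve-∀

      improve : ∀ c → 1 ≤ N → threshold ≤ N → N ≤ k * length (U c) → 16 * k * length (vertsT (new c)) ≤ N → Improved c
      improve c 1≤N hN hU hν = go (findᵇ∈ (improvableTile (U c)) (old c)) (blocks c (length (U c)) (U c) [] (m≤m*n (length (U c)) t ⦃ >-nonZero (≤-trans 1≤t' t'≤t) ⦄)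
                                 (↭-reflexive (sym (++-identityʳ (U c)))))
        where
        u : ℕ
        u = length (U c)
        1≤u : 1 ≤ u
        1≤u = positive (U c) hU
          where
          positive : ∀ (U : List V) → N ≤ k * length U → 1 ≤ length U
          positive [] h = ⊥-elim (<⇒≱ 1≤N (≤-trans h (≤-reflexive (*-zeroʳ k))))
          positive (_ ∷ _) _ = s≤s z≤n
        total : e (U c) Vs ≡ e (U c) (U c) + (e (U c) (vertsT (old c)) + e (U c) (vertsT (new c)))
        total = trans (e-↭ʳ (U c) (part c)) (trans (e-++ʳ (U c) (U c) _) (cong (e (U c) (U c) +_) (e-++ʳ (U c) (vertsT (old c)) _)))
        go : (∃ λ S → S ∈ old c × T (improvableTile (U c) S)) ⊎ (∀ {S} → S ∈ old c → ¬ T (improvableTile (U c) S)) →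
          Improved c ⊎ (t * e (U c) (U c) ≤ u * (u * t' + K * t) + t * (t * u)) → Improved c
        go (inj₁ (S , i , h)) _ = improveTile c i h
        go (inj₂ _) (inj₁ i) = i
        go (inj₂ h) (inj₂ h₁) = ⊥-elim (impossible u (length (vertsT (old c))) (length (vertsT (new c))) _ _ _ 1≤u 1≤N h₁
          (oldTiles (U c) (old c) (sized-old c) h) (e≤ (U c) (vertsT (new c)))
          (subst (λ x → 8 * k * (u * N) ≤ 16 * k * x + u * N) total (H3 (U c) _ (part c) hU))
          (sym (trans (↭-length (part c)) (trans (length-++ (U c)) (cong (u +_) (length-++ (vertsT (old c)))))))
          hU hν hN)

      record Outcome (t : ℕ) : Set where
        field
          U : List V
          𝒯 : List Tile
          sized : All (Sized t) 𝒯
          part : Vs ↭ U ++ vertsT 𝒯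

      finishRound : (c : Config) → Outcome t'
      finishRound c with splitTiles M t' (old c) (sized-old c)
      ... | 𝒯 , s , p = record { U = U c ; 𝒯 = 𝒯 ++ new c ; sized = ++⁺ᴬ s (sized-new c)
        ; part = ↭tr (part c) (++⁺ˡ (U c) (↭tr (++⁺ʳ _ p) (↭-reflexive (sym (concatMap-++ verts 𝒯 (new c)))))) }

      round : ∀ fuel c u₀ → length (U c) ≤ fuel → 1 ≤ N → threshold ≤ N → potential c ≤ (M + 1) * u₀ →
        ∃ λ c' → (k * length (U c') < N) ⊎ (16 * k * (M + 1) * length (U c') + N ≤ 16 * k * (M + 1) * u₀)
      round fuel c u₀ hf 1≤N hN hp = go (<-or-≥ (k * length (U c)) N) (<-or-≥ N (16 * k * length (vertsT (new c))))
        where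
        recurse : ∀ fuel → length (U c) ≤ fuel → Improved c → ∃ λ c' → (k * length (U c') < N) ⊎ (16 * k * (M + 1) * length (U c') + N ≤ 16 * k * (M + 1) * u₀)
        recurse zero hf (c' , lt , p) = ⊥-elim (<⇒≱ lt (≤-trans hf z≤n))
        recurse (suc fuel) hf (c' , lt , p) = round fuel c' u₀ (≤-pred (≤-trans lt hf)) 1≤N hN (≤-trans p hp)
        go : k * length (U c) < N ⊎ N ≤ k * length (U c) → N < 16 * k * length (vertsT (new c)) ⊎ 16 * k * length (vertsT (new c)) ≤ N → _
        go (inj₁ h) _ = c , inj₁ h
        go (inj₂ h) (inj₁ h') = c , inj₂ (linear {a = N + 16 * k * (length (vertsT (new c)) + (M + 1) * length (U c))} {b = 16 * k * length (vertsT (new c)) + 16 * k * ((M + 1) * u₀)} 0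
          (+-mono-≤ (<⇒≤ h') (*-monoʳ-≤ (16 * k) hp)) (lem k (M + 1) (length (U c)) N (length (vertsT (new c))) u₀))
          where
          lem : ∀ k M u N v u₀ → 16 * k * M * u + N + (16 * k * v + 16 * k * (M * u₀)) + 0 ≡ 16 * k * M * u₀ + (N + 16 * k * (v + M * u))
          lem = solve-∀
        go (inj₂ h) (inj₂ h') = recurse fuel hf (improve c 1≤N hN h h')

    module AlmostCover (Vs : List V) (k : ℕ) (1≤k : 1 ≤ k)
      (H3 : ∀ U U' → Vs ↭ U ++ U' → length Vs ≤ k * length U →
        8 * k * (length U * length Vs) ≤ 16 * k * e U Vs + length U * length Vs) where

      thresholdAt : ℕ → ℕ
      thresholdAt = coverThreshold k

      R : ℕ
      R = coverRounds k

      record Tiling (t : ℕ) : Set where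
        field
          U : List V
          𝒯 : List Tile
          sized : All (Sized t) 𝒯
          part : Vs ↭ U ++ vertsT 𝒯

      refine : ∀ {t} m (c : Tiling (m * t)) → Σ (Tiling t) λ c' → Tiling.U c' ≡ Tiling.U c
      refine {t} m c with splitTiles m t (Tiling.𝒯 c) (Tiling.sized c)
      ... | 𝒯 , s , p = record { U = Tiling.U c ; 𝒯 = 𝒯 ; sized = s ; part = ↭tr (Tiling.part c) (++⁺ˡ (Tiling.U c) p) } , refl

      1≤24k : 1 ≤ 24 * k
      1≤24k = ≤-trans 1≤k (m≤n*m k 24)

      rounds : ∀ r t → 1 ≤ t → 1 ≤ length Vs → (∀ s → s < r → thresholdAt ((24 * k) ^ s * t) ≤ length Vs) →
        (c : Tiling ((24 * k) ^ r * t)) → R * length (Tiling.U c) ≤ r * length Vs →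
        Σ (Tiling t) λ c' → k * length (Tiling.U c') < length Vs
      rounds zero t 1≤t 1≤N hN c h = proj₁ c' , subst (λ U → k * length U < length Vs) (sym (proj₂ c')) (subst (λ l → k * l < length Vs) (sym U≡0) (≤-trans (s≤s (≤-reflexive (*-zeroʳ k))) 1≤N))
        where
        c' = refine {t} 1 c
        U≡0 : length (Tiling.U c) ≡ 0
        U≡0 = n≤0⇒n≡0 (≤-trans (m≤n*m _ R ⦃ >-nonZero (*-mono-≤ {1} (*-mono-≤ {1} {16} {1} {k} (s≤s z≤n) 1≤k) (m≤n+m 1 (24 * k))) ⦄) h)
      rounds (suc r) t 1≤t 1≤N hN c h = go (round (length (Tiling.U c)) start (length (Tiling.U c)) ≤-refl 1≤N (hN r ≤-refl) ≤-refl)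
        where
        t' : ℕ
        t' = (24 * k) ^ r * t
        1≤t' : 1 ≤ t'
        1≤t' = *-mono-≤ {1} (m^n>0 (24 * k) ⦃ >-nonZero 1≤24k ⦄ r) 1≤t
        open Round Vs k t' 1≤t' 1≤k H3 using (Config; N; M; round; finishRound; module Outcome; module Config)
        start : Config
        start = record { U = Tiling.U c ; old = Tiling.𝒯 c ; new = [] ; sized-old = subst (λ t → All (Sized t) (Tiling.𝒯 c)) (*-assoc (24 * k) ((24 * k) ^ r) t) (Tiling.sized c)
          ; sized-new = [] ; part = ↭tr (Tiling.part c) (++⁺ˡ (Tiling.U c) (↭-reflexive (sym (++-identityʳ _)))) }
        toTiling : Config → Tiling t'
        toTiling c' = record { Outcome (finishRound c') }
        go : (∃ λ c' → (k * length (Config.U c') < N) ⊎ (16 * k * (M + 1) * length (Config.U c') + N ≤ 16 * k * (M + 1) * length (Tiling.U c))) →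
          Σ (Tiling t) λ c' → k * length (Tiling.U c') < length Vs
        go (c' , inj₁ lt) = let c'' , eq = refine {t} ((24 * k) ^ r) (toTiling c') in c'' , subst (λ U → k * length U < N) (sym eq) lt
        go (c' , inj₂ le) = rounds r t 1≤t 1≤N (λ s lt → hN s (≤-trans lt (n≤1+n r))) (toTiling c')
          (+-cancelʳ-≤ N _ _ (≤-trans le (≤-trans h (≤-reflexive (+-comm N (r * N))))))

      almostCover : ∀ t → 1 ≤ t → 1 ≤ length Vs → (∀ s → s < R → thresholdAt ((24 * k) ^ s * t) ≤ length Vs) →
        Σ (Tiling t) λ c → k * length (Tiling.U c) < length Vs
      almostCover t 1≤t 1≤N hN = rounds R t 1≤t 1≤N hN (record { U = Vs ; 𝒯 = [] ; sized = [] ; part = ↭-reflexive (sym (++-identityʳ Vs)) }) ≤-refl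

  -- Spanning ladders in expanding graphs

  ∑-∈ : ∀ {A : Set} (f : A → ℕ) {x xs} → x ∈ xs → f x ≤ ∑ f xs
  ∑-∈ f (here refl) = m≤m+n _ _
  ∑-∈ f {xs = y ∷ xs} (there m) = ≤-trans (∑-∈ f m) (m≤n+m _ (f y))

  abstract
    ladderThreshold : ℕ → ℕ → ℕ
    ladderThreshold h g = 3000 * h + ∑ (λ s → coverThreshold (100 * h) ((24 * (100 * h)) ^ s * (1000 * h * g))) (upTo (coverRounds (100 * h)))

    ladderThreshold-large : ∀ h g → 3000 * h ≤ ladderThreshold h g
    ladderThreshold-large h g = m≤m+n (3000 * h) _

    ladderThreshold-cover : ∀ h g s → s < coverRounds (100 * h) →
      coverThreshold (100 * h) ((24 * (100 * h)) ^ s * (1000 * h * g)) ≤ ladderThreshold h g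
    ladderThreshold-cover h g s lt = ≤-trans (∑-∈ _ (∈-upTo⁺ lt)) (m≤n+m _ (3000 * h))

  module Ladders {n : ℕ} (G : Graph n) (e₁ e₂ f₁ f₂ : Fin n) (V₀ : List (Fin n)) (h g a z : ℕ)
    (uVs : Unique (e₁ ∷ e₂ ∷ f₁ ∷ f₂ ∷ V₀))
    (1≤h : 1 ≤ h) (1≤g : 1 ≤ g)
    (H1 : ∀ {v} → v ∈ e₁ ∷ e₂ ∷ f₁ ∷ f₂ ∷ V₀ → a + 2 * z ≤ cnt (adj G v) (e₁ ∷ e₂ ∷ f₁ ∷ f₂ ∷ V₀))
    (H2 : ∀ A A' B B' → e₁ ∷ e₂ ∷ f₁ ∷ f₂ ∷ V₀ ↭ A ++ A' → e₁ ∷ e₂ ∷ f₁ ∷ f₂ ∷ V₀ ↭ B ++ B' → a ≤ length A → a ≤ length B →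
      (4 + length V₀) * (4 + length V₀) ≤ g * Tiles.e G A B)
    (H3 : ∀ U U' → V₀ ↭ U ++ U' → length V₀ ≤ 100 * h * length U →
        8 * (100 * h) * (length U * length V₀) ≤ 16 * (100 * h) * Tiles.e G U V₀ + length U * length V₀)
    where
    open Tiles G
    open Tiling G using (Sized; vertsT-length; module AlmostCover)

    Vs : List V
    Vs = e₁ ∷ e₂ ∷ f₁ ∷ f₂ ∷ V₀

    open Stringing G Vs uVs a z g H1 H2
    open Absorbing G Vs uVs a z g H1 H2 using (State; absorbAll) renaming (finish to fillSlots)

    N L t c : ℕ
    N = 4 + length V₀
    L = length V₀
    t = 1000 * h * g
    c = 200 * h

    cancel-h : ∀ {x y} → h * x ≤ h * y → x ≤ y
    cancel-h {x} {y} = *-cancelˡ-≤ h ⦃ >-nonZero 1≤h ⦄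

    module _ (edge-e : e₁ ~ e₂) (edge-f : f₁ ~ f₂) (even : 2 ∣ N) (large : ladderThreshold h g ≤ L) (N≤hz : N ≤ h * z) where

      3000h≤L : 3000 * h ≤ L
      3000h≤L = ≤-trans (ladderThreshold-large h g) large

      3000≤z : 3000 ≤ z
      3000≤z = cancel-h (≤-trans (≤-reflexive (*-comm h 3000)) (≤-trans 3000h≤L (≤-trans (m≤n+m L 4) N≤hz)))

      1≤100h : 1 ≤ 100 * h
      1≤100h = *-mono-≤ {1} {100} {1} {h} (s≤s z≤n) 1≤h

      1≤t : 1 ≤ t
      1≤t = *-mono-≤ {1} {1000 * h} {1} {g} (*-mono-≤ {1} {1000} {1} {h} (s≤s z≤n) 1≤h) 1≤g

      open AlmostCover V₀ (100 * h) 1≤100h H3 using (Tiling; almostCover)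

      200≤c : 200 ≤ c
      200≤c = *-mono-≤ {200} {200} {1} {h} ≤-refl 1≤h

      100≤z : 100 ≤ z
      100≤z = ≤-trans (m≤m+n 100 2900) 3000≤z

      module FromTiling (U : List V) (𝒯 : List Tile) (sized : All (Sized t) 𝒯) (part : V₀ ↭ U ++ vertsT 𝒯) (fewU : 100 * h * length U < L) where

        q u : ℕ
        q = length 𝒯
        u = length U

        tq : 2 * t * q ≤ L
        tq = ≤-trans (≤-reflexive (sym (vertsT-length 𝒯 sized))) (≤-trans (m≤n+m _ u) (≤-reflexive (sym (trans (↭-length part) (length-++ U)))))

        2000q≤z : 2000 * q ≤ z
        2000q≤z = cancel-h (≤-trans (≤-trans (m≤m*n (h * (2000 * q)) g ⦃ >-nonZero 1≤g ⦄) (≤-reflexive (lem h g q)))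
          (≤-trans tq (≤-trans (m≤n+m L 4) N≤hz)))
          where
          lem : ∀ h g q → h * (2000 * q) * g ≡ 2 * (1000 * h * g) * q
          lem = solve-∀

        100u≤z : 100 * u ≤ z
        100u≤z = cancel-h (≤-trans (≤-reflexive (lem h u)) (≤-trans (<⇒≤ fewU) (≤-trans (m≤n+m L 4) N≤hz)))
          where
          lem : ∀ h u → h * (100 * u) ≡ 100 * h * u
          lem = solve-∀

        w : ℕ
        w = z ∸ 100 * (2 * q)

        200q≤z : 100 * (2 * q) ≤ z
        200q≤z = ≤-trans (linear {b = 2000 * q} (1800 * q) ≤-refl (lem q)) 2000q≤z
          where
          lem : ∀ q → 100 * (2 * q) + 2000 * q + 1800 * q ≡ 2000 * q + 2000 * q
          lem = solve-∀

        hz : 100 * (2 * q) + w ≤ z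
        hz = ≤-reflexive (m+[n∸m]≡n 200q≤z)

        hN : 100 * N ≤ c * w
        hN = ≤-trans (*-monoʳ-≤ 100 N≤hz) (linear {a = 100 * h * (1600 * q) + 200 * h * z} {b = 100 * h * z + 200 * h * (100 * (2 * q) + w)} (120000 * h * q)
          (+-mono-≤ (*-monoʳ-≤ (100 * h) (≤-trans (linear {b = 2000 * q} (400 * q) ≤-refl (lem₁ q)) 2000q≤z))
            (*-monoʳ-≤ (200 * h) (≤-reflexive (sym (m+[n∸m]≡n 200q≤z))))) (lem h q z w))
          where
          lem₁ : ∀ q → 1600 * q + 2000 * q + 400 * q ≡ 2000 * q + 2000 * q
          lem₁ = solve-∀
          lem : ∀ h q z w → 100 * (h * z) + (100 * h * z + 200 * h * (100 * (2 * q) + w)) + 120000 * h * q ≡ 200 * h * w + (100 * h * (1600 * q) + 200 * h * z)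
          lem = solve-∀

        hg : g * (c * (2 * q * N)) < N * N
        hg = linear {a = 2 * t * q * N + 4 * N} {b = L * N + 4 * N + 0} (1600 * h * g * q * N + 15 + 4 * L)
          (≤-trans (+-monoˡ-≤ (4 * N) (*-monoˡ-≤ N tq)) (≤-reflexive (sym (+-identityʳ _)))) (lem g h q L)
          where
          lem : ∀ g h q L → suc (g * (200 * h * (2 * q * (4 + L)))) + (L * (4 + L) + 4 * (4 + L) + 0) + (1600 * h * g * q * (4 + L) + 15 + 4 * L) ≡
            (4 + L) * (4 + L) + (2 * (1000 * h * g) * q * (4 + L) + 4 * (4 + L))
          lem = solve-∀

        sparse : ∀ {k} → k ≤ q → g * (20 * (2 * k * N)) < N * N
        sparse {k} k≤q = ≤-<-trans (*-monoʳ-≤ g (*-mono-≤ {20} {c} 20≤c (*-monoˡ-≤ N (*-monoʳ-≤ 2 k≤q)))) hg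
          where
          20≤c : 20 ≤ c
          20≤c = *-mono-≤ {20} {200} {1} {h} (m≤m+n 20 180) 1≤h

        budget : 264 + (2 + 9 * u + 264 * q) ≤ z
        budget = *-cancelˡ-≤ 10 (linear {a = 2 * (2000 * q) + 100 * u + 3000} {b = 2 * z + z + z} (6 * z + 10 * u + 1360 * q + 340)
          (+-mono-≤ (+-mono-≤ (*-monoʳ-≤ 2 2000q≤z) 100u≤z) 3000≤z) (lem u q z))
          where
          lem : ∀ u q z → 10 * (264 + (2 + 9 * u + 264 * q)) + (2 * z + z + z) + (6 * z + 10 * u + 1360 * q + 340) ≡ 10 * z + (2 * (2000 * q) + 100 * u + 3000)
          lem = solve-∀

        start : Partial (e₁ , e₂) (f₁ , f₂) q q (2 + 9 * u)
        start = record { last = e₁ , e₂ ; last₁∈ = here refl ; last₂∈ = there (here refl) ; 𝒯a = [] ; 𝒯b = 𝒯 ; chain = end edge-e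
          ; good = All.map proj₁ sized ; number = ≤-refl ; number-b = refl ; W = U
          ; part = prep e₁ (prep e₂ (↭tr (++⁺ˡ (f₁ ∷ f₂ ∷ []) part)
              (psolve 3 (λ f u v → f ⊕ (u ⊕ v) ⊜ u ⊕ (v ⊕ f)) ↭-refl (f₁ ∷ f₂ ∷ []) U (vertsT 𝒯))))
          ; cost = ≤-refl }

        even-cverts : ∀ {r 𝒯 t} (c : Chain r 𝒯 t) → 2 ∣ length (cverts c)
        even-cverts (end _) = ∣-refl
        even-cverts (step _ _ c) = ∣m∣n⇒∣m+n {m = 2} ∣-refl (even-cverts c)
        even-cverts (slot _ _ _ _ c) = ∣m∣n⇒∣m+n {m = 2} ∣-refl (even-cverts c)

        even-vertsT : ∀ 𝒯 → All Good 𝒯 → 2 ∣ length (vertsT 𝒯)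
        even-vertsT [] [] = divides 0 refl
        even-vertsT ((X , Y) ∷ 𝒯) ((_ , eq) ∷ g) = subst (2 ∣_) (sym (length-++ (X ++ Y)))
          (∣m∣n⇒∣m+n (divides (length X) (trans (length-++ X) (trans (cong (length X +_) (sym eq)) (lem (length X))))) (even-vertsT 𝒯 g))
          where
          lem : ∀ x → x + x ≡ x * 2
          lem = solve-∀

        absorbed : ∀ {m} → Strung {e₁ , e₂} {f₁} {f₂} {q} {c} {w} 200≤c 100≤z hg hz hN m → m ≤ z → Σ (Chain (e₁ , e₂) [] (f₁ , f₂)) λ c → Vs ↭ cverts c
        absorbed s hm = fillSlots (proj₂ (absorbAll few (sparse s.k≤) s.W evenW s.state (≤-trans s.cost hm)))
          where
          module s = Strung s
          module st = State s.state
          few : 20 * (2 * s.k) ≤ z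
          few = ≤-trans (*-monoʳ-≤ 20 (*-monoʳ-≤ 2 s.k≤)) (≤-trans (linear {b = 2000 * q} (1960 * q) ≤-refl (lem q)) 2000q≤z)
            where
            lem : ∀ q → 20 * (2 * q) + 2000 * q + 1960 * q ≡ 2000 * q + 2000 * q
            lem = solve-∀
          evenW : 2 ∣ length s.W
          evenW = ∣m+n∣m⇒∣n (subst (2 ∣_) (trans (↭-length (↭tr st.part (psolve 3 (λ c w v → c ⊕ (w ⊕ v) ⊜ (c ⊕ v) ⊕ w) ↭-refl (cverts st.chain) s.W (vertsT st.𝒯))))
              (length-++ (cverts st.chain ++ vertsT st.𝒯))) even)
            (subst (2 ∣_) (sym (length-++ (cverts st.chain))) (∣m∣n⇒∣m+n (even-cverts st.chain) (even-vertsT st.𝒯 st.good)))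

        ladder : Σ (Chain (e₁ , e₂) [] (f₁ , f₂)) λ c → Vs ↭ cverts c
        ladder = absorbed (stringAll 200≤c 100≤z hg hz hN q edge-f start (≤-trans (≤-reflexive (+-comm (2 + 9 * u + 264 * q) 6)) (≤-trans (+-monoˡ-≤ _ (m≤m+n 6 258)) budget))) budget

      spanningLadder : Σ (Chain (e₁ , e₂) [] (f₁ , f₂)) λ c → Vs ↭ cverts c
      spanningLadder = go (almostCover t 1≤t (≤-trans (*-mono-≤ {1} {3000} {1} {h} (s≤s z≤n) 1≤h) 3000h≤L) (λ s lt → ≤-trans (ladderThreshold-cover h g s lt) large))
        where
        go : (Σ (Tiling t) λ c → 100 * h * length (Tiling.U c) < L) → Σ (Chain (e₁ , e₂) [] (f₁ , f₂)) λ c → Vs ↭ cverts c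
        go (c , lt) = FromTiling.ladder (Tiling.U c) (Tiling.𝒯 c) (Tiling.sized c) (Tiling.part c) lt

  -- Caterpillars and their rotation systems

  data Node : Set where
    S L : ℕ → Node

  iter-+ : ∀ {A : Set} (f : A → A) k l x → iter f (k + l) x ≡ iter f k (iter f l x)
  iter-+ f zero l x = refl
  iter-+ f (suc k) l x = cong f (iter-+ f k l x)

  walk-trans : ∀ {n} {G : Graph n} {P u v w} → Walk G P u v → Walk G P v w → Walk G P u w
  walk-trans (here _) q = q
  walk-trans (step p a w) q = step p a (walk-trans w q)

  T-∨⁻ : ∀ {a b} → T (a ∨ b) → T a ⊎ T b
  T-∨⁻ {true} t = inj₁ t
  T-∨⁻ {false} t = inj₂ t

  T-∨⁺ : ∀ {a b} → T a ⊎ T b → T (a ∨ b)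
  T-∨⁺ {true} _ = tt
  T-∨⁺ {false} (inj₂ t) = t

  module Model (p' d ℓ : ℕ) (1≤d : 1 ≤ d) (long : suc p' + d + 2 ≤ ℓ) where

    p : ℕ
    p = suc p'

    hub : ℕ → ℕ
    hub j = (j ∸ d) ⊓ p

    Valid : Node → Set
    Valid (S i) = i ≤ p
    Valid (L j) = j < ℓ

    tadj : Node → Node → Bool
    tadj (S i) (S j) = (suc i ≡ᵇ j) ∨ (suc j ≡ᵇ i)
    tadj (S i) (L j) = hub j ≡ᵇ i
    tadj (L j) (S i) = hub j ≡ᵇ i
    tadj (L _) (L _) = false

    tadj-sym : ∀ x y → tadj x y ≡ tadj y x
    tadj-sym (S i) (S j) = ∨-comm (suc i ≡ᵇ j) (suc j ≡ᵇ i)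
    tadj-sym (S i) (L j) = refl
    tadj-sym (L j) (S i) = refl
    tadj-sym (L _) (L _) = refl

    ¬≡ᵇsuc : ∀ i → (suc i ≡ᵇ i) ≡ false
    ¬≡ᵇsuc zero = refl
    ¬≡ᵇsuc (suc i) = ¬≡ᵇsuc i

    tadj-irrefl : ∀ x → tadj x x ≡ false
    tadj-irrefl (S i) rewrite ¬≡ᵇsuc i = refl
    tadj-irrefl (L j) = refl

    nxt : ℕ → ℕ
    nxt j = if suc j <ᵇ ℓ then suc j else 0

    cadj : Node → Node → Bool
    cadj (L j) (L k) = (nxt j ≡ᵇ k) ∨ (nxt k ≡ᵇ j)
    cadj _ _ = false

    -- Around the hub S i: its leaves in increasing order, then S (i + 1), then S (i ∸ 1).
    rot : Node → Node → Node
    rot (S i) (L j) = if (suc j <ᵇ ℓ) ∧ (hub (suc j) ≡ᵇ i) then L (suc j) else (if i <ᵇ p then S (suc i) else S (i ∸ 1))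
    rot (S zero) (S j) = L 0
    rot (S (suc i)) (S j) = if i ≡ᵇ j then L (d + suc i) else S i
    rot (L j) y = y

    first : ℕ → ℕ
    first zero = 0
    first (suc i) = d + suc i

    d+p<ℓ : suc (d + p) < ℓ
    d+p<ℓ = ≤-trans (≤-reflexive (lem d p)) long
      where
      lem : ∀ d p → 2 + (d + p) ≡ p + d + 2
      lem = solve-∀

    hub≤p : ∀ j → hub j ≤ p
    hub≤p j = m⊓n≤n (j ∸ d) p

    hub-0 : ∀ {j} → j ≤ d → hub j ≡ 0
    hub-0 {j} h rewrite m≤n⇒m∸n≡0 h = refl

    hub-d+ : ∀ i → hub (d + i) ≡ i ⊓ p
    hub-d+ i = cong (_⊓ p) (m+n∸m≡n d i)

    hub-mid : ∀ {i} → i ≤ p → hub (d + i) ≡ i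
    hub-mid {i} h = trans (hub-d+ i) (m≤n⇒m⊓n≡m h)

    hub-last : ∀ {i} → p ≤ i → hub (d + i) ≡ p
    hub-last {i} h = trans (hub-d+ i) (m≥n⇒m⊓n≡n h)

    hub-first : ∀ {i} → i ≤ p → hub (first i) ≡ i
    hub-first {zero} h = hub-0 z≤n
    hub-first {suc i} h = hub-mid h

    hub-step : ∀ j → hub (suc j) ≡ hub j ⊎ (hub (suc j) ≡ suc (hub j) × j ≡ d + hub j)
    hub-step j with <-or-≥ j d
    ... | inj₁ lt = inj₁ (trans (hub-0 lt) (sym (hub-0 (<⇒≤ lt))))
    ... | inj₂ le with m≤n⇒∃[o]m+o≡n le
    ...   | x , refl with <-or-≥ x p
    ...     | inj₁ x<p = inj₂ (trans (trans (cong hub (sym (+-suc d x))) (hub-mid x<p)) (cong suc (sym (hub-mid (<⇒≤ x<p)))) , cong (d +_) (sym (hub-mid (<⇒≤ x<p))))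
    ...     | inj₂ p≤x = inj₁ (trans (trans (cong hub (sym (+-suc d x))) (hub-last (≤-trans p≤x (n≤1+n x)))) (sym (hub-last p≤x)))

    T-≡ᵇ : ∀ {i j} → T (i ≡ᵇ j) → i ≡ j
    T-≡ᵇ {i} {j} = ≡ᵇ⇒≡ i j

    ≡ᵇ-T : ∀ {i j} → i ≡ j → T (i ≡ᵇ j)
    ≡ᵇ-T {i} {j} = ≡⇒≡ᵇ i j

    if-true : ∀ {A : Set} {b} {x y : A} → T b → (if b then x else y) ≡ x
    if-true {b = true} _ = refl

    if-false : ∀ {A : Set} {b} {x y : A} → ¬ T b → (if b then x else y) ≡ y
    if-false {b = true} h = ⊥-elim (h tt)
    if-false {b = false} _ = refl

    rot-leaf-next : ∀ {i j} → suc j < ℓ → hub (suc j) ≡ i → rot (S i) (L j) ≡ L (suc j)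
    rot-leaf-next h h' = if-true (T-∧⁺ (<⇒<ᵇ h) (≡ᵇ-T h'))

    rot-leaf-up : ∀ {i j} → ¬ (suc j < ℓ × hub (suc j) ≡ i) → i < p → rot (S i) (L j) ≡ S (suc i)
    rot-leaf-up {i} {j} h lt = trans (if-false (λ t → h (<ᵇ⇒< _ _ (proj₁ (T-∧⁻ t)) , T-≡ᵇ (proj₂ (T-∧⁻ {suc j <ᵇ ℓ} t))))) (if-true (<⇒<ᵇ lt))

    rot-leaf-end : ∀ {j} → ¬ (suc j < ℓ × hub (suc j) ≡ p) → rot (S p) (L j) ≡ S (p ∸ 1)
    rot-leaf-end {j} h = trans (if-false (λ t → h (<ᵇ⇒< _ _ (proj₁ (T-∧⁻ t)) , T-≡ᵇ (proj₂ (T-∧⁻ {suc j <ᵇ ℓ} t))))) (if-false (λ t → <-irrefl refl (<ᵇ⇒< p p t)))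

    rot-prev : ∀ i → rot (S (suc i)) (S i) ≡ L (first (suc i))
    rot-prev i = if-true (≡ᵇ-T {i} refl)

    rot-next : ∀ i → rot (S (suc i)) (S (suc (suc i))) ≡ S i
    rot-next i = if-false (λ t → <⇒≢ (≤-trans (n≤1+n _) ≤-refl) (T-≡ᵇ {i} t))

    test? : ∀ i j → Dec (suc j < ℓ × hub (suc j) ≡ i)
    test? i j with suc j <? ℓ | hub (suc j) ≟ i
    ... | yes a | yes b = yes (a , b)
    ... | yes a | no b = no (b ∘ proj₂)
    ... | no a | _ = no (a ∘ proj₁)

    tadj-S : ∀ i → T (tadj (S i) (S (suc i)))
    tadj-S i = T-∨⁺ {suc i ≡ᵇ suc i} (inj₁ (≡ᵇ-T {i} refl))

    tadj-S' : ∀ i → T (tadj (S (suc i)) (S i))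
    tadj-S' i = subst T (tadj-sym (S i) (S (suc i))) (tadj-S i)

    tadj-SS : ∀ {i j} → T (tadj (S i) (S j)) → suc i ≡ j ⊎ suc j ≡ i
    tadj-SS {i} {j} t with T-∨⁻ {suc i ≡ᵇ j} t
    ... | inj₁ a = inj₁ (T-≡ᵇ {suc i} {j} a)
    ... | inj₂ b = inj₂ (T-≡ᵇ {suc j} {i} b)

    rot-closed : ∀ x y → Valid x → Valid y → T (tadj x y) → T (tadj x (rot x y)) × Valid (rot x y)
    rot-closed (L j) y vx vy t = t , vy
    rot-closed (S i) (L j) vx vy t with test? i j
    ... | yes (a , b) rewrite rot-leaf-next {i} {j} a b = ≡ᵇ-T b , a
    ... | no h with <-or-≥ i p
    ...   | inj₁ lt rewrite rot-leaf-up {i} {j} h lt = tadj-S i , lt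
    ...   | inj₂ ge with ≤-antisym vx ge
    ...     | refl rewrite rot-leaf-end {j} h = tadj-S' p' , n≤1+n p'
    rot-closed (S zero) (S j) vx vy t = ≡ᵇ-T (hub-0 z≤n) , ≤-trans (s≤s z≤n) d+p<ℓ
    rot-closed (S (suc i)) (S j) vx vy t with i ≟ j
    ... | yes refl rewrite rot-prev i = ≡ᵇ-T (hub-mid vx) , ≤-trans (s≤s (+-monoʳ-≤ d vx)) (<⇒≤ d+p<ℓ)
    ... | no ne rewrite if-false {b = i ≡ᵇ j} {x = L (d + suc i)} {y = S i} (λ t → ne (T-≡ᵇ t)) = tadj-S' i , ≤-trans (n≤1+n i) vx

    rank : Node → ℕ
    rank (S i) = i
    rank (L j) = suc p

    -- Both neighbours of a vertex of maximal rank on a cycle would be its parent.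
    lower-unique : ∀ x y z → Valid x → Valid y → Valid z → T (tadj x y) → T (tadj x z) → rank y ≤ rank x → rank z ≤ rank x → y ≡ z
    lower-unique (S i) (S j) (S k) vx vy vz t t' h h' with tadj-SS {i} {j} t | tadj-SS {i} {k} t'
    ... | inj₁ refl | _ = ⊥-elim (<⇒≱ ≤-refl h)
    ... | inj₂ refl | inj₁ refl = ⊥-elim (<⇒≱ ≤-refl h')
    ... | inj₂ refl | inj₂ refl = refl
    lower-unique (S i) (L j) z vx vy vz t t' h h' = ⊥-elim (<⇒≱ h vx)
    lower-unique (S i) (S j) (L k) vx vy vz t t' h h' = ⊥-elim (<⇒≱ h' vx)
    lower-unique (L j) (S i) (S k) vx vy vz t t' h h' = cong S (trans (sym (T-≡ᵇ {hub j} t)) (T-≡ᵇ {hub j} t'))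

  csuc-< : ∀ {m} (i : Fin (suc m)) → suc (Fin.toℕ i) < suc m → Fin.toℕ (csuc i) ≡ suc (Fin.toℕ i)
  csuc-< {m} i h with suc (Fin.toℕ i) <? suc m
  ... | yes p = toℕ-fromℕ< p
  ... | no ¬p = ⊥-elim (¬p h)

  csuc-≥ : ∀ {m} (i : Fin (suc m)) → suc m ≤ suc (Fin.toℕ i) → Fin.toℕ (csuc i) ≡ 0
  csuc-≥ {m} i h with suc (Fin.toℕ i) <? suc m
  ... | yes p = ⊥-elim (<⇒≱ p h)
  ... | no ¬p = refl

  csuc-surjective : ∀ {m} (i : Fin (suc m)) → ∃ λ j → csuc j ≡ i
  csuc-surjective {m} Fin.zero = Fin.fromℕ m , toℕ-injective (csuc-≥ (Fin.fromℕ m) (s≤s (≤-reflexive (sym (toℕ-fromℕ m)))))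
  csuc-surjective {suc m} (Fin.suc i) = Fin.inject₁ i , toℕ-injective (trans (csuc-< (Fin.inject₁ i) lt) (cong suc (toℕ-inject₁ i)))
    where
    lt : suc (Fin.toℕ (Fin.inject₁ i)) < suc (suc m)
    lt = s≤s (≤-trans (s≤s (≤-reflexive (toℕ-inject₁ i))) (toℕ<n i))

  csuc²≢ : ∀ {k} (j : Fin (3 + k)) → csuc (csuc j) ≢ j
  csuc²≢ {k} j eq with <-or-≥ (suc (Fin.toℕ j)) (3 + k)
  ... | inj₂ ge = <⇒≱ (subst (λ x → suc x < 3 + k) (sym (trans (cong Fin.toℕ (sym eq)) one)) (s≤s (s≤s (s≤s z≤n)))) ge
    where
    zero' : Fin.toℕ (csuc j) ≡ 0
    zero' = csuc-≥ j ge
    one : Fin.toℕ (csuc (csuc j)) ≡ 1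
    one = trans (csuc-< (csuc j) (subst (λ x → suc x < 3 + k) (sym zero') (s≤s (s≤s z≤n)))) (cong suc zero')
  ... | inj₁ lt with <-or-≥ (suc (Fin.toℕ (csuc j))) (3 + k)
  ...   | inj₁ lt' = <⇒≢ (≤-trans (n≤1+n _) ≤-refl) (trans (cong Fin.toℕ (sym eq)) (trans (csuc-< (csuc j) lt') (cong suc (csuc-< j lt))))
  ...   | inj₂ ge' = <⇒≱ (subst (λ x → suc x < 3 + k) (sym (trans (csuc-< j lt) (cong suc (trans (cong Fin.toℕ (sym eq)) (csuc-≥ (csuc j) ge')))))
          (s≤s (s≤s (s≤s z≤n)))) ge'

  argmax : ∀ {m} (f : Fin (suc m) → ℕ) → ∃ λ i → ∀ j → f j ≤ f i
  argmax {zero} f = Fin.zero , λ { Fin.zero → ≤-refl }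
  argmax {suc m} f with argmax (f ∘ Fin.suc)
  ... | i , h with ≤-total (f Fin.zero) (f (Fin.suc i))
  ...   | inj₁ le = Fin.suc i , λ { Fin.zero → le ; (Fin.suc j) → h j }
  ...   | inj₂ ge = Fin.zero , λ { Fin.zero → ≤-refl ; (Fin.suc j) → ≤-trans (h j) ge }

  cnt≥ : ∀ {n} (f : Fin n → Bool) {xs F} → Unique F → (∀ {v} → v ∈ F → v ∈ xs × T (f v)) → length F ≤ cnt f xs
  cnt≥ f {xs} uF h = ≤-trans (⊆⇒length≤ uF (λ m → ∈-sel⁺ f (proj₁ (h m)) (proj₂ (h m)))) (≤-reflexive (length-sel f xs))

  cnt≤1 : ∀ {n} (f : Fin n → Bool) {xs} → Unique xs → (∀ {u v} → T (f u) → T (f v) → u ≡ v) → cnt f xs ≤ 1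
  cnt≤1 f {xs} u h = ≤-trans (≤-reflexive (sym (length-sel f xs))) (go (sel f xs) (Unique-sel f u) (λ m → proj₂ (∈-sel⁻ f xs m)))
    where
    go : ∀ ys → Unique ys → (∀ {y} → y ∈ ys → T (f y)) → length ys ≤ 1
    go [] _ _ = z≤n
    go (y ∷ []) _ _ = ≤-refl
    go (y ∷ y' ∷ ys) ((ne ∷ _) ∷ _) t = ⊥-elim (ne (h (t (here refl)) (t (there (here refl)))))

  module Halin {n : ℕ} (G : Graph n) (p' d ℓ : ℕ) (1≤d : 1 ≤ d) (long : suc p' + d + 2 ≤ ℓ) where
    open Model p' d ℓ 1≤d long

    module Labelled
      (ι : Node → Fin n) (κ : Fin n → Node) (κι : ∀ x → Valid x → κ (ι x) ≡ x) (ικ : ∀ v → ι (κ v) ≡ v) (κ-valid : ∀ v → Valid (κ v))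
      (spine-edge : ∀ i → suc i ≤ p → Adj G (ι (S i)) (ι (S (suc i))))
      (rim-edge : ∀ j → suc j < ℓ → Adj G (ι (L j)) (ι (L (suc j))))
      (closing-edge : ∀ j → suc j ≡ ℓ → Adj G (ι (L j)) (ι (L 0)))
      (spoke-edge : ∀ j → j < ℓ → Adj G (ι (S (hub j))) (ι (L j)))
      (4≤n : 4 ≤ n) where

      Tr : Graph n
      Tr = record { adj = λ u v → tadj (κ u) (κ v) ; sym = λ u v → tadj-sym (κ u) (κ v) ; irrefl = λ v → tadj-irrefl (κ v) }

      adj⁺ : ∀ {x y} → Valid x → Valid y → T (tadj x y) → Adj Tr (ι x) (ι y)
      adj⁺ {x} {y} vx vy = subst₂ (λ a b → T (tadj a b)) (sym (κι x vx)) (sym (κι y vy))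

      ι-injective : ∀ {x y} → Valid x → Valid y → ι x ≡ ι y → x ≡ y
      ι-injective {x} {y} vx vy eq = trans (sym (κι x vx)) (trans (cong κ eq) (κι y vy))

      κ-injective : ∀ {u v} → κ u ≡ κ v → u ≡ v
      κ-injective {u} {v} eq = trans (sym (ικ u)) (trans (cong ι eq) (ικ v))

      toRoot : ∀ x → Valid x → Walk Tr (λ _ → ⊤) (ι x) (ι (S 0))
      toRoot (S zero) v = here tt
      toRoot (S (suc i)) v = step tt (adj⁺ v (<⇒≤ v) (tadj-S' i)) (toRoot (S i) (<⇒≤ v))
      toRoot (L j) v = step tt (adj⁺ v (hub≤p j) (≡ᵇ-T {hub j} refl)) (spine (hub j) (hub≤p j))
        where
        spine : ∀ i → i ≤ p → Walk Tr (λ _ → ⊤) (ι (S i)) (ι (S 0))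
        spine zero v = here tt
        spine (suc i) v = step tt (adj⁺ v (<⇒≤ v) (tadj-S' i)) (spine i (<⇒≤ v))

      fromRoot : ∀ x → Valid x → Walk Tr (λ _ → ⊤) (ι (S 0)) (ι x)
      fromRoot (S zero) v = here tt
      fromRoot (S (suc i)) v = walk-trans (fromRoot (S i) (<⇒≤ v)) (step tt (adj⁺ (<⇒≤ v) v (tadj-S i)) (here tt))
      fromRoot (L j) v = walk-trans (spine (hub j) (hub≤p j)) (step tt (adj⁺ (hub≤p j) v (≡ᵇ-T {hub j} refl)) (here tt))
        where
        spine : ∀ i → i ≤ p → Walk Tr (λ _ → ⊤) (ι (S 0)) (ι (S i))
        spine zero v = here tt
        spine (suc i) v = walk-trans (spine i (<⇒≤ v)) (step tt (adj⁺ (<⇒≤ v) v (tadj-S i)) (here tt))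

      connected : Connected Tr
      connected u v = subst₂ (Walk Tr (λ _ → ⊤)) (ικ u) (ικ v) (walk-trans (toRoot (κ u) (κ-valid u)) (fromRoot (κ v) (κ-valid v)))

      acyclic : ¬ HasCycle Tr
      acyclic (k , c , inj , edge) with argmax (λ i → rank (κ (c i)))
      ... | i , max with csuc-surjective i
      ...   | j , refl = csuc²≢ j (inj (κ-injective (lower-unique (κ (c i)) (κ (c (csuc i))) (κ (c j)) (κ-valid _) (κ-valid _) (κ-valid _)
                (edge i) (subst T (tadj-sym (κ (c j)) (κ (c i))) (edge j)) (max (csuc i)) (max j))))

      deg≡ : ∀ v → deg Tr v ≡ cnt (adj Tr v) (L.allFin n)
      deg≡ v = cnt≡countTrue (adj Tr v) (L.allFin n)

      parent-unique : ∀ {j} → j < ℓ → ∀ {u} → Adj Tr u (ι (L j)) → u ≡ ι (S (hub j))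
      parent-unique {j} vj {u} t = trans (sym (ικ u)) (cong ι (go (κ u) (subst (λ x → T (tadj (κ u) x)) (κι (L j) vj) t)))
        where
        go : ∀ x → T (tadj x (L j)) → x ≡ S (hub j)
        go (S i) t = cong S (sym (T-≡ᵇ {hub j} t))

      leaf : ∀ {j} → j < ℓ → IsLeaf Tr (ι (L j))
      leaf {j} vj = ≤-antisym
        (≤-trans (≤-reflexive (deg≡ (ι (L j)))) (cnt≤1 _ (allFin⁺ n) (λ {u} {v} t t' →
          trans (parent-unique vj (subst T (adj-sym Tr (ι (L j)) u) t)) (sym (parent-unique vj (subst T (adj-sym Tr (ι (L j)) v) t'))))))
        (≤-trans (cnt≥ (adj Tr (ι (L j))) {L.allFin n} {ι (S (hub j)) ∷ []} ([] ∷ []) (λ { (here refl) → ∈-allFin _ , adj⁺ vj (hub≤p j) (≡ᵇ-T {hub j} refl) }))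
          (≤-reflexive (sym (deg≡ (ι (L j))))))

      L-injective : ∀ {i j} → L i ≡ L j → i ≡ j
      L-injective refl = refl

      three : ∀ {i x y z} → i ≤ p → Valid x → Valid y → Valid z → T (tadj (S i) x) → T (tadj (S i) y) → T (tadj (S i) z) →
        x ≢ y → x ≢ z → y ≢ z → 3 ≤ deg Tr (ι (S i))
      three {i} {x} {y} {z} vi vx vy vz tx ty tz xy xz yz = ≤-trans (cnt≥ (adj Tr (ι (S i))) {L.allFin n} {ι x ∷ ι y ∷ ι z ∷ []}
          (((λ e → xy (ι-injective vx vy e)) ∷ (λ e → xz (ι-injective vx vz e)) ∷ []) ∷ (((λ e → yz (ι-injective vy vz e)) ∷ []) ∷ ([] ∷ [])))
          (λ { (here refl) → ∈-allFin _ , adj⁺ vi vx tx ; (there (here refl)) → ∈-allFin _ , adj⁺ vi vy ty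
             ; (there (there (here refl))) → ∈-allFin _ , adj⁺ vi vz tz }))
        (≤-reflexive (sym (deg≡ (ι (S i)))))

      deg-hub : ∀ {i} → i ≤ p → 3 ≤ deg Tr (ι (S i))
      deg-hub {zero} vi = three {x = L 0} {L d} {S 1} vi (≤-trans (s≤s z≤n) d+p<ℓ) (≤-trans (s≤s (m≤m+n d p)) (<⇒≤ d+p<ℓ)) (s≤s z≤n)
        (≡ᵇ-T (hub-0 z≤n)) (≡ᵇ-T (hub-0 ≤-refl)) (tadj-S 0) (λ { refl → <⇒≱ 1≤d z≤n }) (λ ()) (λ ())
      deg-hub {suc i} vi with <-or-≥ (suc i) p
      ... | inj₁ lt = three {x = L (d + suc i)} {S i} {S (suc (suc i))} vi (≤-trans (s≤s (+-monoʳ-≤ d vi)) (<⇒≤ d+p<ℓ)) (<⇒≤ vi) lt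
        (≡ᵇ-T (hub-mid vi)) (tadj-S' i) (tadj-S (suc i)) (λ ()) (λ ()) (λ ())
      ... | inj₂ ge with ≤-antisym vi ge
      ...   | refl = three {x = L (d + p)} {L (suc (d + p))} {S p'} vi (<⇒≤ d+p<ℓ) d+p<ℓ (n≤1+n p')
        (≡ᵇ-T (hub-mid vi)) (≡ᵇ-T (trans (cong hub (sym (+-suc d p))) (hub-last (n≤1+n p)))) (tadj-S' p') (λ eq → <⇒≢ ≤-refl (L-injective eq)) (λ ()) (λ ())

      ¬leaf-hub : ∀ {i} → i ≤ p → ¬ IsLeaf Tr (ι (S i))
      ¬leaf-hub vi eq = <⇒≱ (s≤s (s≤s z≤n)) (≤-trans (deg-hub vi) (≤-reflexive eq))

      deg≢2 : ∀ v → deg Tr v ≢ 2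
      deg≢2 v eq = go (κ v) (κ-valid v) (ικ v)
        where
        go : ∀ x → Valid x → ι x ≡ v → ⊥
        go (S i) vx refl = <⇒≱ ≤-refl (≤-trans (deg-hub vx) (≤-reflexive eq))
        go (L j) vx refl with () ← trans (sym (leaf vx)) eq

      σ' : Fin n → Fin n → Fin n
      σ' v u = ι (rot (κ v) (κ u))

      σ'-ι : ∀ {x y} → Valid x → Valid y → σ' (ι x) (ι y) ≡ ι (rot x y)
      σ'-ι {x} {y} vx vy = cong₂ (λ a b → ι (rot a b)) (κι x vx) (κι y vy)

      Reaches : Node → Node → Node → Set
      Reaches x y z = ∃ λ k → iter (σ' (ι x)) k (ι y) ≡ ι z

      R-refl : ∀ {x y} → Reaches x y y
      R-refl = 0 , refl

      R-trans : ∀ {x y z w} → Reaches x y z → Reaches x z w → Reaches x y w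
      R-trans {x} {y} (k , p) (l , q) = l + k , trans (iter-+ (σ' (ι x)) l k (ι y)) (trans (cong (iter (σ' (ι x)) l) p) q)

      R-step : ∀ {x y z} → Valid x → Valid y → rot x y ≡ z → Reaches x y z
      R-step vx vy refl = 1 , σ'-ι vx vy

      after : ℕ → Node
      after i = if i <ᵇ p then S (suc i) else S (i ∸ 1)

      rot-leaf-after : ∀ {i j} → ¬ (suc j < ℓ × hub (suc j) ≡ i) → rot (S i) (L j) ≡ after i
      rot-leaf-after {i} {j} h = if-false (λ t → h (<ᵇ⇒< _ _ (proj₁ (T-∧⁻ t)) , T-≡ᵇ (proj₂ (T-∧⁻ {suc j <ᵇ ℓ} t))))

      leaf⇒after : ∀ fuel i j → i ≤ p → hub j ≡ i → j < ℓ → ℓ ≤ fuel + j → Reaches (S i) (L j) (after i)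
      leaf⇒after zero i j vi h lt f = ⊥-elim (<⇒≱ lt f)
      leaf⇒after (suc fuel) i j vi h lt f with test? i j
      ... | yes (a , b) = R-trans (R-step vi lt (rot-leaf-next a b)) (leaf⇒after fuel i (suc j) vi b a (≤-trans f (≤-reflexive (sym (+-suc fuel j)))))
      ... | no ¬t = R-step vi lt (rot-leaf-after ¬t)

      first⇒leaf : ∀ i j → i ≤ p → hub j ≡ i → j < ℓ → Reaches (S i) (L (first i)) (L j)
      first⇒leaf i zero vi h lt with trans (sym h) (hub-0 z≤n)
      ... | refl = R-refl
      first⇒leaf i (suc j) vi h lt with hub-step j
      ... | inj₁ same = R-trans (first⇒leaf i j vi (trans (sym same) h) (<⇒≤ lt)) (R-step vi (<⇒≤ lt) (rot-leaf-next lt h))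
      ... | inj₂ (up , eq) with trans (sym up) h
      ...   | refl = subst (λ k → Reaches (S (suc (hub j))) (L (first (suc (hub j)))) (L k)) (trans (+-suc d (hub j)) (cong suc (sym eq))) R-refl

      up⇒first : ∀ i → suc i ≤ p → Reaches (S i) (S (suc i)) (L (first i))
      up⇒first zero lt = R-step z≤n lt refl
      up⇒first (suc i) lt = R-trans (R-step (<⇒≤ lt) lt (rot-next i)) (R-step (<⇒≤ lt) (<⇒≤ (<⇒≤ lt)) (rot-prev i))

      first<ℓ : ∀ {i} → i ≤ p → first i < ℓ
      first<ℓ {zero} vi = ≤-trans (s≤s z≤n) d+p<ℓ
      first<ℓ {suc i} vi = ≤-trans (s≤s (+-monoʳ-≤ d vi)) (<⇒≤ d+p<ℓ)

      first⇒after : ∀ i → i ≤ p → Reaches (S i) (L (first i)) (after i)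
      first⇒after i vi = leaf⇒after ℓ i (first i) vi (hub-first vi) (first<ℓ vi) (m≤m+n ℓ (first i))

      after-up : ∀ {i} → i < p → after i ≡ S (suc i)
      after-up lt = if-true (<⇒<ᵇ lt)

      after-end : after p ≡ S p'
      after-end = if-false (λ t → <-irrefl refl (<ᵇ⇒< p p t))

      after⇒first : ∀ i → i ≤ p → Reaches (S i) (after i) (L (first i))
      after⇒first i vi with <-or-≥ i p
      ... | inj₁ lt rewrite after-up lt = up⇒first i lt
      ... | inj₂ ge with ≤-antisym vi ge
      ...   | refl rewrite after-end = R-step ≤-refl (n≤1+n p') (rot-prev p')

      toFirst : ∀ i y → i ≤ p → Valid y → T (tadj (S i) y) → Reaches (S i) y (L (first i))
      toFirst i (L j) vi vy t = R-trans (leaf⇒after ℓ i j vi (T-≡ᵇ t) vy (m≤m+n ℓ j)) (after⇒first i vi)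
      toFirst i (S k) vi vy t with tadj-SS {i} {k} t
      ... | inj₁ refl = up⇒first i vy
      ... | inj₂ refl = R-step vi vy (rot-prev k)

      fromFirst : ∀ i z → i ≤ p → Valid z → T (tadj (S i) z) → Reaches (S i) (L (first i)) z
      fromFirst i (L j) vi vz t = first⇒leaf i j vi (T-≡ᵇ t) vz
      fromFirst i (S k) vi vz t with tadj-SS {i} {k} t
      ... | inj₁ refl = subst (Reaches (S i) (L (first i))) (after-up vz) (first⇒after i vi)
      ... | inj₂ refl with <-or-≥ i p
      ...   | inj₁ lt = R-trans (subst (Reaches (S i) (L (first i))) (after-up lt) (first⇒after i vi)) (R-step vi lt (rot-next k))
      ...   | inj₂ ge with ≤-antisym vi ge
      ...     | refl = subst (Reaches (S p) (L (first p))) after-end (first⇒after p vi)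

      cyclic-node : ∀ x y z → Valid x → Valid y → Valid z → T (tadj x y) → T (tadj x z) → Reaches x y z
      cyclic-node (S i) y z vx vy vz t t' = R-trans (toFirst i y vx vy t) (fromFirst i z vx vz t')
      cyclic-node (L j) (S i) (S k) vx vy vz t t' with trans (sym (T-≡ᵇ {hub j} t)) (T-≡ᵇ {hub j} t')
      ... | refl = R-refl

      ρ : Rotation Tr
      ρ = record
        { σ = σ'
        ; closed = λ v u t → let a , b = rot-closed (κ v) (κ u) (κ-valid v) (κ-valid u) t in subst (λ x → T (tadj (κ v) x)) (sym (κι _ b)) a
        ; cyclic = λ v u w t t' → let k , q = cyclic-node (κ v) (κ u) (κ w) (κ-valid v) (κ-valid u) (κ-valid w) t t' in
            k , subst₂ (λ a b → iter (σ' a) k b ≡ w) (ικ v) (ικ u) (trans q (ικ w)) }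

      next-ι : ∀ {x y} → Valid x → Valid y → nextDart ρ (ι x , ι y) ≡ (ι y , ι (rot y x))
      next-ι vx vy = cong (ι _ ,_) (σ'-ι vy vx)

      record Run (j : ℕ) (x y : Node) : Set where
        constructor run
        field
          {steps} : ℕ
          reached : iter (nextDart ρ) steps (ι (S (hub j)) , ι (L j)) ≡ (ι x , ι y)
          internal : ∀ i → 1 ≤ i → i < steps → ¬ IsLeaf Tr (proj₂ (iter (nextDart ρ) i (ι (S (hub j)) , ι (L j))))

      Run-step : ∀ {j x i z} → Valid x → i ≤ p → Run j x (S i) → rot (S i) x ≡ z → Run j (S i) z
      Run-step vx vi (run {k} r int) refl = run {steps = suc k} (trans (cong (nextDart ρ) r) (next-ι vx vi)) int'
        where
        int' : ∀ i → 1 ≤ i → i < suc k → _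
        int' i h (s≤s h') with m≤n⇒m<n∨m≡n h'
        ... | inj₁ lt = int i h lt
        ... | inj₂ refl = λ l → ¬leaf-hub vi (subst (IsLeaf Tr) (cong proj₂ r) l)

      Run-start : ∀ {j} → j < ℓ → Run j (L j) (S (hub j))
      Run-start {j} vj = run {steps = 1} (next-ι (hub≤p j) vj) (λ i h h' → ⊥-elim (<⇒≱ h' h))

      nxt-< : ∀ {j} → suc j < ℓ → nxt j ≡ suc j
      nxt-< h = if-true (<⇒<ᵇ h)

      nxt-≥ : ∀ {j} → ¬ suc j < ℓ → nxt j ≡ 0
      nxt-≥ h = if-false (h ∘ <ᵇ⇒< _ _)

      nxt<ℓ : ∀ j → nxt j < ℓ
      nxt<ℓ j with suc j <? ℓ
      ... | yes h rewrite nxt-< h = h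
      ... | no h rewrite nxt-≥ {j} h = ≤-trans (s≤s z≤n) d+p<ℓ

      Tour : ℕ → ℕ → Set
      Tour j k = NextLeaf ρ (ι (L j)) (ι (L k))

      finish : ∀ {j x i k} → j < ℓ → k < ℓ → Valid x → i ≤ p → Run j x (S i) → rot (S i) x ≡ L k → Tour j k
      finish {j} {x} {i} {k} vj vk vx vi r eq = toTour (Run-step vx vi r refl) (s≤s z≤n)
        where
        toTour : (r' : Run j (S i) (rot (S i) x)) → 1 ≤ Run.steps r' → Tour j k
        toTour (run {m} r int) 1≤m = leaf vj , leaf vk , (ι (S (hub j)) , ι (L j)) , adj⁺ (hub≤p j) vj (≡ᵇ-T {hub j} refl) , refl ,
          m , 1≤m , trans (cong proj₂ r) (cong ι eq) , int

      wrap : ∀ {j} i → suc i ≤ p → j < ℓ → Run j (S (suc i)) (S i) → Tour j 0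
      wrap zero vi vj r = finish vj (≤-trans (s≤s z≤n) d+p<ℓ) vi z≤n r refl
      wrap (suc i) vi vj r = wrap i (<⇒≤ vi) vj (Run-step vi (<⇒≤ vi) r (rot-next i))

      tour : ∀ j → j < ℓ → Tour j (nxt j)
      tour j vj with suc j <? ℓ
      ... | yes lt = subst (Tour j) (sym (nxt-< lt)) (go (hub-step j))
        where
        go : hub (suc j) ≡ hub j ⊎ (hub (suc j) ≡ suc (hub j) × j ≡ d + hub j) → Tour j (suc j)
        go (inj₁ same) = finish vj lt vj (hub≤p j) (Run-start vj) (rot-leaf-next lt same)
        go (inj₂ (up , eq)) = finish vj lt (hub≤p j) up≤p
            (Run-step vj (hub≤p j) (Run-start vj) (rot-leaf-up (λ (_ , h) → <⇒≢ ≤-refl (trans (sym h) up)) up≤p))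
            (trans (rot-prev (hub j)) (cong L (trans (+-suc d (hub j)) (cong suc (sym eq)))))
          where
          up≤p : suc (hub j) ≤ p
          up≤p = ≤-trans (≤-reflexive (sym up)) (hub≤p (suc j))
      ... | no ge = subst (Tour j) (sym (nxt-≥ {j} ge)) (wrap p' ≤-refl vj
            (Run-step vj ≤-refl (subst (λ i → Run j (L j) (S i)) last (Run-start vj)) (rot-leaf-end {j} (ge ∘ proj₁))))
        where
        last : hub j ≡ p
        last with m≤n⇒∃[o]m+o≡n {d} {j} (≤-trans (m≤m+n d p) (≤-pred (≤-trans (<⇒≤ d+p<ℓ) (≮⇒≥ ge))))
        ... | x , refl = hub-last (+-cancelˡ-≤ d p x (≤-pred (≤-trans (<⇒≤ d+p<ℓ) (≮⇒≥ ge))))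

      tour-unique : ∀ {j b} → j < ℓ → NextLeaf ρ (ι (L j)) b → b ≡ ι (L (nxt j))
      tour-unique {j} {b} vj (_ , lb , (x , y) , adj-xy , refl , k , 1≤k , hk , int) with tour j vj
      ... | (_ , lb' , (x' , y') , adj-xy' , refl , k' , 1≤k' , hk' , int') with parent-unique vj adj-xy | parent-unique vj adj-xy'
      ...   | refl | refl with <-cmp k k'
      ...     | tri< lt _ _ = ⊥-elim (int' k 1≤k lt (subst (IsLeaf Tr) (sym hk) lb))
      ...     | tri> _ _ gt = ⊥-elim (int k' 1≤k' gt (subst (IsLeaf Tr) (sym hk') lb'))
      ...     | tri≈ _ refl _ = trans (sym hk) hk'

      H : Graph n
      H = record { adj = λ u v → tadj (κ u) (κ v) ∨ cadj (κ u) (κ v)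
        ; sym = λ u v → cong₂ _∨_ (tadj-sym (κ u) (κ v)) (cadj-sym (κ u) (κ v))
        ; irrefl = λ v → cong₂ _∨_ (tadj-irrefl (κ v)) (cadj-irrefl (κ v)) }
        where
        cadj-sym : ∀ x y → cadj x y ≡ cadj y x
        cadj-sym (S _) (S _) = refl
        cadj-sym (S _) (L _) = refl
        cadj-sym (L _) (S _) = refl
        cadj-sym (L j) (L k) = ∨-comm (nxt j ≡ᵇ k) (nxt k ≡ᵇ j)
        nxt≢ : ∀ j → nxt j ≢ j
        nxt≢ j eq with suc j <? ℓ
        ... | yes h = <⇒≢ ≤-refl (sym (trans (sym (nxt-< h)) eq))
        ... | no h with trans (sym (nxt-≥ {j} h)) eq
        ...   | refl = h (≤-trans (s≤s (s≤s z≤n)) d+p<ℓ)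
        cadj-irrefl : ∀ x → cadj x x ≡ false
        cadj-irrefl (S _) = refl
        cadj-irrefl (L j) with nxt j ≡ᵇ j in eq
        ... | false = refl
        ... | true = ⊥-elim (nxt≢ j (T-≡ᵇ (subst T (sym eq) tt)))

      cadj⁻ : ∀ x y → T (cadj x y) → ∃ λ j → ∃ λ k → x ≡ L j × y ≡ L k × (nxt j ≡ k ⊎ nxt k ≡ j)
      cadj⁻ (L j) (L k) t with T-∨⁻ {nxt j ≡ᵇ k} t
      ... | inj₁ a = j , k , refl , refl , inj₁ (T-≡ᵇ a)
      ... | inj₂ b = j , k , refl , refl , inj₂ (T-≡ᵇ b)

      rim⇒NextLeaf : ∀ {u v j} → κ u ≡ L j → κ v ≡ L (nxt j) → NextLeaf ρ u v
      rim⇒NextLeaf {u} {v} {j} eu ev = subst₂ (NextLeaf ρ) (trans (cong ι (sym eu)) (ικ u)) (trans (cong ι (sym ev)) (ικ v))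
        (tour j (subst Valid eu (κ-valid u)))

      NextLeaf⇒rim : ∀ {u v} → NextLeaf ρ u v → ∃ λ j → κ u ≡ L j × κ v ≡ L (nxt j)
      NextLeaf⇒rim {u} {v} nl = go (κ u) refl
        where
        go : ∀ x → κ u ≡ x → ∃ λ j → κ u ≡ L j × κ v ≡ L (nxt j)
        go (S i) eq = ⊥-elim (¬leaf-hub (subst Valid eq (κ-valid u)) (subst (IsLeaf Tr) (trans (sym (ικ u)) (cong ι eq)) (proj₁ nl)))
        go (L j) eq = j , eq , trans (cong κ (tour-unique (subst Valid eq (κ-valid u)) (subst (λ u → NextLeaf ρ u v) (trans (sym (ικ u)) (cong ι eq)) nl)))
          (κι (L (nxt j)) (nxt<ℓ j))

      halin : IsHalin H
      halin = 4≤n , Tr , ((connected , acyclic) , deg≢2) , ρ , λ u v → fwd u v , bwd u v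
        where
        fwd : ∀ u v → Adj H u v → Adj Tr u v ⊎ NextLeaf ρ u v ⊎ NextLeaf ρ v u
        fwd u v t with T-∨⁻ {tadj (κ u) (κ v)} t
        ... | inj₁ a = inj₁ a
        ... | inj₂ b with cadj⁻ (κ u) (κ v) b
        ...   | j , k , eu , ev , inj₁ refl = inj₂ (inj₁ (rim⇒NextLeaf eu ev))
        ...   | j , k , eu , ev , inj₂ refl = inj₂ (inj₂ (rim⇒NextLeaf ev eu))
        bwd : ∀ u v → Adj Tr u v ⊎ NextLeaf ρ u v ⊎ NextLeaf ρ v u → Adj H u v
        bwd u v (inj₁ t) = T-∨⁺ (inj₁ t)
        bwd u v (inj₂ (inj₁ nl)) with NextLeaf⇒rim nl
        ... | j , eu , ev = T-∨⁺ {tadj (κ u) (κ v)} (inj₂ (subst₂ (λ x y → T (cadj x y)) (sym eu) (sym ev) (T-∨⁺ {nxt j ≡ᵇ nxt j} (inj₁ (≡ᵇ-T {nxt j} refl)))))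
        bwd u v (inj₂ (inj₂ nl)) with NextLeaf⇒rim nl
        ... | j , ev , eu = T-∨⁺ {tadj (κ u) (κ v)} (inj₂ (subst₂ (λ x y → T (cadj x y)) (sym eu) (sym ev) (T-∨⁺ {nxt (nxt j) ≡ᵇ j} (inj₂ (≡ᵇ-T {nxt j} refl)))))

      Gsym : ∀ {u v} → Adj G u v → Adj G v u
      Gsym {u} {v} = subst T (adj-sym G u v)

      rim : ∀ j k → j < ℓ → nxt j ≡ k → Adj G (ι (L j)) (ι (L k))
      rim j k vj eq with suc j <? ℓ
      ... | yes h = subst (λ k → Adj G (ι (L j)) (ι (L k))) (trans (sym (nxt-< h)) eq) (rim-edge j h)
      ... | no h = subst (λ k → Adj G (ι (L j)) (ι (L k))) (trans (sym (nxt-≥ {j} h)) eq) (closing-edge j (≤-antisym vj (≮⇒≥ h)))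

      ι-edge : ∀ x y → Valid x → Valid y → T (tadj x y) ⊎ T (cadj x y) → Adj G (ι x) (ι y)
      ι-edge (S i) (S j) vx vy (inj₁ t) with tadj-SS {i} {j} t
      ... | inj₁ refl = spine-edge i vy
      ... | inj₂ refl = Gsym (spine-edge j vx)
      ι-edge (S i) (L j) vx vy (inj₁ t) with T-≡ᵇ {hub j} t
      ... | refl = spoke-edge j vy
      ι-edge (L j) (S i) vx vy (inj₁ t) with T-≡ᵇ {hub j} t
      ... | refl = Gsym (spoke-edge j vx)
      ι-edge (L j) (L k) vx vy (inj₂ t) with T-∨⁻ {nxt j ≡ᵇ k} t
      ... | inj₁ a = rim j k vx (T-≡ᵇ a)
      ... | inj₂ b = Gsym (rim k j vy (T-≡ᵇ b))

      spanningHalin : HasSpanningHalin G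
      spanningHalin = H , (λ u v t → subst₂ (Adj G) (ικ u) (ικ v) (ι-edge (κ u) (κ v) (κ-valid u) (κ-valid v) (T-∨⁻ {tadj (κ u) (κ v)} t))) , halin

  module FromRows {n : ℕ} (G : Graph n) where
    open Tiles G

    data Trail : V → List V → V → Set where
      one : ∀ {x} → Trail x (x ∷ []) x
      more : ∀ {x y xs z} → x ~ y → Trail y xs z → Trail x (x ∷ xs) z

    Trail-++ : ∀ {x xs y x' ys y'} → Trail x xs y → y ~ x' → Trail x' ys y' → Trail x (xs ++ ys) y'
    Trail-++ one a t = more a t
    Trail-++ (more b s) a t = more b (Trail-++ s a t)

    nth : V → List V → ℕ → V
    nth v [] i = v
    nth v (x ∷ xs) zero = x
    nth v (x ∷ xs) (suc i) = nth v xs i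

    nth∈ : ∀ v xs {i} → i < length xs → nth v xs i ∈ xs
    nth∈ v (x ∷ xs) {zero} h = here refl
    nth∈ v (x ∷ xs) {suc i} (s≤s h) = there (nth∈ v xs h)

    nth-++ˡ : ∀ v xs {ys i} → i < length xs → nth v (xs ++ ys) i ≡ nth v xs i
    nth-++ˡ v (x ∷ xs) {i = zero} h = refl
    nth-++ˡ v (x ∷ xs) {i = suc i} (s≤s h) = nth-++ˡ v xs h

    nth-++ʳ : ∀ v xs {ys} i → nth v (xs ++ ys) (length xs + i) ≡ nth v ys i
    nth-++ʳ v [] i = refl
    nth-++ʳ v (x ∷ xs) i = nth-++ʳ v xs i

    index : V → List V → ℕ
    index v [] = 0
    index v (x ∷ xs) with v Fin.≟ x
    ... | yes _ = 0
    ... | no _ = suc (index v xs)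

    index< : ∀ {v xs} → v ∈ xs → index v xs < length xs
    index< {v} {x ∷ xs} m with v Fin.≟ x
    ... | yes _ = s≤s z≤n
    index< {v} {x ∷ xs} (here eq) | no ne = ⊥-elim (ne eq)
    index< {v} {x ∷ xs} (there m) | no ne = s≤s (index< m)

    nth-index : ∀ w {v xs} → v ∈ xs → nth w xs (index v xs) ≡ v
    nth-index w {v} {x ∷ xs} m with v Fin.≟ x
    ... | yes eq = sym eq
    nth-index w {v} {x ∷ xs} (here eq) | no ne = ⊥-elim (ne eq)
    nth-index w {v} {x ∷ xs} (there m) | no ne = nth-index w m

    index-nth : ∀ w {xs} → Unique xs → ∀ {i} → i < length xs → index (nth w xs i) xs ≡ i
    index-nth w {x ∷ xs} (a ∷ u) {zero} h with x Fin.≟ x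
    ... | yes _ = refl
    ... | no ne = ⊥-elim (ne refl)
    index-nth w {x ∷ xs} (a ∷ u) {suc i} (s≤s h) with nth w xs i Fin.≟ x
    ... | yes eq = ⊥-elim (All.lookup a (nth∈ w xs h) (sym eq))
    ... | no _ = cong suc (index-nth w u h)

    Trail-edge : ∀ w {x xs y} → Trail x xs y → ∀ {j} → suc j < length xs → nth w xs j ~ nth w xs (suc j)
    Trail-edge w one (s≤s ())
    Trail-edge w (more a one) {zero} h = a
    Trail-edge w (more a (more b t)) {zero} h = a
    Trail-edge w (more a t) {suc j} (s≤s h) = Trail-edge w t h

    Trail-first : ∀ w {x xs y} → Trail x xs y → nth w xs 0 ≡ x
    Trail-first w one = refl
    Trail-first w (more _ _) = refl

    Trail-last : ∀ w {x xs y} → Trail x xs y → ∀ {j} → suc j ≡ length xs → nth w xs j ≡ y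
    Trail-last w one {zero} eq = refl
    Trail-last w (more a one) {suc zero} eq = refl
    Trail-last w (more a (more b t)) {suc j} eq = Trail-last w (more b t) (suc-injective eq)

    Trail-length : ∀ {x xs y} → Trail x xs y → 1 ≤ length xs
    Trail-length one = s≤s z≤n
    Trail-length (more _ _) = s≤s z≤n

    record Rows (a b x y : V) (vs : List V) : Set where
      field
        {Sp Lf} : List V
        spine : Trail a Sp x
        leaves : Trail b Lf y
        same : length Sp ≡ length Lf
        rungs : ∀ w {i} → i < length Sp → nth w Sp i ~ nth w Lf i
        cover : vs ↭ Sp ++ Lf

    flip : ∀ {a b x y vs} → Rows a b x y vs → Rows b a y x vs
    flip r = record { spine = r.leaves ; leaves = r.spine ; same = sym r.same ; rungs = λ w h → ~sym (r.rungs w (≤-trans h (≤-reflexive (sym r.same))))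
      ; cover = ↭tr r.cover (++-comm r.Sp r.Lf) }
      where module r = Rows r

    single : ∀ {a b} → a ~ b → Rows a b a b (a ∷ b ∷ [])
    single e = record { spine = one ; leaves = one ; same = refl ; rungs = λ { w {zero} h → e ; w {suc i} (s≤s ()) } ; cover = ↭refl }

    extendRows : ∀ {a b c d x y vs} → a ~ b → a ~ c → b ~ d → Rows c d x y vs → Rows a b x y (a ∷ b ∷ vs)
    extendRows {a} {b} e p q r = record { spine = more p r.spine ; leaves = more q r.leaves ; same = cong suc r.same
      ; rungs = λ { w {zero} h → e ; w {suc i} (s≤s h) → r.rungs w h }
      ; cover = prep a (↭tr (prep b r.cover) (↭-sym (shift b r.Sp r.Lf))) }
      where module r = Rows r

    orient : ∀ {a b f₁ f₂} (c : Chain (a , b) [] (f₁ , f₂)) → Rows a b f₁ f₂ (cverts c) ⊎ Rows a b f₂ f₁ (cverts c)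
    orient (end e) = inj₁ (single e)
    orient (step e (inj₁ (p , q)) c) with orient c
    ... | inj₁ r = inj₁ (extendRows e p q r)
    ... | inj₂ r = inj₂ (extendRows e p q r)
    orient (step e (inj₂ (p , q)) c) with orient c
    ... | inj₁ r = inj₂ (extendRows e p q (flip r))
    ... | inj₂ r = inj₁ (extendRows e p q (flip r))

    -- The hubs are one row of the ladder; the rim is the other row, extended by pre at the first hub and by post at the last.
    halinFromRows : ∀ {e₁ e₂ x y vs b₀ pre b₁ c₀ post c₁} → Rows e₁ e₂ x y vs → 4 ≤ length vs →
      Trail b₀ pre b₁ → b₁ ~ e₂ → (∀ {v} → v ∈ pre → e₁ ~ v) →
      Trail c₀ post c₁ → y ~ c₀ → (∀ {v} → v ∈ post → x ~ v) → c₁ ~ b₀ →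
      L.allFin n ↭ pre ++ vs ++ post → HasSpanningHalin G
    halinFromRows {e₁} {e₂} {x} {y} {vs} {b₀} {pre} {b₁} {c₀} {post} {c₁} r 4≤vs tpre b₁e₂ apre tpost yc₀ apost c₁b₀ cover =
      withLength (length Sp ∸ 2) (trans (sym (m+[n∸m]≡n 2≤Sp)) refl)
      where
      open Rows r using (Sp; Lf; spine; leaves; same; rungs)
      rim : List V
      rim = pre ++ Lf ++ post
      trim : Trail b₀ rim c₁
      trim = Trail-++ tpre b₁e₂ (Trail-++ leaves yc₀ tpost)
      all↭ : L.allFin n ↭ Sp ++ rim
      all↭ = ↭tr cover (↭tr (++⁺ˡ pre (++⁺ʳ post (Rows.cover r))) (psolve 4 (λ a s l b → a ⊕ ((s ⊕ l) ⊕ b) ⊜ s ⊕ (a ⊕ (l ⊕ b))) ↭-refl pre Sp Lf post))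
      u : Unique (Sp ++ rim)
      u = Unique-↭ all↭ (allFin⁺ n)
      d ℓ : ℕ
      d = length pre
      ℓ = length rim
      lenℓ : ℓ ≡ d + (length Sp + length post)
      lenℓ = trans (length-++ pre) (cong (d +_) (trans (length-++ Lf) (cong (_+ length post) (sym same))))
      lenvs : length vs ≡ length Sp + length Sp
      lenvs = trans (↭-length (Rows.cover r)) (trans (length-++ Sp) (cong (length Sp +_) (sym same)))
      2≤Sp : 2 ≤ length Sp
      2≤Sp = *-cancelˡ-≤ 2 (≤-trans 4≤vs (≤-reflexive (trans lenvs (lem (length Sp)))))
        where
        lem : ∀ s → s + s ≡ 2 * s
        lem = solve-∀
      4≤n : 4 ≤ n
      4≤n = ≤-trans 4≤vs (≤-trans (≤-trans (m≤m+n (length vs) (length post)) (≤-trans (m≤n+m _ d)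
        (≤-reflexive (sym (trans (↭-length cover) (trans (length-++ pre) (cong (d +_) (length-++ vs)))))))) (≤-reflexive (length-tabulate id)))
      κ : V → Node
      κ v = if inᵇ Sp v then S (index v Sp) else L (index v rim)
      κ-∈ : ∀ {v} → v ∈ Sp → κ v ≡ S (index v Sp)
      κ-∈ {v} m with v ∈? Sp
      ... | yes _ = refl
      ... | no h = ⊥-elim (h m)
      κ-∉ : ∀ {v} → v ∉ Sp → κ v ≡ L (index v rim)
      κ-∉ {v} h with v ∈? Sp
      ... | yes m = ⊥-elim (h m)
      ... | no _ = refl
      ι : Node → V
      ι (S i) = nth e₁ Sp i
      ι (L j) = nth e₁ rim j
      ∈rim : ∀ {v} → v ∉ Sp → v ∈ rim
      ∈rim {v} h with ∈-++⁻ Sp (∈-resp-↭ all↭ (∈-allFin v))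
      ... | inj₁ m = ⊥-elim (h m)
      ... | inj₂ m = m
      ικ : ∀ v → ι (κ v) ≡ v
      ικ v with v ∈? Sp
      ... | yes m = nth-index e₁ m
      ... | no h = nth-index e₁ (∈rim h)

      withLength : ∀ p' → length Sp ≡ suc (suc p') → HasSpanningHalin G
      withLength p' eq = H.spanningHalin
        where
        1≤d : 1 ≤ d
        1≤d = Trail-length tpre
        long : suc p' + d + 2 ≤ ℓ
        long = ≤-trans (linear {b = length post} 0 (Trail-length tpost) (lem p' d (length post))) (≤-reflexive (trans (cong (λ s → d + (s + length post)) (sym eq)) (sym lenℓ)))
          where
          lem : ∀ p' d l → suc p' + d + 2 + l + 0 ≡ d + (suc (suc p') + l) + 1
          lem = solve-∀
        open Model p' d ℓ 1≤d long
        <Sp : ∀ {i} → i ≤ p → i < length Sp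
        <Sp h = ≤-trans (s≤s h) (≤-reflexive (sym eq))
        κι : ∀ x → Valid x → κ (ι x) ≡ x
        κι (S i) h = trans (κ-∈ (nth∈ e₁ Sp (<Sp h))) (cong S (index-nth e₁ (Unique-++ˡ Sp u) (<Sp h)))
        κι (L j) h = trans (κ-∉ (λ m → Unique-disjoint Sp u m (nth∈ e₁ rim h))) (cong L (index-nth e₁ (Unique-++ʳ Sp u) h))
        κ-valid : ∀ v → Valid (κ v)
        κ-valid v with v ∈? Sp
        ... | yes m = ≤-pred (≤-trans (index< m) (≤-reflexive eq))
        ... | no h = index< (∈rim h)
        spoke : ∀ j → j < ℓ → ι (S (hub j)) ~ ι (L j)
        spoke j h with <-or-≥ j d
        ... | inj₁ lt = subst₂ _~_ (sym (trans (cong (nth e₁ Sp) (hub-0 (<⇒≤ lt))) (Trail-first e₁ spine))) (sym (nth-++ˡ e₁ pre lt)) (apre (nth∈ e₁ pre lt))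
        ... | inj₂ ge with m≤n⇒∃[o]m+o≡n ge
        ...   | i , refl with <-or-≥ i (length Sp)
        ...     | inj₁ lt = subst₂ _~_ (cong (nth e₁ Sp) (sym (hub-mid (≤-pred (≤-trans lt (≤-reflexive eq))))))
                  (sym (trans (nth-++ʳ e₁ pre i) (nth-++ˡ e₁ Lf (≤-trans lt (≤-reflexive same))))) (rungs e₁ lt)
        ...     | inj₂ ge' with m≤n⇒∃[o]m+o≡n ge'
        ...       | k , refl = subst₂ _~_ (sym (trans (cong (nth e₁ Sp) (hub-last (≤-trans (n≤1+n p) (≤-trans (≤-reflexive (sym eq)) (m≤m+n (length Sp) k)))))
                      (Trail-last e₁ spine (sym eq))))
                    (sym (trans (nth-++ʳ e₁ pre (length Sp + k)) (trans (cong (λ s → nth e₁ (Lf ++ post) (s + k)) same) (nth-++ʳ e₁ Lf k))))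
                    (apost (nth∈ e₁ post (+-cancelˡ-≤ (d + length Sp) _ _ (≤-trans (≤-reflexive (trans (+-suc (d + length Sp) k) (cong suc (+-assoc d (length Sp) k))))
                      (≤-trans h (≤-reflexive (trans lenℓ (sym (+-assoc d (length Sp) (length post))))))))))
        module H = Halin.Labelled G p' d ℓ 1≤d long ι κ κι ικ κ-valid
          (λ i h → Trail-edge e₁ spine (≤-trans (s≤s h) (≤-reflexive (sym eq))))
          (λ j h → Trail-edge e₁ trim h)
          (λ j h → subst₂ _~_ (sym (Trail-last e₁ trim h)) (sym (Trail-first e₁ trim)) c₁b₀)
          spoke 4≤n

    halinFromChain : ∀ {e₁ e₂ f₁ f₂ b₀ pre b₁ c₀ post c₁} (c : Chain (e₁ , e₂) [] (f₁ , f₂)) → 4 ≤ length (cverts c) →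
      Trail b₀ pre b₁ → b₁ ~ e₂ → (∀ {v} → v ∈ pre → e₁ ~ v) →
      Trail c₀ post c₁ → (∀ {v} → v ∈ post → f₁ ~ v × f₂ ~ v) → c₀ ∈ post → c₁ ~ b₀ →
      L.allFin n ↭ pre ++ cverts c ++ post → HasSpanningHalin G
    halinFromChain c 4≤ tpre be apre tpost apost ic₀ cb cover with orient c
    ... | inj₁ r = halinFromRows r 4≤ tpre be apre tpost (proj₂ (apost ic₀)) (proj₁ ∘ apost) cb cover
    ... | inj₂ r = halinFromRows r 4≤ tpre be apre tpost (proj₁ (apost ic₀)) (proj₂ ∘ apost) cb cover

  -- Expanding graphs

  module CaseTwo {n : ℕ} (G : Graph n) (h g a z : ℕ) (1≤h : 1 ≤ h) (1≤g : 1 ≤ g)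
    (degree : ∀ v → n + 1 ≤ 2 * cnt (adj G v) (L.allFin n))
    (a-bound : 2 * (a + 2 * z + 3) ≤ n + 1)
    (expanding : ∀ A A' B B' → L.allFin n ↭ A ++ A' → L.allFin n ↭ B ++ B' → a ≤ length A → a ≤ length B → n * n ≤ g * Tiles.e G A B)
    (n≤hz : n ≤ h * z) (3≤z : 3 ≤ z)
    (large : ladderThreshold h g + 7 ≤ n) (large₁ : 10 * g < n) (large₂ : 7200 * h + 7 ≤ n) where
    open Tiles G
    open FromRows G

    all : List V
    all = L.allFin n

    uall : Unique all
    uall = allFin⁺ n

    |all| : length all ≡ n
    |all| = length-tabulate id

    deg≥ : ∀ v → a + 2 * z + 3 ≤ cnt (adj G v) all
    deg≥ v = *-cancelˡ-≤ 2 (≤-trans a-bound (degree v))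

    module Remaining (X : List V) (few : length X ≤ 3) (e₁ e₂ f₁ f₂ : V) (V₀ : List V) (part : all ↭ X ++ (e₁ ∷ e₂ ∷ f₁ ∷ f₂ ∷ V₀)) where

      Vs : List V
      Vs = e₁ ∷ e₂ ∷ f₁ ∷ f₂ ∷ V₀

      L₀ : ℕ
      L₀ = length V₀

      size : n ≡ length X + (4 + L₀)
      size = trans (sym |all|) (trans (↭-length part) (length-++ X))

      uVs : Unique Vs
      uVs = Unique-++ʳ X (Unique-↭ part uall)

      H1 : ∀ {v} → v ∈ Vs → a + 2 * z ≤ cnt (adj G v) Vs
      H1 {v} _ = +-cancelʳ-≤ 3 _ _ (≤-trans (deg≥ v) (≤-trans (≤-reflexive (trans (∑-↭ _ part) (trans (∑-++ _ X Vs) (+-comm _ (cnt (adj G v) Vs)))))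
        (+-monoʳ-≤ (cnt (adj G v) Vs) (≤-trans (cnt≤length (adj G v) X) few))))

      H2 : ∀ A A' B B' → Vs ↭ A ++ A' → Vs ↭ B ++ B' → a ≤ length A → a ≤ length B → (4 + L₀) * (4 + L₀) ≤ g * e A B
      H2 A A' B B' p q lA lB = ≤-trans (*-mono-≤ s s) (expanding A (A' ++ X) B (B' ++ X) (ext A A' p) (ext B B' q) lA lB)
        where
        s : 4 + L₀ ≤ n
        s = ≤-trans (m≤n+m _ (length X)) (≤-reflexive (sym size))
        ext : ∀ A A' → Vs ↭ A ++ A' → all ↭ A ++ (A' ++ X)
        ext A A' p = ↭tr part (↭tr (++⁺ˡ X p) (psolve 3 (λ x a b → x ⊕ (a ⊕ b) ⊜ a ⊕ (b ⊕ x)) ↭-refl X A A'))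

      deg₀ : ∀ v → n + 1 ≤ 2 * (cnt (adj G v) V₀ + 7)
      deg₀ v = ≤-trans (degree v) (*-monoʳ-≤ 2 (≤-trans (≤-reflexive (trans (∑-↭ _ part') (trans (∑-++ _ V₀ (X ++ e₁ ∷ e₂ ∷ f₁ ∷ f₂ ∷ [])) refl)))
        (+-monoʳ-≤ (cnt (adj G v) V₀) (≤-trans (cnt≤length (adj G v) (X ++ e₁ ∷ e₂ ∷ f₁ ∷ f₂ ∷ [])) (≤-trans (≤-reflexive (length-++ X)) (+-monoˡ-≤ 4 few))))))
        where
        part' : all ↭ V₀ ++ (X ++ (e₁ ∷ e₂ ∷ f₁ ∷ f₂ ∷ []))
        part' = ↭tr part (psolve 3 (λ x f v → x ⊕ (f ⊕ v) ⊜ v ⊕ (x ⊕ f)) ↭-refl X (e₁ ∷ e₂ ∷ f₁ ∷ f₂ ∷ []) V₀)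

      H3 : ∀ U U' → V₀ ↭ U ++ U' → L₀ ≤ 100 * h * length U → 8 * (100 * h) * (length U * L₀) ≤ 16 * (100 * h) * e U V₀ + length U * L₀
      H3 U U' p _ = linear {a = 8 * (100 * h) * (u * (n + 1)) + u * (7200 * h + 7)} {b = 8 * (100 * h) * (2 * (e U V₀ + u * 7)) + u * (7 + L₀)} (u * (800 * h * (length X)) )
          (+-mono-≤ (*-monoʳ-≤ (8 * (100 * h)) sumDeg) (*-monoʳ-≤ u (≤-trans large₂ (≤-trans (≤-reflexive size) (+-monoˡ-≤ (4 + L₀) few)))))
          (subst (λ n → 8 * (100 * h) * (u * L₀) + (8 * (100 * h) * (2 * (e U V₀ + u * 7)) + u * (7 + L₀)) + u * (800 * h * length X) ≡
            16 * (100 * h) * e U V₀ + u * L₀ + (8 * (100 * h) * (u * (n + 1)) + u * (7200 * h + 7))) (sym size) (lem h u L₀ (e U V₀) (length X)))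
        where
        u : ℕ
        u = length U
        sumDeg : u * (n + 1) ≤ 2 * (e U V₀ + u * 7)
        sumDeg = ≤-trans (≤-reflexive (trans (*-comm u (n + 1)) (sym (∑-const (n + 1) U)))) (≤-trans (∑-mono U (λ {v} _ → deg₀ v))
          (≤-reflexive (trans (∑-* 2 _ U) (cong (2 *_) (trans (∑-+ _ _ U) (cong (e U V₀ +_) (trans (∑-const 7 U) (*-comm 7 u))))))))
        lem : ∀ h u l e x → 8 * (100 * h) * (u * l) + (8 * (100 * h) * (2 * (e + u * 7)) + u * (7 + l)) + u * (800 * h * x) ≡
            16 * (100 * h) * e + u * l + (8 * (100 * h) * (u * (x + (4 + l) + 1)) + u * (7200 * h + 7))
        lem = solve-∀

      ladder : e₁ ~ e₂ → f₁ ~ f₂ → 2 ∣ 4 + L₀ → Σ (Chain (e₁ , e₂) [] (f₁ , f₂)) λ c → Vs ↭ cverts c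
      ladder ee ff even = Ladders.spanningLadder G e₁ e₂ f₁ f₂ V₀ h g a z uVs 1≤h 1≤g H1 H2 H3 ee ff even
        (+-cancelʳ-≤ 7 _ _ (≤-trans large (≤-trans (≤-reflexive size) (≤-trans (+-monoˡ-≤ (4 + L₀) few) (≤-reflexive (+-comm 7 L₀))))))
        (≤-trans (≤-trans (m≤n+m _ (length X)) (≤-reflexive (sym size))) n≤hz)

    -- Expansion is applied to N(v) ∖ F and N(v).
    triangle : ∀ v F → length F ≤ 5 → ∃ λ s → v ~ s × s ∉ F × 10 < cnt (adj G s) (sel (adj G v) all)
    triangle v F lF = go (∑-< (λ s → cnt (adj G s) A) (λ _ → 10) A' (subst (_< e A' A) (sym (∑-const 10 A')) dense))
      where
      A A' : List V
      A = sel (adj G v) all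
      f' : V → Bool
      f' u = adj G v u ∧ not (inᵇ F u)
      A' = sel f' all
      lA : a + 2 * z + 3 ≤ length A
      lA = ≤-trans (deg≥ v) (≤-reflexive (sym (length-sel (adj G v) all)))
      lA' : a ≤ length A'
      lA' = +-cancelʳ-≤ 5 a _ (≤-trans five (≤-trans (deg≥ v) (≤-trans (cnt-avoid (adj G v) F uall) (+-mono-≤ (≤-reflexive (sym (length-sel f' all))) lF))))
        where
        five : a + 5 ≤ a + 2 * z + 3
        five = linear {a = 2} {b = 2 * z} 0 (*-monoʳ-≤ 2 (≤-trans (s≤s z≤n) 3≤z)) (lem a z)
          where
          lem : ∀ a z → a + 5 + 2 * z + 0 ≡ a + 2 * z + 3 + 2
          lem = solve-∀
      lA'≤n : length A' ≤ n
      lA'≤n = ≤-trans (≤-reflexive (length-sel f' all)) (≤-trans (cnt≤length f' all) (≤-reflexive |all|))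
      dense : 10 * length A' < e A' A
      dense = *-cancelˡ-< g _ _ (≤-<-trans (≤-trans (≤-reflexive (trans (sym (*-assoc g 10 (length A'))) (cong (_* length A') (*-comm g 10)))) (*-monoʳ-≤ (10 * g) lA'≤n))
        (<-≤-trans (*-monoˡ-< n ⦃ >-nonZero (≤-trans (s≤s z≤n) large₁) ⦄ large₁)
          (expanding A' _ A _ (sel-rej f' all) (sel-rej (adj G v) all) lA' (≤-trans (≤-trans (m≤m+n a (2 * z)) (m≤m+n _ 3)) lA))))
      go : (∃ λ s → s ∈ A' × 10 < cnt (adj G s) A) → ∃ λ s → v ~ s × s ∉ F × 10 < cnt (adj G s) A
      go (s , i , hs) = s , proj₁ (T-∧⁻ {adj G v s} t) , (λ m → T-not⁻ (proj₂ (T-∧⁻ {adj G v s} t)) (inᵇ⁺ F m)) , hs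
        where
        t = proj₂ (∈-sel⁻ f' all i)

    neighbour : ∀ v F → length F ≤ 5 → ∃ λ u → v ~ u × u ∉ F
    neighbour v F lF = let s , a , b , _ = triangle v F lF in s , a , b

    apex : ∀ {v s} F → length F ≤ 10 → 10 < cnt (adj G s) (sel (adj G v) all) → ∃ λ u → v ~ u × s ~ u × u ∉ F
    apex {v} {s} F lF h = let u , i , t , ne = pick (adj G s) F (Unique-sel (adj G v) uall) (≤-trans (s≤s lF) h) in
      u , proj₂ (∈-sel⁻ (adj G v) all i) , t , ne

    ~⇒≢ : ∀ {u v} → u ~ v → u ≢ v
    ~⇒≢ a refl = ~irrefl a

    split-off : ∀ {F} → Unique F → ∃ λ V₀ → all ↭ F ++ V₀
    split-off uF = ⊆⇒↭ uF (λ _ → ∈-allFin _)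

    module Gadget (r b₀ b₁ b₂ a' s t : V) (rb₀ : r ~ b₀) (rb₁ : r ~ b₁) (rb₂ : r ~ b₂) (b₁b₀ : b₁ ~ b₀) (b₁b₂ : b₁ ~ b₂) (b₀a' : b₀ ~ a')
      (a's : a' ~ s) (a't : a' ~ t) (st : s ~ t) (u : Unique (t ∷ s ∷ a' ∷ b₂ ∷ b₀ ∷ b₁ ∷ r ∷ [])) where

      evenCase : 2 ∣ n → HasSpanningHalin G
      evenCase ev = go (split-off uF)
        where
        F : List V
        F = b₀ ∷ a' ∷ r ∷ b₁ ∷ s ∷ t ∷ []
        uF : Unique F
        uF = Unique-++ʳ (b₂ ∷ []) (Unique-↭ (psolve 7 (λ t s a b₂ b₀ b₁ r → t ⊕ (s ⊕ (a ⊕ (b₂ ⊕ (b₀ ⊕ (b₁ ⊕ r))))) ⊜ b₂ ⊕ (b₀ ⊕ (a ⊕ (r ⊕ (b₁ ⊕ (s ⊕ t)))))) ↭-refl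
          [ t ] [ s ] [ a' ] [ b₂ ] [ b₀ ] [ b₁ ] [ r ]) u)
        go : (∃ λ V₀ → all ↭ F ++ V₀) → HasSpanningHalin G
        go (V₀ , part) = done (Remaining.ladder (b₀ ∷ a' ∷ []) (m≤m+n 2 1) r b₁ s t V₀ part rb₁ st
            (∣m+n∣m⇒∣n {2} {2} (subst (2 ∣_) (trans (sym |all|) (↭-length part)) ev) ∣-refl))
          where
          done : (Σ (Chain (r , b₁) [] (s , t)) λ c → r ∷ b₁ ∷ s ∷ t ∷ V₀ ↭ cverts c) → HasSpanningHalin G
          done (c , p) = halinFromChain c (≤-trans (m≤m+n 4 (length V₀)) (≤-reflexive (↭-length p)))
            one (~sym b₁b₀) (λ { (here refl) → rb₀ }) one (λ { (here refl) → ~sym a's , ~sym a't }) (here refl) (~sym b₀a')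
            (↭tr part (prep b₀ (↭tr (prep a' p) (++-comm [ a' ] (cverts c)))))

      oddCase : 2 ∣ suc n → HasSpanningHalin G
      oddCase ev = go (split-off uF)
        where
        F : List V
        F = b₀ ∷ b₁ ∷ a' ∷ r ∷ b₂ ∷ s ∷ t ∷ []
        uF : Unique F
        uF = Unique-↭ (psolve 7 (λ t s a b₂ b₀ b₁ r → t ⊕ (s ⊕ (a ⊕ (b₂ ⊕ (b₀ ⊕ (b₁ ⊕ r))))) ⊜ b₀ ⊕ (b₁ ⊕ (a ⊕ (r ⊕ (b₂ ⊕ (s ⊕ t)))))) ↭-refl
          [ t ] [ s ] [ a' ] [ b₂ ] [ b₀ ] [ b₁ ] [ r ]) u
        go : (∃ λ V₀ → all ↭ F ++ V₀) → HasSpanningHalin G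
        go (V₀ , part) = done (Remaining.ladder (b₀ ∷ b₁ ∷ a' ∷ []) ≤-refl r b₂ s t V₀ part rb₂ st
            (∣m+n∣m⇒∣n {2} {4} (subst (λ k → 2 ∣ suc k) (trans (sym |all|) (↭-length part)) ev) (divides 2 refl)))
          where
          done : (Σ (Chain (r , b₂) [] (s , t)) λ c → r ∷ b₂ ∷ s ∷ t ∷ V₀ ↭ cverts c) → HasSpanningHalin G
          done (c , p) = halinFromChain c (≤-trans (m≤m+n 4 (length V₀)) (≤-reflexive (↭-length p)))
            (more (~sym b₁b₀) one) b₁b₂ (λ { (here refl) → rb₀ ; (there (here refl)) → rb₁ }) one (λ { (here refl) → ~sym a's , ~sym a't }) (here refl) (~sym b₀a')
            (↭tr part (prep b₀ (prep b₁ (↭tr (prep a' p) (++-comm [ a' ] (cverts c))))))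

    caseTwo : (2 ∣ n ⊎ 2 ∣ suc n) → HasSpanningHalin G
    caseTwo parity = go₁ (pickAny {xs = all} [] uall (≤-trans (≤-trans (s≤s z≤n) large₁) (≤-reflexive (sym |all|))))
      where
      go₄ : ∀ {r b₀ b₁ b₂ a'} → r ~ b₀ → r ~ b₁ → r ~ b₂ → b₁ ~ b₀ → b₁ ~ b₂ → b₀ ~ a' → Unique (a' ∷ b₂ ∷ b₀ ∷ b₁ ∷ r ∷ []) →
        (∃ λ s → a' ~ s × s ∉ (a' ∷ b₂ ∷ b₀ ∷ b₁ ∷ r ∷ []) × 10 < cnt (adj G s) (sel (adj G a') all)) → HasSpanningHalin G
      go₄ {r} {b₀} {b₁} {b₂} {a'} p₀ p₁ p₂ q₀ q₂ q u (s , as , ns , hs) = go₅ (apex (s ∷ a' ∷ b₂ ∷ b₀ ∷ b₁ ∷ r ∷ []) (m≤m+n 6 4) hs)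
        where
        go₅ : (∃ λ t → a' ~ t × s ~ t × t ∉ (s ∷ a' ∷ b₂ ∷ b₀ ∷ b₁ ∷ r ∷ [])) → HasSpanningHalin G
        go₅ (t , at , st , nt) = go₆ parity
          where
          module Gd = Gadget r b₀ b₁ b₂ a' s t p₀ p₁ p₂ q₀ q₂ q as at st (∉⇒All≢ nt ∷ (∉⇒All≢ ns ∷ u))
          go₆ : (2 ∣ n ⊎ 2 ∣ suc n) → HasSpanningHalin G
          go₆ (inj₁ ev) = Gd.evenCase ev
          go₆ (inj₂ od) = Gd.oddCase od
      go₃ : ∀ {r b₀ b₁ b₂} → r ~ b₀ → r ~ b₁ → r ~ b₂ → b₁ ~ b₀ → b₁ ~ b₂ → Unique (b₂ ∷ b₀ ∷ b₁ ∷ r ∷ []) → HasSpanningHalin G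
      go₃ {r} {b₀} {b₁} {b₂} p₀ p₁ p₂ q₀ q₂ u =
        let a' , q , na = neighbour b₀ (b₂ ∷ b₀ ∷ b₁ ∷ r ∷ []) (m≤m+n 4 1) in
        go₄ p₀ p₁ p₂ q₀ q₂ q (∉⇒All≢ na ∷ u) (triangle a' (a' ∷ b₂ ∷ b₀ ∷ b₁ ∷ r ∷ []) ≤-refl)
      go₂ : ∀ {r} → (∃ λ b₁ → r ~ b₁ × b₁ ∉ [] × 10 < cnt (adj G b₁) (sel (adj G r) all)) → HasSpanningHalin G
      go₂ {r} (b₁ , p₁ , _ , h₁) =
        let b₀ , p₀ , q₀ , n₀ = apex (b₁ ∷ r ∷ []) (m≤m+n 2 8) h₁
            b₂ , p₂ , q₂ , n₂ = apex (b₀ ∷ b₁ ∷ r ∷ []) (m≤m+n 3 7) h₁ in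
        go₃ p₀ p₁ p₂ q₀ q₂ (∉⇒All≢ n₂ ∷ (∉⇒All≢ n₀ ∷ (((λ eq → ~⇒≢ p₁ (sym eq)) ∷ []) ∷ ([] ∷ []))))
      go₁ : (∃ λ r → r ∈ all × r ∉ []) → HasSpanningHalin G
      go₁ (r , _) = go₂ (triangle r [] z≤n)

  -- Two almost complete halves

  cnt-≤₁ : ∀ {A : Set} {f g : A → Bool} xs → (∀ x → b2n (f x) ≤ b2n (g x)) → cnt f xs ≤ cnt g xs
  cnt-≤₁ xs h = ∑-mono xs (λ {x} _ → h x)

  cnt-≤₂ : ∀ {A : Set} {f g h : A → Bool} xs → (∀ x → b2n (f x) ≤ b2n (g x) + b2n (h x)) → cnt f xs ≤ cnt g xs + cnt h xs
  cnt-≤₂ xs h = ≤-trans (∑-mono xs (λ {x} _ → h x)) (≤-reflexive (∑-+ _ _ xs))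

  cnt-≤₃ : ∀ {A : Set} {f g h k : A → Bool} xs → (∀ x → b2n (f x) ≤ b2n (g x) + b2n (h x) + b2n (k x)) → cnt f xs ≤ cnt g xs + cnt h xs + cnt k xs
  cnt-≤₃ {g = g} {h} {k} xs p = ≤-trans (∑-mono xs (λ {x} _ → p x)) (≤-reflexive (trans (∑-+ _ _ xs) (cong (_+ cnt k xs) (∑-+ _ _ xs))))

  length-≤₃ : ∀ {A : Set} {g h k : A → Bool} xs → (∀ x → 1 ≤ b2n (g x) + b2n (h x) + b2n (k x)) → length xs ≤ cnt g xs + cnt h xs + cnt k xs
  length-≤₃ {g = g} {h} {k} xs p = ≤-trans (≤-reflexive (length≡∑ xs)) (≤-trans (∑-mono xs (λ {x} _ → p x))
    (≤-reflexive (trans (∑-+ _ _ xs) (cong (_+ cnt k xs) (∑-+ _ _ xs)))))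

  cnt-part : ∀ {A : Set} (f : A → Bool) {xs} ys zs → xs ↭ ys ++ zs → cnt f ys ≤ cnt f xs
  cnt-part f ys zs p = ≤-trans (m≤m+n _ _) (≤-reflexive (sym (trans (∑-↭ _ p) (∑-++ _ ys _))))

  module NearClique {n : ℕ} (G : Graph n) (h g : ℕ) (180≤h : 180 ≤ h) (500≤g : 500 ≤ g) (core : Fin n → Bool) (z y : ℕ) (W : List (Fin n)) (uW : Unique W)
    (few : cnt (not ∘ core) W ≤ 7 * z)
    (miss : ∀ {v} → T (core v) → cnt (λ u → core u ∧ not (adj G v u)) W ≤ 5 * z)
    (degW : ∀ {v} → v ∈ W → 14 * y ≤ cnt (adj G v) W)
    (|W|≤ : length W ≤ 180 * y) (1000z≤y : 1000 * z ≤ y) (2≤y : 2 ≤ y)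
    (large : ladderThreshold h g + 6 ≤ length W) (wide : 100 * h * (28 * z) + 6 ≤ length W) where
    open Tiles G

    module _ (X : List V) (|X|≤2 : length X ≤ 2) (e₁ e₂ f₁ f₂ : V) (V₀ : List V) (part : W ↭ X ++ (e₁ ∷ e₂ ∷ f₁ ∷ f₂ ∷ V₀)) where

      Vs : List V
      Vs = e₁ ∷ e₂ ∷ f₁ ∷ f₂ ∷ V₀
      L₀ : ℕ
      L₀ = length V₀

      size : length W ≡ length X + (4 + L₀)
      size = trans (↭-length part) (length-++ X)

      |W|≤L₀+6 : length W ≤ L₀ + 6
      |W|≤L₀+6 = ≤-trans (≤-reflexive size) (≤-trans (+-monoˡ-≤ (4 + L₀) |X|≤2) (≤-reflexive (+-comm 6 L₀)))

      W↭Vs++X : W ↭ Vs ++ X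
      W↭Vs++X = ↭tr part (++-comm X Vs)

      W↭V₀ : W ↭ V₀ ++ (X ++ e₁ ∷ e₂ ∷ f₁ ∷ f₂ ∷ [])
      W↭V₀ = ↭tr part (psolve 3 (λ x f v → x ⊕ (f ⊕ v) ⊜ v ⊕ (x ⊕ f)) ↭-refl X (e₁ ∷ e₂ ∷ f₁ ∷ f₂ ∷ []) V₀)

      13z≤y : 13 * z ≤ y
      13z≤y = ≤-trans (*-monoˡ-≤ z {13} {1000} (≤ᵇ⇒≤ 13 1000 tt)) 1000z≤y

      H1 : ∀ {v} → v ∈ Vs → 10 * y + 2 * y ≤ cnt (adj G v) Vs
      H1 {v} i = linear {a = 14 * y + cnt (adj G v) X + 2} {b = cnt (adj G v) Vs + cnt (adj G v) X + 2 + y} y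
        (+-mono-≤ (+-mono-≤ (≤-trans (degW (∈-resp-↭ (↭-sym part) (∈-++⁺ʳ X i))) (≤-reflexive (trans (∑-↭ _ W↭Vs++X) (∑-++ _ Vs X))))
          (≤-trans (cnt≤length (adj G v) X) |X|≤2)) 2≤y) (lem y (cnt (adj G v) Vs) (cnt (adj G v) X))
        where
        lem : ∀ y d x → 10 * y + 2 * y + (d + x + 2 + y) + y ≡ d + (14 * y + x + 2)
        lem = solve-∀

      cover : ∀ {v} B C → T (core v) → W ↭ B ++ C → length B ≤ cnt (adj G v) B + 12 * z
      cover {v} B C cv p = ≤-trans (length-≤₃ {g = adj G v} {λ u → core u ∧ not (adj G v u)} {not ∘ core} B (λ u → point (adj G v u) (core u)))
        (≤-trans (+-mono-≤ (+-monoʳ-≤ (cnt (adj G v) B) (≤-trans (cnt-part _ B C p) (miss cv))) (≤-trans (cnt-part _ B C p) few))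
          (≤-reflexive (lem (cnt (adj G v) B) z)))
        where
        point : ∀ a c → 1 ≤ b2n a + b2n (c ∧ not a) + b2n (not c)
        point true c = s≤s z≤n
        point false true = s≤s z≤n
        point false false = s≤s z≤n
        lem : ∀ d z → d + 5 * z + 7 * z ≡ d + 12 * z
        lem = solve-∀

      coreCount : ∀ A C → W ↭ A ++ C → length A ≤ cnt core A + 7 * z
      coreCount A C p = ≤-trans (≤-trans (length-≤₃ {g = core} {not ∘ core} {λ _ → false} A (λ u → point (core u))) (≤-reflexive (trans (cong (cnt core A + cnt (not ∘ core) A +_) (∑-const 0 A)) (+-identityʳ _))))
        (+-monoʳ-≤ (cnt core A) (≤-trans (cnt-part _ A C p) few))
        where
        point : ∀ c → 1 ≤ b2n c + b2n (not c) + 0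
        point true = s≤s z≤n
        point false = s≤s z≤n

      coreSum : ∀ A B k l → (∀ {v} → T (core v) → k ≤ cnt (adj G v) B + l) → k * cnt core A ≤ e A B + l * cnt core A
      coreSum [] B k l h = ≤-trans (≤-reflexive (*-zeroʳ k)) z≤n
      coreSum (v ∷ A) B k l h with coreSum A B k l h | core v in eq
      ... | ih | true = linear {a = k + k * cnt core A} {b = (cnt (adj G v) B + l) + (e A B + l * cnt core A)} 0 (+-mono-≤ (h (subst T (sym eq) tt)) ih)
        (lem k (cnt core A) (cnt (adj G v) B) l (e A B))
        where
        lem : ∀ k x d l e → k * (1 + x) + (d + l + (e + l * x)) + 0 ≡ d + e + l * (1 + x) + (k + k * x)
        lem = solve-∀
      ... | ih | false = ≤-trans ih (+-monoˡ-≤ (l * cnt core A) (m≤n+m (e A B) (cnt (adj G v) B)))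

      H2 : ∀ A A' B B' → Vs ↭ A ++ A' → Vs ↭ B ++ B' → 10 * y ≤ length A → 10 * y ≤ length B → (4 + L₀) * (4 + L₀) ≤ g * e A B
      H2 A A' B B' p q lA lB = ≤-trans (≤-trans (*-mono-≤ s s) (≤-trans (linear {b = 9 * y * (9 * y)} (8100 * (y * y)) ≤-refl (lem₁ y)) (*-monoʳ-≤ 500 81y²))) (*-monoˡ-≤ (e A B) 500≤g)
        where
        s : 4 + L₀ ≤ 180 * y
        s = ≤-trans (≤-trans (m≤n+m _ (length X)) (≤-reflexive (sym size))) |W|≤
        lem₁ : ∀ y → 180 * y * (180 * y) + 9 * y * (9 * y) + 8100 * (y * y) ≡ 500 * (9 * y * (9 * y)) + 9 * y * (9 * y)
        lem₁ = solve-∀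
        ext : ∀ {A A'} → Vs ↭ A ++ A' → W ↭ A ++ (A' ++ X)
        ext {A} {A'} p = ↭tr W↭Vs++X (↭tr (++⁺ʳ X p) (↭-reflexive (++-assoc A A' X)))
        9y : ∀ {x k w} → 10 * y ≤ x → k ≤ 13 → x ≤ w + k * z → 9 * y ≤ w
        9y {x} {k} {w} h hk h' = linear {a = 10 * y + x + 13 * z} {b = x + (w + 13 * z) + y} 0
          (+-mono-≤ (+-mono-≤ h (≤-trans h' (+-monoʳ-≤ w (*-monoˡ-≤ z hk)))) 13z≤y) (lem y x w z)
          where
          lem : ∀ y x w z → 9 * y + (x + (w + 13 * z) + y) + 0 ≡ w + (10 * y + x + 13 * z)
          lem = solve-∀
        81y² : 9 * y * (9 * y) ≤ e A B
        81y² = ≤-trans (*-monoʳ-≤ (9 * y) (9y lA (m≤m+n 7 6) (coreCount A (A' ++ X) (ext {A} {A'} p))))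
          (≤-trans (coreSum A B (9 * y) 0 (λ cv → ≤-trans (9y lB (m≤m+n 12 1) (cover B (B' ++ X) cv (ext {B} {B'} q))) (m≤m+n _ 0))) (≤-reflexive (+-identityʳ _)))

      H3 : ∀ U U' → V₀ ↭ U ++ U' → L₀ ≤ 100 * h * length U → 8 * (100 * h) * (length U * L₀) ≤ 16 * (100 * h) * e U V₀ + length U * L₀
      H3 U U' p hU = ≤-trans (≤-trans (*-monoʳ-≤ (8 * (100 * h)) uL≤2e) (≤-reflexive (double h (e U V₀)))) (m≤m+n _ _)
        where
        double : ∀ h e → 8 * (100 * h) * (2 * e) ≡ 16 * (100 * h) * e
        double = solve-∀
        u x : ℕ
        u = length U
        x = cnt core U
        extU : W ↭ U ++ (U' ++ (X ++ e₁ ∷ e₂ ∷ f₁ ∷ f₂ ∷ []))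
        extU = ↭tr W↭V₀ (↭tr (++⁺ʳ _ p) (↭-reflexive (++-assoc U U' _)))
        2≤100h : 2 ≤ 100 * h
        2≤100h = ≤-trans (≤-trans (m≤m+n 2 178) 180≤h) (m≤n*m h 100)
        wide₀ : 100 * h * (28 * z) ≤ L₀
        wide₀ = +-cancelʳ-≤ 6 _ _ (≤-trans wide |W|≤L₀+6)
        28z≤u : 28 * z ≤ u
        28z≤u = *-cancelˡ-≤ (100 * h) ⦃ >-nonZero (≤-trans (s≤s z≤n) 2≤100h) ⦄ (≤-trans wide₀ hU)
        48z≤L : 48 * z ≤ L₀
        48z≤L = ≤-trans (≤-trans (linear {b = 56 * z} (8 * z) ≤-refl (lem z)) (*-monoˡ-≤ (28 * z) {2} {100 * h} 2≤100h)) wide₀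
          where
          lem : ∀ z → 48 * z + 56 * z + 8 * z ≡ 2 * (28 * z) + 56 * z
          lem = solve-∀
        main : L₀ * x ≤ e U V₀ + 12 * z * x
        main = coreSum U V₀ L₀ (12 * z) (λ cv → cover V₀ (X ++ e₁ ∷ e₂ ∷ f₁ ∷ f₂ ∷ []) cv W↭V₀)
        x≤u : x ≤ u
        x≤u = cnt≤length core U
        uL≤2e : u * L₀ ≤ 2 * e U V₀
        uL≤2e = *-cancelˡ-≤ 2 (linear
          {a = 2 * (L₀ * u) + 2 * (L₀ * u) + 2 * (L₀ * x) + 2 * (L₀ * x) + L₀ * (28 * z) + u * (48 * z) + 48 * z * x}
          {b = 2 * (L₀ * (x + 7 * z)) + 2 * (L₀ * (x + 7 * z)) + 2 * (e U V₀ + 12 * z * x) + 2 * (e U V₀ + 12 * z * x) + L₀ * u + u * L₀ + 48 * z * u} 0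
          (+-mono-≤ (+-mono-≤ (+-mono-≤ (+-mono-≤ (+-mono-≤ (+-mono-≤ hu hu) (*-monoʳ-≤ 2 main)) (*-monoʳ-≤ 2 main)) (*-monoʳ-≤ L₀ 28z≤u)) (*-monoʳ-≤ u 48z≤L)) (*-monoʳ-≤ (48 * z) x≤u))
          (lem u L₀ x z (e U V₀)))
          where
          hu : 2 * (L₀ * u) ≤ 2 * (L₀ * (x + 7 * z))
          hu = *-monoʳ-≤ 2 (*-monoʳ-≤ L₀ (coreCount U (U' ++ (X ++ e₁ ∷ e₂ ∷ f₁ ∷ f₂ ∷ [])) extU))
          lem : ∀ u L x z e → 2 * (u * L) + (2 * (L * (x + 7 * z)) + 2 * (L * (x + 7 * z)) + 2 * (e + 12 * z * x) + 2 * (e + 12 * z * x) + L * u + u * L + 48 * z * u) + 0 ≡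
            2 * (2 * e) + (2 * (L * u) + 2 * (L * u) + 2 * (L * x) + 2 * (L * x) + L * (28 * z) + u * (48 * z) + 48 * z * x)
          lem = solve-∀

      halfLadder : e₁ ~ e₂ → f₁ ~ f₂ → 2 ∣ 4 + L₀ → Σ (Chain (e₁ , e₂) [] (f₁ , f₂)) λ c → Vs ↭ cverts c
      halfLadder ee ff even = Ladders.spanningLadder G e₁ e₂ f₁ f₂ V₀ h g (10 * y) y (Unique-++ʳ X (Unique-↭ part uW)) (≤-trans (s≤s z≤n) 180≤h) (≤-trans (s≤s z≤n) 500≤g) H1 H2 H3 ee ff even
        (+-cancelʳ-≤ 6 _ _ (≤-trans large |W|≤L₀+6)) (≤-trans (≤-trans (m≤n+m _ (length X)) (≤-reflexive (sym size))) (≤-trans |W|≤ (*-monoˡ-≤ y 180≤h)))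

  module Cliques {n : ℕ} (G : Graph n) (z : ℕ) where
    open Tiles G

    all : List V
    all = L.allFin n

    uall : Unique all
    uall = allFin⁺ n

    |all| : length all ≡ n
    |all| = length-tabulate id

    -- P and Q are almost cliques on about half of the vertices each.
    record Cores (P Q : V → Bool) : Set where
      field
        disjoint : ∀ {v} → T (P v) → T (Q v) → ⊥
        rest : cnt (λ v → not (P v) ∧ not (Q v)) all ≤ 7 * z
        missP : ∀ {v} → T (P v) → cnt (λ u → P u ∧ not (adj G v u)) all ≤ 5 * z
        missQ : ∀ {v} → T (Q v) → cnt (λ u → Q u ∧ not (adj G v u)) all ≤ 5 * z
        halfP : n ≤ 2 * cnt P all + 7 * z
        halfQ : n ≤ 2 * cnt Q all + 7 * z

    swapCores : ∀ {P Q} → Cores P Q → Cores Q P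
    swapCores {P} {Q} c = record { disjoint = λ q p → c.disjoint p q
      ; rest = ≤-trans (cnt-≤₁ all (λ v → ≤-reflexive (cong b2n (∧-comm (not (Q v)) (not (P v)))))) c.rest
      ; missP = c.missQ ; missQ = c.missP ; halfP = c.halfQ ; halfQ = c.halfP }
      where module c = Cores c

    module Core {P Q : V → Bool} (c : Cores P Q) (big : 100 * z + 100 ≤ n) where
      open Cores c

      P-large : 15 * z + 20 ≤ cnt P all
      P-large = *-cancelˡ-≤ 2 (linear {a = 100 * z + 100 + n} {b = n + (2 * cnt P all + 7 * z)} (63 * z + 60) (+-mono-≤ big halfP) (lem z n (cnt P all)))
        where
        lem : ∀ z n p → 2 * (15 * z + 20) + (n + (2 * p + 7 * z)) + (63 * z + 60) ≡ 2 * p + (100 * z + 100 + n)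
        lem = solve-∀

      point : ∀ p a b → b2n (p ∧ a) ≤ b2n (p ∧ a ∧ b) + b2n (p ∧ not b)
      point false a b = z≤n
      point true false b = z≤n
      point true true true = s≤s z≤n
      point true true false = s≤s z≤n

      common : ∀ F (f : V → Bool) k → length F ≤ 10 → cnt P all ≤ cnt (λ u → P u ∧ f u) all + k → k ≤ 15 * z →
        ∃ λ u → T (P u) × T (f u) × u ∉ F
      common F f k lF h hk = let u , _ , t , ne = pick (λ u → P u ∧ f u) {all} F uall enough in u , proj₁ (T-∧⁻ {P u} t) , proj₂ (T-∧⁻ {P u} t) , ne
        where
        enough : length F < cnt (λ u → P u ∧ f u) all
        enough = linear {a = length F + (15 * z + 20) + (cnt P all) + k} {b = 10 + cnt P all + (cnt (λ u → P u ∧ f u) all + k) + 15 * z} 9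
          (+-mono-≤ (+-mono-≤ (+-mono-≤ lF P-large) h) hk) (lem (length F) z (cnt P all) (cnt (λ u → P u ∧ f u) all) k)
          where
          lem : ∀ f z p x k → suc f + (10 + p + (x + k) + 15 * z) + 9 ≡ x + (f + (15 * z + 20) + p + k)
          lem = solve-∀

      shrinkBy : ∀ {v} → T (P v) → ∀ (f : V → Bool) k → cnt P all ≤ cnt (λ u → P u ∧ f u) all + k →
        cnt P all ≤ cnt (λ u → P u ∧ (f u ∧ adj G v u)) all + (5 * z + k)
      shrinkBy {v} pv f k h = ≤-trans h (≤-trans (+-monoˡ-≤ k (≤-trans (cnt-≤₂ all (λ u → point (P u) (f u) (adj G v u))) (+-monoʳ-≤ _ (missP pv))))
        (≤-reflexive (+-assoc (cnt (λ u → P u ∧ (f u ∧ adj G v u)) all) (5 * z) k)))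

      record Clique₄ (v : V) (F : List V) : Set where
        field
          x y w : V
          Px : T (P x)
          Py : T (P y)
          Pw : T (P w)
          vx : v ~ x
          vy : v ~ y
          vw : v ~ w
          xy : x ~ y
          xw : x ~ w
          yw : y ~ w
          fresh : Unique F → Unique (w ∷ y ∷ x ∷ F)

      clique₄ : ∀ v F → T (P v) → length F ≤ 8 → Clique₄ v F
      clique₄ v F pv lF = go₁ (common F (λ u → true ∧ adj G v u) (5 * z + 0) (≤-trans lF (m≤m+n 8 2)) h₁ (≤-trans (≤-reflexive (+-identityʳ _)) (*-monoˡ-≤ z (m≤m+n 5 10))))
        where
        h₀ : cnt P all ≤ cnt (λ u → P u ∧ true) all + 0
        h₀ = ≤-trans (cnt-≤₁ all (λ u → ≤-reflexive (cong b2n (sym (∧-identityʳ (P u)))))) (m≤m+n _ 0)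
        h₁ = shrinkBy pv (λ _ → true) 0 h₀
        bound : 5 * z + (5 * z + 0) ≤ 15 * z
        bound = ≤-trans (m≤m+n _ (5 * z)) (≤-reflexive (lem z))
          where
          lem : ∀ z → 5 * z + (5 * z + 0) + 5 * z ≡ 15 * z
          lem = solve-∀
        bound₃ : 5 * z + (5 * z + (5 * z + 0)) ≤ 15 * z
        bound₃ = ≤-reflexive (lem z)
          where
          lem : ∀ z → 5 * z + (5 * z + (5 * z + 0)) ≡ 15 * z
          lem = solve-∀
        go₁ : (∃ λ x → T (P x) × T (true ∧ adj G v x) × x ∉ F) → Clique₄ v F
        go₁ (x , px , vx , nx) = go₂ (common (x ∷ F) _ _ (≤-trans (s≤s lF) (m≤m+n 9 1)) h₂ bound)
          where
          h₂ = shrinkBy px (λ u → true ∧ adj G v u) (5 * z + 0) h₁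
          go₂ : (∃ λ y → T (P y) × T ((true ∧ adj G v y) ∧ adj G x y) × y ∉ x ∷ F) → Clique₄ v F
          go₂ (y , py , ty , ny) = go₃ (common (y ∷ x ∷ F) _ _ (s≤s (s≤s lF)) h₃ bound₃)
            where
            h₃ = shrinkBy py (λ u → (true ∧ adj G v u) ∧ adj G x u) (5 * z + (5 * z + 0)) h₂
            go₃ : (∃ λ w → T (P w) × T (((true ∧ adj G v w) ∧ adj G x w) ∧ adj G y w) × w ∉ y ∷ x ∷ F) → Clique₄ v F
            go₃ (w , pw , tw , nw) = record { x = x ; y = y ; w = w ; Px = px ; Py = py ; Pw = pw ; vx = vx
              ; vy = proj₁ (T-∧⁻ {adj G v y} ty) ; xy = proj₂ (T-∧⁻ {adj G v y} ty)
              ; vw = proj₁ (T-∧⁻ {adj G v w} (proj₁ (T-∧⁻ {adj G v w ∧ adj G x w} tw)))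
              ; xw = proj₂ (T-∧⁻ {adj G v w} (proj₁ (T-∧⁻ {adj G v w ∧ adj G x w} tw)))
              ; yw = proj₂ (T-∧⁻ {adj G v w ∧ adj G x w} tw)
              ; fresh = λ u → ∉⇒All≢ nw ∷ (∉⇒All≢ ny ∷ (∉⇒All≢ nx ∷ u)) }

    -- The vertices outside both cores join the core in which they have more neighbours.
    module Half (h g : ℕ) (180≤h : 180 ≤ h) (500≤g : 500 ≤ g) (y : ℕ) {P Q : V → Bool} (c : Cores P Q) (degree : ∀ v → n + 1 ≤ 2 * cnt (adj G v) all)
      (side : V → Bool) (P⇒side : ∀ {v} → T (P v) → T (side v)) (Q⇒¬side : ∀ {v} → T (Q v) → ¬ T (side v))
      (side⇒ : ∀ {v} → T (side v) → ¬ T (P v) → cnt (λ u → Q u ∧ adj G v u) all ≤ cnt (λ u → P u ∧ adj G v u) all)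
      (100y≤n : 100 * y ≤ n) (n≤180y : n ≤ 180 * y) (1000z≤y : 1000 * z ≤ y) (2≤y : 2 ≤ y)
      (large : 4 * (ladderThreshold h g + 6) ≤ n) (wide : 4 * (100 * h * (28 * z) + 6) ≤ n) where
      open Cores c

      W : List V
      W = sel side all

      uW : Unique W
      uW = Unique-sel side uall

      14z≤n : 14 * z ≤ n
      14z≤n = ≤-trans (≤-trans (*-monoˡ-≤ z {14} {1000} (≤ᵇ⇒≤ 14 1000 tt)) 1000z≤y) (≤-trans (m≤n*m y 100) 100y≤n)

      fewW : cnt (not ∘ P) W ≤ 7 * z
      fewW = ≤-trans (≤-reflexive (cnt-sel (not ∘ P) side all)) (≤-trans (cnt-mono all (λ {v} _ t → T-∧⁺ (proj₁ (T-∧⁻ {not (P v)} t))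
        (T-not⁺ (λ q → Q⇒¬side q (proj₂ (T-∧⁻ {not (P v)} t)))))) rest)

      missW : ∀ {v} → T (P v) → cnt (λ u → P u ∧ not (adj G v u)) W ≤ 5 * z
      missW pv = ≤-trans (cnt-part _ W (rej side all) (sel-rej side all)) (missP pv)

      neighboursInCore : ∀ {v} → T (side v) → n ≤ 4 * cnt (λ u → P u ∧ adj G v u) all + 34 * z
      neighboursInCore {v} sv with T? (P v)
      ... | yes pv = linear {a = n + n + (2 * cnt P all + 2 * cnt P all) + 14 * z} {b = (2 * cnt P all + 7 * z) + (2 * cnt P all + 7 * z) + (2 * (x + 5 * z) + 2 * (x + 5 * z)) + n} (14 * z)
          (+-mono-≤ (+-mono-≤ (+-mono-≤ halfP halfP) (+-mono-≤ (*-monoʳ-≤ 2 cp) (*-monoʳ-≤ 2 cp))) 14z≤n) (lem n (cnt P all) x z)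
        where
        x : ℕ
        x = cnt (λ u → P u ∧ adj G v u) all
        pt : ∀ p a → b2n p ≤ b2n (p ∧ a) + b2n (p ∧ not a)
        pt false a = z≤n
        pt true true = s≤s z≤n
        pt true false = s≤s z≤n
        cp : cnt P all ≤ x + 5 * z
        cp = ≤-trans (cnt-≤₂ all (λ u → pt (P u) (adj G v u))) (+-monoʳ-≤ x (missP pv))
        lem : ∀ n p x z → n + ((2 * p + 7 * z) + (2 * p + 7 * z) + (2 * (x + 5 * z) + 2 * (x + 5 * z)) + n) + 14 * z ≡ 4 * x + 34 * z + (n + n + (2 * p + 2 * p) + 14 * z)
        lem = solve-∀
      ... | no ¬pv = linear {a = n + 1 + 2 * cnt (adj G v) all + 2 * q} {b = 2 * cnt (adj G v) all + 2 * (x + q + 7 * z) + 2 * x} (1 + 20 * z)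
          (+-mono-≤ (+-mono-≤ (degree v) (*-monoʳ-≤ 2 split)) (*-monoʳ-≤ 2 (side⇒ sv ¬pv))) (lem n (cnt (adj G v) all) x q z)
        where
        x q : ℕ
        x = cnt (λ u → P u ∧ adj G v u) all
        q = cnt (λ u → Q u ∧ adj G v u) all
        pt : ∀ p q a → b2n a ≤ b2n (p ∧ a) + b2n (q ∧ a) + b2n (not p ∧ not q)
        pt p q false = z≤n
        pt true q true = s≤s z≤n
        pt false true true = s≤s z≤n
        pt false false true = s≤s z≤n
        split : cnt (adj G v) all ≤ x + q + 7 * z
        split = ≤-trans (cnt-≤₃ all (λ u → pt (P u) (Q u) (adj G v u))) (+-monoʳ-≤ (x + q) rest)
        lem : ∀ n d x q z → n + (2 * d + 2 * (x + q + 7 * z) + 2 * x) + (1 + 20 * z) ≡ 4 * x + 34 * z + (n + 1 + 2 * d + 2 * q)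
        lem = solve-∀

      degW : ∀ {v} → v ∈ W → 14 * y ≤ cnt (adj G v) W
      degW {v} i = *-cancelˡ-≤ 4 (linear {a = 100 * y + n + 34 * z + 4 * x} {b = n + (4 * x + 34 * z) + y + 4 * cnt (adj G v) W} (43 * y)
        (+-mono-≤ (+-mono-≤ (+-mono-≤ 100y≤n (neighboursInCore (proj₂ (∈-sel⁻ side all i)))) (≤-trans (*-monoˡ-≤ z {34} {1000} (≤ᵇ⇒≤ 34 1000 tt)) 1000z≤y)) (*-monoʳ-≤ 4 x≤))
        (lem y n x z (cnt (adj G v) W)))
        where
        x : ℕ
        x = cnt (λ u → P u ∧ adj G v u) all
        x≤ : x ≤ cnt (adj G v) W
        x≤ = ≤-trans (cnt-mono all (λ {u} _ t → T-∧⁺ (proj₂ (T-∧⁻ {P u} t)) (P⇒side (proj₁ (T-∧⁻ {P u} t))))) (≤-reflexive (sym (cnt-sel (adj G v) side all)))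
        lem : ∀ y n x z d → 4 * (14 * y) + (n + (4 * x + 34 * z) + y + 4 * d) + 43 * y ≡ 4 * d + (100 * y + n + 34 * z + 4 * x)
        lem = solve-∀

      |W|≤n : length W ≤ n
      |W|≤n = ≤-trans (≤-reflexive (length-sel side all)) (≤-trans (cnt≤length side all) (≤-reflexive |all|))

      n≤4W : n ≤ 4 * length W
      n≤4W = linear {a = n + n + 14 * z + 4 * cnt P all} {b = (2 * cnt P all + 7 * z) + (2 * cnt P all + 7 * z) + n + 4 * length W} 0
        (+-mono-≤ (+-mono-≤ (+-mono-≤ halfP halfP) 14z≤n) (*-monoʳ-≤ 4 (≤-trans (cnt-mono all (λ _ → P⇒side)) (≤-reflexive (sym (length-sel side all))))))
        (lem n (cnt P all) z (length W))
        where
        lem : ∀ n p z w → n + ((2 * p + 7 * z) + (2 * p + 7 * z) + n + 4 * w) + 0 ≡ 4 * w + (n + n + 14 * z + 4 * p)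
        lem = solve-∀

      open NearClique G h g 180≤h 500≤g P z y W uW fewW missW degW (≤-trans |W|≤n n≤180y) 1000z≤y 2≤y
        (*-cancelˡ-≤ 4 (≤-trans large n≤4W)) (*-cancelˡ-≤ 4 (≤-trans wide n≤4W)) public using (halfLadder)

      core∈W : ∀ {v} → T (P v) → v ∈ W
      core∈W pv = ∈-sel⁺ side (∈-allFin _) (P⇒side pv)

  rej≡sel-not : ∀ {A : Set} (f : A → Bool) xs → rej f xs ≡ sel (not ∘ f) xs
  rej≡sel-not f [] = refl
  rej≡sel-not f (x ∷ xs) with f x
  ... | true = rej≡sel-not f xs
  ... | false = cong (x ∷_) (rej≡sel-not f xs)

  evenOrOdd : ∀ m → 2 ∣ m ⊎ 2 ∣ suc m
  evenOrOdd zero = inj₁ (divides 0 refl)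
  evenOrOdd (suc m) with evenOrOdd m
  ... | inj₁ d = inj₂ (∣m∣n⇒∣m+n {m = 2} ∣-refl d)
  ... | inj₂ d = inj₁ d

  module CaseOne {n : ℕ} (G : Graph n) (b h g y z : ℕ) (180≤h : 180 ≤ h) (500≤g : 500 ≤ g) (4≤b : 4 ≤ b)
    (degree : ∀ v → n + 1 ≤ 2 * cnt (adj G v) (L.allFin n))
    (noCut : ∀ (f : Fin n → Bool) → b * cnt f (L.allFin n) ≤ n → ¬ (∃ λ u → ∃ λ v → ¬ T (f u) × ¬ T (f v) × ¬ Walk G (λ x → ¬ T (f x)) u v))
    (smallCut : b * (17 * z + 4) ≤ n) (100z≤n : 100 * z + 100 ≤ n)
    (100y≤n : 100 * y ≤ n) (n≤180y : n ≤ 180 * y) (1000z≤y : 1000 * z ≤ y) (2≤y : 2 ≤ y)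
    (large : 4 * (ladderThreshold h g + 6) ≤ n) (wide : 4 * (100 * h * (28 * z) + 6) ≤ n)
    (P Q : Fin n → Bool) (cores : Cliques.Cores G z P Q) where
    open Tiles G
    open Cliques G z
    open FromRows G
    open Cores cores

    Z : V → Bool
    Z v = not (P v) ∧ not (Q v)

    Crossing : (V → Bool) → Set
    Crossing f = ∃ λ x → ∃ λ x' → T (P x) × T (Q x') × ¬ T (f x) × ¬ T (f x') × x ~ x'

    outside : ∀ (f R : V → Bool) → cnt f all < cnt R all → ∃ λ v → T (R v) × ¬ T (f v)
    outside f R lt with ∑-< (b2n ∘ R) (b2n ∘ f) all lt
    ... | v , _ , l = v , go (f v) (R v) l
      where
      go : ∀ a c → b2n a < b2n c → T c × ¬ T a
      go false true _ = tt , λ ()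
      go true true (s≤s ())
      go true false ()
      go false false ()

    fewer : ∀ (f R : V → Bool) → b * cnt f all ≤ n → n ≤ 2 * cnt R all + 7 * z → cnt f all < cnt R all
    fewer f R hf hR = *-cancelˡ-< 4 _ _ (linear {a = b4 + (n + n) + (100 * z + 100)} {b = n + ((2 * cnt R all + 7 * z) + (2 * cnt R all + 7 * z)) + n} (86 * z + 99)
      (+-mono-≤ (+-mono-≤ (≤-trans (*-monoˡ-≤ (cnt f all) 4≤b) hf) (+-mono-≤ hR hR)) 100z≤n) (lem (cnt f all) (cnt R all) z n))
      where
      b4 : ℕ
      b4 = 4 * cnt f all
      lem : ∀ x r z n → suc (4 * x) + (n + ((2 * r + 7 * z) + (2 * r + 7 * z)) + n) + (86 * z + 99) ≡ 4 * r + (4 * x + (n + n) + (100 * z + 100))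
      lem = solve-∀

    crossing : ∀ f → b * cnt f all ≤ n → (∀ {v} → T (Z v) → T (f v)) → Crossing f
    crossing f hf Z⇒f = go (findᵇ∈ exits all)
      where
      target : V → V → Bool
      target x y = (Q y ∧ not (f y)) ∧ adj G x y
      exits : V → Bool
      exits x = (P x ∧ not (f x)) ∧ (0 <ᵇ cnt (target x) all)
      go : (∃ λ x → x ∈ all × T (exits x)) ⊎ (∀ {x} → x ∈ all → ¬ T (exits x)) → Crossing f
      go (inj₁ (x , _ , t)) with pick (target x) {all} [] uall (<ᵇ⇒< 0 _ (proj₂ (T-∧⁻ {P x ∧ not (f x)} t)))
      ... | x' , _ , t' , _ = x , x' , proj₁ (T-∧⁻ {P x} px) , proj₁ (T-∧⁻ {Q x'} qx) , T-not⁻ (proj₂ (T-∧⁻ {P x} px)) , T-not⁻ (proj₂ (T-∧⁻ {Q x'} qx)) ,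
            proj₂ (T-∧⁻ {Q x' ∧ not (f x')} t')
        where
        px = proj₁ (T-∧⁻ {P x ∧ not (f x)} t)
        qx = proj₁ (T-∧⁻ {Q x' ∧ not (f x')} t')
      go (inj₂ none) = ⊥-elim (noCut f hf (proj₁ u , proj₁ v , proj₂ (proj₂ u) , proj₂ (proj₂ v) , λ w → stuck (proj₁ (proj₂ u)) w (proj₁ (proj₂ v))))
        where
        u = outside f P (fewer f P hf halfP)
        v = outside f Q (fewer f Q hf halfQ)
        start : ∀ {u v} → Walk G (λ x → ¬ T (f x)) u v → ¬ T (f u)
        start (here p) = p
        start (step p _ _) = p
        stuck : ∀ {u v} → T (P u) → Walk G (λ x → ¬ T (f x)) u v → T (Q v) → ⊥
        stuck pu (here _) qv = disjoint pu qv
        stuck {u} pu (step {w = t} fu a w) qv with T? (P t) | T? (Q t)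
        ... | yes pt | _ = stuck pt w qv
        ... | no npt | no nqt = start w (Z⇒f (T-∧⁺ (T-not⁺ npt) (T-not⁺ nqt)))
        ... | no npt | yes qt = none (∈-allFin u) (T-∧⁺ (T-∧⁺ pu (T-not⁺ fu)) (<⇒<ᵇ
              (≤-trans (cnt≥ (target u) {all} {t ∷ []} ([] ∷ []) (λ { (here refl) → ∈-allFin t , T-∧⁺ (T-∧⁺ qt (T-not⁺ (start w))) a })) ≤-refl)))

    side : V → Bool
    side v = P v ∨ (not (Q v) ∧ (cnt (λ u → Q u ∧ adj G v u) all ≤ᵇ cnt (λ u → P u ∧ adj G v u) all))

    P⇒side : ∀ {v} → T (P v) → T (side v)
    P⇒side p = T-∨⁺ (inj₁ p)

    Q⇒¬side : ∀ {v} → T (Q v) → ¬ T (side v)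
    Q⇒¬side {v} q s with T-∨⁻ {P v} s
    ... | inj₁ p = disjoint p q
    ... | inj₂ t = T-not⁻ (proj₁ (T-∧⁻ {not (Q v)} t)) q

    side⇒ : ∀ {v} → T (side v) → ¬ T (P v) → cnt (λ u → Q u ∧ adj G v u) all ≤ cnt (λ u → P u ∧ adj G v u) all
    side⇒ {v} s np with T-∨⁻ {P v} s
    ... | inj₁ p = ⊥-elim (np p)
    ... | inj₂ t = ≤ᵇ⇒≤ _ _ (proj₂ (T-∧⁻ {not (Q v)} t))

    ¬side⇒ : ∀ {v} → T (not (side v)) → ¬ T (Q v) → cnt (λ u → P u ∧ adj G v u) all ≤ cnt (λ u → Q u ∧ adj G v u) all
    ¬side⇒ {v} s nq = <⇒≤ (≰⇒> (λ le → T-not⁻ s (T-∨⁺ {P v} (inj₂ (T-∧⁺ (T-not⁺ nq) (≤⇒≤ᵇ le))))))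

    module HP = Half h g 180≤h 500≤g y cores degree side P⇒side Q⇒¬side side⇒ 100y≤n n≤180y 1000z≤y 2≤y large wide
    module HQ = Half h g 180≤h 500≤g y (swapCores cores) degree (not ∘ side) (λ q → T-not⁺ (Q⇒¬side q)) (λ p s → T-not⁻ s (P⇒side p)) ¬side⇒
      100y≤n n≤180y 1000z≤y 2≤y large wide

    all↭ : all ↭ HP.W ++ HQ.W
    all↭ = ↭tr (sel-rej side all) (++⁺ˡ HP.W (↭-reflexive (rej≡sel-not side all)))

    -- An end of the rim: pre leaves the ladder at the rung (p , q) and finishes at v.
    record RimEnd (v x₁ x₂ : V) (W : List V) : Set where
      field
        p q c : V
        pre pre' V₀ : List V
        trail : Trail v pre c
        trail' : Trail c pre' v
        reversed : pre ↭ pre'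
        pq : p ~ q
        spokes : ∀ {u} → u ∈ pre → p ~ u × q ~ u
        c∈ : c ∈ pre
        short : length pre ≤ 2
        part : W ↭ pre ++ (p ∷ q ∷ x₁ ∷ x₂ ∷ V₀)
        even : 2 ∣ 4 + length V₀

    rimEndFromClique : ∀ {R S} (c : Cores R S) {W} → Unique W → (∀ {v} → T (R v) → v ∈ W) → ∀ {v x₁ x₂} → T (R v) → T (R x₁) → T (R x₂) →
      Unique (v ∷ x₁ ∷ x₂ ∷ []) → Core.Clique₄ c 100z≤n v (v ∷ x₁ ∷ x₂ ∷ []) → RimEnd v x₁ x₂ W
    rimEndFromClique c {W} uW R⇒W {v} {x₁} {x₂} rv r₁ r₂ u k = go (evenOrOdd (length W))
      where
      open Core.Clique₄ k renaming (x to p; y to q)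
      u' : Unique (w ∷ q ∷ p ∷ v ∷ x₁ ∷ x₂ ∷ [])
      u' = fresh u
      go : 2 ∣ length W ⊎ 2 ∣ suc (length W) → RimEnd v x₁ x₂ W
      go (inj₁ ev) = done (⊆⇒↭ uF F⊆)
        where
        F : List V
        F = v ∷ w ∷ p ∷ q ∷ x₁ ∷ x₂ ∷ []
        uF : Unique F
        uF = Unique-↭ (psolve 5 (λ w q p v x → w ⊕ (q ⊕ (p ⊕ (v ⊕ x))) ⊜ v ⊕ (w ⊕ (p ⊕ (q ⊕ x)))) ↭-refl [ w ] [ q ] [ p ] [ v ] (x₁ ∷ x₂ ∷ [])) u'
        F⊆ : ∀ {t} → t ∈ F → t ∈ W
        F⊆ (here refl) = R⇒W rv
        F⊆ (there (here refl)) = R⇒W Pw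
        F⊆ (there (there (here refl))) = R⇒W Px
        F⊆ (there (there (there (here refl)))) = R⇒W Py
        F⊆ (there (there (there (there (here refl))))) = R⇒W r₁
        F⊆ (there (there (there (there (there (here refl)))))) = R⇒W r₂
        done : (∃ λ V₀ → W ↭ F ++ V₀) → RimEnd v x₁ x₂ W
        done (V₀ , part) = record { p = p ; q = q ; c = w ; pre = v ∷ w ∷ [] ; pre' = w ∷ v ∷ [] ; V₀ = V₀ ; trail = more vw one ; trail' = more (~sym vw) one
          ; reversed = swap v w ↭refl ; pq = xy ; spokes = λ { (here refl) → ~sym vx , ~sym vy ; (there (here refl)) → xw , yw }
          ; c∈ = there (here refl) ; short = ≤-refl ; part = part
          ; even = ∣m+n∣m⇒∣n {2} {2} (subst (2 ∣_) (↭-length part) ev) ∣-refl }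
      go (inj₂ od) = done (⊆⇒↭ uF F⊆)
        where
        F : List V
        F = v ∷ p ∷ q ∷ x₁ ∷ x₂ ∷ []
        uF : Unique F
        uF = Unique-++ʳ (w ∷ []) (Unique-↭ (psolve 5 (λ w q p v x → w ⊕ (q ⊕ (p ⊕ (v ⊕ x))) ⊜ w ⊕ (v ⊕ (p ⊕ (q ⊕ x)))) ↭-refl [ w ] [ q ] [ p ] [ v ] (x₁ ∷ x₂ ∷ [])) u')
        F⊆ : ∀ {t} → t ∈ F → t ∈ W
        F⊆ (here refl) = R⇒W rv
        F⊆ (there (here refl)) = R⇒W Px
        F⊆ (there (there (here refl))) = R⇒W Py
        F⊆ (there (there (there (here refl)))) = R⇒W r₁
        F⊆ (there (there (there (there (here refl))))) = R⇒W r₂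
        done : (∃ λ V₀ → W ↭ F ++ V₀) → RimEnd v x₁ x₂ W
        done (V₀ , part) = record { p = p ; q = q ; c = v ; pre = v ∷ [] ; pre' = v ∷ [] ; V₀ = V₀ ; trail = one ; trail' = one
          ; reversed = ↭refl ; pq = xy ; spokes = λ { (here refl) → ~sym vx , ~sym vy }
          ; c∈ = here refl ; short = s≤s z≤n ; part = part
          ; even = ∣m+n∣m⇒∣n {2} {2} (subst (λ k → 2 ∣ suc k) (↭-length part) od) ∣-refl }

    rimEnd : ∀ {R S} (c : Cores R S) {W} → Unique W → (∀ {v} → T (R v) → v ∈ W) → ∀ {v x₁ x₂} → T (R v) → T (R x₁) → T (R x₂) →
      Unique (v ∷ x₁ ∷ x₂ ∷ []) → RimEnd v x₁ x₂ W
    rimEnd c uW R⇒W {v} {x₁} {x₂} rv r₁ r₂ u = rimEndFromClique c uW R⇒W rv r₁ r₂ u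
      (Core.clique₄ c 100z≤n v (v ∷ x₁ ∷ x₂ ∷ []) rv (m≤m+n 3 5))

    finish : ∀ {b₀ a' x₁ x₂ x₁' x₂'} → a' ~ b₀ → x₁ ~ x₂ → x₁' ~ x₂' → x₁ ~ x₁' → x₂ ~ x₂' → RimEnd b₀ x₁ x₂ HP.W → RimEnd a' x₁' x₂' HQ.W → HasSpanningHalin G
    finish {b₀} {a'} {x₁} {x₂} {x₁'} {x₂'} ab xx xx' l₁ l₂ rp rq = go
        (HP.halfLadder rp.pre rp.short rp.p rp.q x₁ x₂ rp.V₀ rp.part rp.pq xx rp.even)
        (HQ.halfLadder rq.pre rq.short x₁' x₂' rq.p rq.q rq.V₀ partQ xx' rq.pq rq.even)
      where
      module rp = RimEnd rp
      module rq = RimEnd rq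
      partQ : HQ.W ↭ rq.pre ++ (x₁' ∷ x₂' ∷ rq.p ∷ rq.q ∷ rq.V₀)
      partQ = ↭tr rq.part (++⁺ˡ rq.pre (psolve 3 (λ a b v → a ⊕ (b ⊕ v) ⊜ b ⊕ (a ⊕ v)) ↭-refl (rq.p ∷ rq.q ∷ []) (x₁' ∷ x₂' ∷ []) rq.V₀))
      go : (Σ (Chain (rp.p , rp.q) [] (x₁ , x₂)) λ c → rp.p ∷ rp.q ∷ x₁ ∷ x₂ ∷ rp.V₀ ↭ cverts c) →
           (Σ (Chain (x₁' , x₂') [] (rq.p , rq.q)) λ c → x₁' ∷ x₂' ∷ rq.p ∷ rq.q ∷ rq.V₀ ↭ cverts c) → HasSpanningHalin G
      go (cp , pp) (cq , pq) = done (join cp (link (inj₁ (l₁ , l₂))) cq)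
        where
        done : (Σ (Chain (rp.p , rp.q) [] (rq.p , rq.q)) λ c → cverts c ≡ cverts cp ++ cverts cq) → HasSpanningHalin G
        done (c , eq) = halinFromChain c
          (≤-trans (≤-trans (m≤m+n 4 (length rp.V₀)) (≤-reflexive (↭-length pp))) (≤-trans (m≤m+n _ (length (cverts cq))) (≤-reflexive (sym (trans (cong length eq) (length-++ (cverts cp)))))))
          rp.trail (~sym (proj₂ (rp.spokes rp.c∈))) (λ i → proj₁ (rp.spokes i))
          rq.trail' (λ i → rq.spokes (∈-resp-↭ (↭-sym rq.reversed) i)) (∈-resp-↭ rq.reversed rq.c∈) ab
          (↭tr all↭ (↭tr (++⁺ (↭tr rp.part (++⁺ˡ rp.pre pp)) (↭tr partQ (++⁺ rq.reversed pq)))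
            (↭tr (reorder rp.pre (cverts cp) rq.pre' (cverts cq)) (++⁺ˡ rp.pre (++⁺ʳ rq.pre' (↭-reflexive (sym eq)))))))
          where
          reorder : ∀ (a b c d : List V) → (a ++ b) ++ (c ++ d) ↭ a ++ (b ++ d) ++ c
          reorder = psolve 4 (λ a b c d → (a ⊕ b) ⊕ (c ⊕ d) ⊜ a ⊕ ((b ⊕ d) ⊕ c)) ↭-refl

    caseOne : HasSpanningHalin G
    caseOne = go₁ (crossing Z (≤-trans (*-monoʳ-≤ b (≤-trans rest (≤-trans (*-monoˡ-≤ z (m≤m+n 7 10)) (m≤m+n (17 * z) 4)))) smallCut) id)
      where
      go₃ : ∀ {x₁ x₁' x₂ x₂'} → T (P x₁) → T (Q x₁') → T (P x₂) → T (Q x₂') → x₁ ~ x₁' → x₂ ~ x₂' → x₁ ~ x₂ → x₁' ~ x₂' →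
        Crossing (λ u → Z u ∨ inᵇ (x₁ ∷ x₂ ∷ x₁' ∷ x₂' ∷ []) u) → HasSpanningHalin G
      go₃ {x₁} {x₁'} {x₂} {x₂'} p₁ q₁ p₂ q₂ l₁ l₂ xx xx' (b₀ , a' , pb , qa , nb , na , ba) =
        finish (~sym ba) xx xx' l₁ l₂
          (rimEnd cores HP.uW HP.core∈W pb p₁ p₂ (((λ { refl → nb (avoid (here refl)) }) ∷ (λ { refl → nb (avoid (there (here refl))) }) ∷ []) ∷ ((≢x xx ∷ []) ∷ ([] ∷ []))))
          (rimEnd (swapCores cores) HQ.uW HQ.core∈W qa q₁ q₂ (((λ { refl → na (avoid (there (there (here refl)))) }) ∷ (λ { refl → na (avoid (there (there (there (here refl))))) }) ∷ []) ∷ ((≢x xx' ∷ []) ∷ ([] ∷ []))))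
        where
        avoid : ∀ {u} → u ∈ x₁ ∷ x₂ ∷ x₁' ∷ x₂' ∷ [] → T (Z u ∨ inᵇ (x₁ ∷ x₂ ∷ x₁' ∷ x₂' ∷ []) u)
        avoid {u} m = T-∨⁺ {Z u} (inj₂ (inᵇ⁺ (x₁ ∷ x₂ ∷ x₁' ∷ x₂' ∷ []) m))
        ≢x : ∀ {u v} → u ~ v → u ≢ v
        ≢x a refl = ~irrefl a
      b2n-∨ : ∀ a c → b2n (a ∨ c) ≤ b2n a + b2n c
      b2n-∨ true c = s≤s z≤n
      b2n-∨ false c = ≤-refl
      go₂ : ∀ {x₁ x₁'} → T (P x₁) → T (Q x₁') → x₁ ~ x₁' → Crossing (λ u → Z u ∨ ((P u ∧ not (adj G x₁ u)) ∨ (Q u ∧ not (adj G x₁' u)))) → HasSpanningHalin G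
      go₂ {x₁} {x₁'} p₁ q₁ l₁ (x₂ , x₂' , p₂ , q₂ , n₂ , n₂' , l₂) = go₃ p₁ q₁ p₂ q₂ l₁ l₂ xx xx'
        (crossing _ (≤-trans (*-monoʳ-≤ b (≤-trans (cnt-≤₂ all (λ u → b2n-∨ (Z u) (inᵇ F u))) (≤-trans (+-mono-≤ rest (cnt-∈ F uall)) (+-monoˡ-≤ 4 (*-monoˡ-≤ z (m≤m+n 7 10)))))) smallCut)
          (λ t → T-∨⁺ (inj₁ t)))
        where
        F : List V
        F = x₁ ∷ x₂ ∷ x₁' ∷ x₂' ∷ []
        decide : ∀ {a} → ¬ T (not a) → T a
        decide {true} _ = tt
        decide {false} h = h tt
        xx : x₁ ~ x₂
        xx = decide (λ t → n₂ (T-∨⁺ {Z x₂} (inj₂ (T-∨⁺ (inj₁ (T-∧⁺ p₂ t))))))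
        xx' : x₁' ~ x₂'
        xx' = decide (λ t → n₂' (T-∨⁺ {Z x₂'} (inj₂ (T-∨⁺ {P x₂' ∧ not (adj G x₁ x₂')} (inj₂ (T-∧⁺ q₂ t))))))
      go₁ : Crossing Z → HasSpanningHalin G
      go₁ (x₁ , x₁' , p₁ , q₁ , _ , _ , l₁) = go₂ p₁ q₁ l₁ (crossing _ (≤-trans (*-monoʳ-≤ b (≤-trans (cnt-≤₃ all (λ u →
          ≤-trans (b2n-∨ (Z u) _) (≤-trans (+-monoʳ-≤ (b2n (Z u)) (b2n-∨ (P u ∧ not (adj G x₁ u)) _)) (≤-reflexive (sym (+-assoc (b2n (Z u)) _ _))))))
          (≤-trans (+-mono-≤ (+-mono-≤ rest (missP p₁)) (missQ q₁)) (≤-trans (≤-reflexive (lem z)) (m≤m+n (17 * z) 4))))) smallCut)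
        (λ t → T-∨⁺ (inj₁ t)))
        where
        lem : ∀ z → 7 * z + 5 * z + 5 * z ≡ 17 * z
        lem = solve-∀

  module BuildCores {n : ℕ} (G : Graph n) (a b z : ℕ)
    (degree : ∀ v → n + 1 ≤ 2 * cnt (adj G v) (L.allFin n))
    (noSparse : ∀ (f : Fin n → Bool) → n * b ≤ 2 * b * cnt f (L.allFin n) + 14 * n →
      ¬ (∀ {v} → T (f v) → b * cnt (λ u → adj G v u ∧ f u) (L.allFin n) ≤ n))
    (a-large : n ≤ 2 * a + 4 * z + 6) (6≤z : 6 ≤ z) (bz : b * (16 * z + 6) ≤ 14 * n) (bz' : b * z ≤ n) where
    open Tiles G
    open Cliques G z

    low : (V → Bool) → V → Bool
    low f' v = cnt (λ u → adj G v u ∧ f' u) all <ᵇ z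

    core : (V → Bool) → (V → Bool) → V → Bool
    core f f' v = f v ∧ low f' v

    1≤z : 1 ≤ z
    1≤z = ≤-trans (s≤s z≤n) 6≤z

    module _ (f f' : V → Bool) (sparse : e (sel f all) (sel f' all) ≤ z * z) (af' : a ≤ cnt f' all) where

      core-large : cnt f all ≤ cnt (core f f') all + cnt (λ v → not (low f' v) ∧ f v) all × cnt (λ v → not (low f' v) ∧ f v) all ≤ z
      core-large = cnt-≤₂ all (λ v → pt (f v) (low f' v)) , *-cancelˡ-≤ z ⦃ >-nonZero 1≤z ⦄ (≤-trans (≤-trans (≤-reflexive (trans (cong (z *_) (sym (cnt-sel (not ∘ low f') f all)))
          (sym (∑-* z _ (sel f all))))) (∑-mono (sel f all) (λ {v} _ → each v))) sparse)
        where
        pt : ∀ f l → b2n f ≤ b2n (f ∧ l) + b2n (not l ∧ f)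
        pt false l = z≤n
        pt true true = s≤s z≤n
        pt true false = s≤s z≤n
        each : ∀ v → z * b2n (not (low f' v)) ≤ cnt (adj G v) (sel f' all)
        each v with low f' v in eq
        ... | true = ≤-trans (≤-reflexive (*-zeroʳ z)) z≤n
        ... | false = ≤-trans (≤-reflexive (*-identityʳ z)) (≤-trans (≮⇒≥ (λ lt → subst T eq (<⇒<ᵇ lt))) (≤-reflexive (sym (cnt-sel (adj G v) f' all))))

      core-size : cnt f all ≤ cnt (core f f') all + z
      core-size = ≤-trans (proj₁ core-large) (+-monoʳ-≤ _ (proj₂ core-large))

      core-low : ∀ {v} → T (core f f' v) → cnt (λ u → adj G v u ∧ f' u) all < z
      core-low {v} t = <ᵇ⇒< _ _ (proj₂ (T-∧⁻ {f v} t))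

      core-outside : ∀ {v} → T (core f f' v) → cnt (λ u → not (adj G v u) ∧ not (f' u)) all ≤ 4 * z
      core-outside {v} t = *-cancelˡ-≤ 2 (linear
          {a = 2 * (x + cnt f' all + cnt (adj G v) all) + (n + 1) + n + 2 * a + 2 * suc c + 6}
          {b = 2 * (n + c) + 2 * cnt (adj G v) all + (2 * a + 4 * z + 6) + 2 * cnt f' all + 2 * z + z} (3 + z)
          (+-mono-≤ (+-mono-≤ (+-mono-≤ (+-mono-≤ (+-mono-≤ (*-monoʳ-≤ 2 total) (degree v)) a-large) (*-monoʳ-≤ 2 af')) (*-monoʳ-≤ 2 (core-low t))) 6≤z)
          (lem x (cnt f' all) (cnt (adj G v) all) n a z c))
        where
        x c : ℕ
        x = cnt (λ u → not (adj G v u) ∧ not (f' u)) all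
        c = cnt (λ u → adj G v u ∧ f' u) all
        pt : ∀ p q → b2n (not p ∧ not q) + b2n q + b2n p ≡ 1 + b2n (p ∧ q)
        pt true true = refl
        pt true false = refl
        pt false true = refl
        pt false false = refl
        total : x + cnt f' all + cnt (adj G v) all ≤ n + c
        total = ≤-reflexive (trans (sym (trans (∑-+ _ _ all) (cong (_+ cnt (adj G v) all) (∑-+ _ _ all)))) (trans (∑-cong all (λ u → pt (adj G v u) (f' u)))
          (trans (∑-+ _ _ all) (cong (_+ c) (trans (sym (length≡∑ all)) |all|)))))
        lem : ∀ x f d n a z c → 2 * x + (2 * (n + c) + 2 * d + (2 * a + 4 * z + 6) + 2 * f + 2 * z + z) + (3 + z) ≡
          2 * (4 * z) + (2 * (x + f + d) + (n + 1) + n + 2 * a + 2 * (1 + c) + 6)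
        lem = solve-∀

    module _ (f f' : V → Bool) (sparse : e (sel f all) (sel f' all) ≤ z * z) (af : a ≤ cnt f all) (af' : a ≤ cnt f' all) where

      sparse' : e (sel f' all) (sel f all) ≤ z * z
      sparse' = ≤-trans (≤-reflexive (e-sym (sel f' all) (sel f all))) sparse

      P Q : V → Bool
      P = core f f'
      Q = core f' f

      disjoint : ∀ {v} → T (P v) → T (Q v) → ⊥
      disjoint {v} pv qv = noSparse s size sparseDegrees
        where
        s : V → Bool
        s u = P u ∧ f' u
        pt₁ : ∀ p q → b2n p ≤ b2n (p ∧ q) + b2n (p ∧ not q)
        pt₁ false q = z≤n
        pt₁ true true = s≤s z≤n
        pt₁ true false = s≤s z≤n
        pt₂ : ∀ f l q m → b2n ((f ∧ l) ∧ not q) ≤ b2n (m ∧ f) + b2n (not m ∧ not q)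
        pt₂ false l q m = z≤n
        pt₂ true false q m = z≤n
        pt₂ true true true m = z≤n
        pt₂ true true false true = s≤s z≤n
        pt₂ true true false false = s≤s z≤n
        a≤ : a ≤ cnt s all + 6 * z
        a≤ = ≤-trans (≤-trans af (core-size f f' sparse af')) (≤-trans (+-monoˡ-≤ z (≤-trans (cnt-≤₂ all (λ u → pt₁ (P u) (f' u)))
          (+-monoʳ-≤ (cnt s all) (≤-trans (cnt-≤₂ all (λ u → pt₂ (f u) (low f' u) (f' u) (adj G v u)))
            (+-mono-≤ (<⇒≤ (core-low f' f sparse' af qv)) (core-outside f f' sparse af' pv)))))) (≤-reflexive (lem (cnt s all) z)))
          where
          lem : ∀ s z → s + (z + 4 * z) + z ≡ s + 6 * z
          lem = solve-∀
        size : n * b ≤ 2 * b * cnt s all + 14 * n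
        size = linear {a = b * n + 2 * b * a + b * (16 * z + 6)} {b = b * (2 * a + 4 * z + 6) + 2 * b * (cnt s all + 6 * z) + 14 * n} 0
          (+-mono-≤ (+-mono-≤ (*-monoʳ-≤ b a-large) (*-monoʳ-≤ (2 * b) a≤)) bz) (lem n b (cnt s all) a z)
          where
          lem : ∀ n b s a z → n * b + (b * (2 * a + 4 * z + 6) + 2 * b * (s + 6 * z) + 14 * n) + 0 ≡ 2 * b * s + 14 * n + (b * n + 2 * b * a + b * (16 * z + 6))
          lem = solve-∀
        sparseDegrees : ∀ {u} → T (s u) → b * cnt (λ w → adj G u w ∧ s w) all ≤ n
        sparseDegrees {u} t = ≤-trans (*-monoʳ-≤ b (≤-trans (cnt-mono all (λ {w} _ t' → T-∧⁺ (proj₁ (T-∧⁻ {adj G u w} t')) (proj₂ (T-∧⁻ {P w} (proj₂ (T-∧⁻ {adj G u w} t'))))))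
          (<⇒≤ (core-low f f' sparse af' (proj₁ (T-∧⁻ {P u} t)))))) bz'

      missing : ∀ {v} → T (P v) → cnt (λ u → P u ∧ not (adj G v u)) all ≤ 5 * z
      missing {v} pv = ≤-trans (cnt-≤₂ all point) (≤-trans (+-mono-≤ (core-outside f f' sparse af' pv) (proj₂ (core-large f' f sparse' af))) (≤-reflexive (lem z)))
        where
        lem : ∀ z → 4 * z + z ≡ 5 * z
        lem = solve-∀
        point : ∀ u → b2n (P u ∧ not (adj G v u)) ≤ b2n (not (adj G v u) ∧ not (f' u)) + b2n (not (low f u) ∧ f' u)
        point u with P u in eq
        ... | false = z≤n
        ... | true = go (adj G v u) (f' u) refl (low f u) refl
          where
          go : ∀ m q → f' u ≡ q → ∀ l → low f u ≡ l → b2n (not m) ≤ b2n (not m ∧ not q) + b2n (not l ∧ q)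
          go true q _ l _ = z≤n
          go false false _ l _ = s≤s z≤n
          go false true _ false _ = s≤s z≤n
          go false true eq' true eq'' = ⊥-elim (disjoint {u} (subst T (sym eq) tt) (T-∧⁺ (subst T (sym eq') tt) (subst T (sym eq'') tt)))

      half : n ≤ 2 * cnt P all + 7 * z
      half = linear {a = n + 2 * a + 6} {b = (2 * a + 4 * z + 6) + 2 * (cnt P all + z) + z} 0
        (+-mono-≤ (+-mono-≤ a-large (*-monoʳ-≤ 2 (≤-trans af (core-size f f' sparse af')))) 6≤z) (lem n a z (cnt P all))
        where
        lem : ∀ n a z p → n + ((2 * a + 4 * z + 6) + 2 * (p + z) + z) + 0 ≡ 2 * p + 7 * z + (n + 2 * a + 6)
        lem = solve-∀

    buildCores : ∀ f f' → e (sel f all) (sel f' all) ≤ z * z → a ≤ cnt f all → a ≤ cnt f' all → Cores (core f f') (core f' f)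
    buildCores f f' sparse af af' = record
      { disjoint = disjoint f f' sparse af af'
      ; rest = rest
      ; missP = missing f f' sparse af af'
      ; missQ = missing f' f sp' af' af
      ; halfP = half f f' sparse af af'
      ; halfQ = half f' f sp' af' af }
      where
      sp' = sparse' f f' sparse af af'
      P₀ Q₀ : V → Bool
      P₀ = core f f'
      Q₀ = core f' f
      point : ∀ u → b2n (not (P₀ u) ∧ not (Q₀ u)) + b2n (P₀ u) + b2n (Q₀ u) ≤ 1
      point u with P₀ u in eq | Q₀ u in eq'
      ... | true | true = ⊥-elim (disjoint f f' sparse af af' {u} (subst T (sym eq) tt) (subst T (sym eq') tt))
      ... | true | false = s≤s z≤n
      ... | false | true = s≤s z≤n
      ... | false | false = s≤s z≤n
      sum≤ : cnt (λ u → not (P₀ u) ∧ not (Q₀ u)) all + cnt P₀ all + cnt Q₀ all ≤ n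
      sum≤ = ≤-trans (≤-reflexive (sym (trans (∑-+ _ _ all) (cong (_+ cnt Q₀ all) (∑-+ _ _ all))))) (≤-trans (∑-mono all (λ {u} _ → point u))
        (≤-reflexive (trans (sym (length≡∑ all)) |all|)))
      rest : cnt (λ u → not (P₀ u) ∧ not (Q₀ u)) all ≤ 7 * z
      rest = linear {a = r + cnt P₀ all + cnt Q₀ all + n + a + a + 6} {b = n + (2 * a + 4 * z + 6) + (cnt P₀ all + z) + (cnt Q₀ all + z) + z} 0
        (+-mono-≤ (+-mono-≤ (+-mono-≤ (+-mono-≤ sum≤ a-large) (≤-trans af (core-size f f' sparse af'))) (≤-trans af' (core-size f' f sp' af))) 6≤z)
        (lem r (cnt P₀ all) (cnt Q₀ all) n a z)
        where
        r : ℕ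
        r = cnt (λ u → not (P₀ u) ∧ not (Q₀ u)) all
        lem : ∀ r p q n a z → r + (n + (2 * a + 4 * z + 6) + (p + z) + (q + z) + z) + 0 ≡ 7 * z + (r + p + q + n + a + a + 6)
        lem = solve-∀

  -- Choice of constants

  module Decide {n : ℕ} (G : Graph n) (a g : ℕ) where
    open Tiles G

    all : List V
    all = L.allFin n

    Witness : (V → Bool) → (V → Bool) → Set
    Witness f f' = a ≤ cnt f all × a ≤ cnt f' all × g * e (sel f all) (sel f' all) < n * n

    witness? : ∀ f f' → Dec (Witness f f')
    witness? f f' = (a ≤? cnt f all) ×-dec ((a ≤? cnt f' all) ×-dec (g * e (sel f all) (sel f' all) <? n * n))

    sel-cong : ∀ {f f' : V → Bool} → (∀ v → f v ≡ f' v) → ∀ xs → sel f xs ≡ sel f' xs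
    sel-cong h [] = refl
    sel-cong {f} {f'} h (x ∷ xs) rewrite h x = cong (λ r → if f' x then x ∷ r else r) (sel-cong h xs)

    expandingOrWitness : (∀ A A' B B' → all ↭ A ++ A' → all ↭ B ++ B' → a ≤ length A → a ≤ length B → n * n ≤ g * e A B) ⊎
      (∃ λ f → ∃ λ f' → Witness f f')
    expandingOrWitness with anySubset? (λ p → anySubset? (λ q → witness? (Vec.lookup p) (Vec.lookup q)))
    ... | yes (p , q , w) = inj₂ (Vec.lookup p , Vec.lookup q , w)
    ... | no none = inj₁ expanding
      where
      subset : ∀ A A' → all ↭ A ++ A' → sel (Vec.lookup (Vec.tabulate (inᵇ A))) all ↭ A
      subset A A' p = ↭tr (↭-reflexive (sel-cong (lookup∘tabulate (inᵇ A)) all))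
        (sel-inᵇ↭ (allFin⁺ n) (Unique-++ˡ A (Unique-↭ p (allFin⁺ n))) (λ _ → ∈-allFin _))
      size : ∀ A A' → all ↭ A ++ A' → a ≤ length A → a ≤ cnt (Vec.lookup (Vec.tabulate (inᵇ A))) all
      size A A' p h = ≤-trans h (≤-reflexive (trans (sym (↭-length (subset A A' p))) (length-sel _ all)))
      expanding : ∀ A A' B B' → all ↭ A ++ A' → all ↭ B ++ B' → a ≤ length A → a ≤ length B → n * n ≤ g * e A B
      expanding A A' B B' p q lA lB with <-or-≥ (g * e A B) (n * n)
      ... | inj₂ h = h
      ... | inj₁ lt = ⊥-elim (none (Vec.tabulate (inᵇ A) , Vec.tabulate (inᵇ B) , size A A' p lA , size B B' q lB ,
          subst (λ k → g * k < n * n) (sym (trans (∑-↭ _ (subset A A' p)) (e-↭ʳ A (subset B B' q)))) lt))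

  floor-upper : ∀ m d .⦃ _ : NonZero d ⦄ → m < d * (m / d + 1)
  floor-upper m d = ≤-trans (s≤s (≤-reflexive (m≡m%n+[m/n]*n m d))) (≤-trans (+-monoˡ-≤ (m / d * d) (m%n<n m d)) (≤-reflexive (lem d (m / d))))
    where
    lem : ∀ d q → d + q * d ≡ d * (q + 1)
    lem = solve-∀

  floor-lower : ∀ {k} m d .⦃ _ : NonZero d ⦄ → k * d ≤ m → k ≤ m / d
  floor-lower {k} m d h = ≤-trans (≤-reflexive (sym (m*n/n≡m k d))) (/-monoˡ-≤ d h)

  module Combine (b h g C : ℕ) (12000≤C : 12000 ≤ C) (4≤b : 4 ≤ b) (180≤h : 180 ≤ h) (500≤g : 500 ≤ g) where

    H h₂ g₂ n₀ : ℕ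
    H = C * h * b
    h₂ = 2 * H
    g₂ = 4 * H * H
    n₀ = 10 * H + (ladderThreshold h₂ g₂ + 7) + (10 * g₂ + 1) + (7200 * h₂ + 7) + 4 * (ladderThreshold h g + 6)

    1≤H : 1 ≤ H
    1≤H = *-mono-≤ {1} {C * h} {1} {b} (*-mono-≤ {1} {C} {1} {h} (≤-trans (s≤s z≤n) 12000≤C) (≤-trans (s≤s z≤n) 180≤h)) (≤-trans (s≤s z≤n) 4≤b)

    instance
      H≢0 : NonZero H
      H≢0 = >-nonZero 1≤H

    module _ {n : ℕ} (n₀≤n : n₀ ≤ n) (G : Graph n)
      (degree : ∀ v → n + 1 ≤ 2 * cnt (adj G v) (L.allFin n))
      (noCut : ∀ (f : Fin n → Bool) → b * cnt f (L.allFin n) ≤ n → ¬ (∃ λ u → ∃ λ v → ¬ T (f u) × ¬ T (f v) × ¬ Walk G (λ x → ¬ T (f x)) u v))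
      (noSparse : ∀ (f : Fin n → Bool) → n * b ≤ 2 * b * cnt f (L.allFin n) + 14 * n →
        ¬ (∀ {v} → T (f v) → b * cnt (λ u → adj G v u ∧ f u) (L.allFin n) ≤ n)) where

      z y a : ℕ
      z = n / H
      y = n / 100
      a = (n ∸ (4 * z + 5)) / 2

      t₁ t₂ t₃ t₄ t₅ : ℕ
      t₁ = 10 * H
      t₂ = ladderThreshold h₂ g₂ + 7
      t₃ = 10 * g₂ + 1
      t₄ = 7200 * h₂ + 7
      t₅ = 4 * (ladderThreshold h g + 6)

      T₁ : t₁ ≤ n
      T₁ = ≤-trans (≤-trans (≤-trans (≤-trans (m≤m+n t₁ t₂) (m≤m+n _ t₃)) (m≤m+n _ t₄)) (m≤m+n _ t₅)) n₀≤n
      T₂ : t₂ ≤ n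
      T₂ = ≤-trans (≤-trans (≤-trans (≤-trans (m≤n+m t₂ t₁) (m≤m+n _ t₃)) (m≤m+n _ t₄)) (m≤m+n _ t₅)) n₀≤n
      T₃ : t₃ ≤ n
      T₃ = ≤-trans (≤-trans (≤-trans (m≤n+m t₃ (t₁ + t₂)) (m≤m+n _ t₄)) (m≤m+n _ t₅)) n₀≤n
      T₄ : t₄ ≤ n
      T₄ = ≤-trans (≤-trans (m≤n+m t₄ (t₁ + t₂ + t₃)) (m≤m+n _ t₅)) n₀≤n
      T₅ : t₅ ≤ n
      T₅ = ≤-trans (m≤n+m t₅ (t₁ + t₂ + t₃ + t₄)) n₀≤n

      10≤z : 10 ≤ z
      10≤z = floor-lower n H T₁

      zH≤n : z * H ≤ n
      zH≤n = m/n*n≤m n H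

      z≤bz : z ≤ b * z
      z≤bz = m≤n*m z b ⦃ >-nonZero (≤-trans (s≤s z≤n) 4≤b) ⦄

      below : ∀ {k x} → k ≤ 12000 → x ≤ h * (b * z) → k * x ≤ n
      below k≤ x≤ = ≤-trans (*-mono-≤ (≤-trans k≤ 12000≤C) x≤) (≤-trans (≤-reflexive (lem C h b z)) zH≤n)
        where
        lem : ∀ c h b z → c * (h * (b * z)) ≡ z * (c * h * b)
        lem = solve-∀

      bz≤hbz : b * z ≤ h * (b * z)
      bz≤hbz = m≤n*m (b * z) h ⦃ >-nonZero (≤-trans (s≤s z≤n) 180≤h) ⦄

      b≤bz : b * 10 ≤ b * z
      b≤bz = *-monoʳ-≤ b 10≤z

      smallCut : b * (17 * z + 4) ≤ n
      smallCut = linear {a = b * 10 + 18 * (b * z)} {b = b * z + n} (6 * b) (+-mono-≤ b≤bz (below {18} (≤ᵇ⇒≤ 18 12000 tt) bz≤hbz)) (lem b z n)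
        where
        lem : ∀ b z n → b * (17 * z + 4) + (b * z + n) + 6 * b ≡ n + (b * 10 + 18 * (b * z))
        lem = solve-∀

      100z≤n : 100 * z + 100 ≤ n
      100z≤n = linear {a = 10 * 10 + 110 * z} {b = 10 * z + n} 0 (+-mono-≤ (*-monoʳ-≤ 10 10≤z) (below {110} (≤ᵇ⇒≤ 110 12000 tt) (≤-trans z≤bz bz≤hbz))) (lem z n)
        where
        lem : ∀ z n → 100 * z + 100 + (10 * z + n) + 0 ≡ n + (100 + 110 * z)
        lem = solve-∀

      n≤2Hz : n ≤ h₂ * z
      n≤2Hz = ≤-trans (<⇒≤ (floor-upper n H)) (linear {a = H * 10} {b = H * z} (9 * H) (*-monoʳ-≤ H 10≤z) (lem H z))
        where
        lem : ∀ H z → H * (z + 1) + H * z + 9 * H ≡ 2 * H * z + H * 10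
        lem = solve-∀

      1000z≤y : 1000 * z ≤ y
      1000z≤y = floor-lower n 100 (≤-trans (≤-reflexive (trans (*-assoc 1000 z 100) (cong (1000 *_) (*-comm z 100))))
        (below (≤ᵇ⇒≤ 1000 12000 tt) (*-mono-≤ (≤-trans (m≤m+n 100 80) 180≤h) z≤bz)))

      2≤y : 2 ≤ y
      2≤y = ≤-trans (≤-trans (≤-trans (m≤m+n 2 8) 10≤z) (m≤n*m z 1000)) 1000z≤y

      100y≤n : 100 * y ≤ n
      100y≤n = ≤-trans (≤-reflexive (*-comm 100 y)) (m/n*n≤m n 100)

      n≤180y : n ≤ 180 * y
      n≤180y = ≤-trans (<⇒≤ (floor-upper n 100)) (linear {a = 80 * 2} {b = 80 * y} 60 (*-monoʳ-≤ 80 2≤y) (lem y))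
        where
        lem : ∀ y → 100 * (y + 1) + 80 * y + 60 ≡ 180 * y + 160
        lem = solve-∀

      wide : 4 * (100 * h * (28 * z) + 6) ≤ n
      wide = ≤-trans (linear {a = 24 * (1 * 1)} {b = 24 * (h * z)} (776 * (h * z)) (*-monoʳ-≤ 24 (*-mono-≤ {1} {h} {1} {z} (≤-trans (s≤s z≤n) 180≤h) (≤-trans (s≤s z≤n) 10≤z))) (lem h z))
        (below ≤-refl (*-monoʳ-≤ h z≤bz))
        where
        lem : ∀ h z → 4 * (100 * h * (28 * z) + 6) + 24 * (h * z) + 776 * (h * z) ≡ 12000 * (h * z) + 24
        lem = solve-∀

      4z+5≤n : 4 * z + 5 ≤ n
      4z+5≤n = ≤-trans (+-mono-≤ (*-monoˡ-≤ z {4} {100} (≤ᵇ⇒≤ 4 100 tt)) (≤ᵇ⇒≤ 5 100 tt)) 100z≤n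

      a-bound : 2 * (a + 2 * z + 3) ≤ n + 1
      a-bound = linear {a = a * 2 + (n' + (4 * z + 5))} {b = n' + n} 0 (+-mono-≤ (m/n*n≤m n' 2) (≤-reflexive (m∸n+n≡m 4z+5≤n))) (lem a z n n')
        where
        n' : ℕ
        n' = n ∸ (4 * z + 5)
        lem : ∀ a z n n' → 2 * (a + 2 * z + 3) + (n' + n) + 0 ≡ n + 1 + (a * 2 + (n' + (4 * z + 5)))
        lem = solve-∀

      a-large : n ≤ 2 * a + 4 * z + 6
      a-large = linear {a = suc n' + n} {b = 2 * (a + 1) + (n' + (4 * z + 5))} 0 (+-mono-≤ (floor-upper n' 2) (≤-reflexive (sym (m∸n+n≡m 4z+5≤n)))) (lem a z n n')
        where
        n' : ℕ
        n' = n ∸ (4 * z + 5)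
        lem : ∀ a z n n' → n + (2 * (a + 1) + (n' + (4 * z + 5))) + 0 ≡ 2 * a + 4 * z + 6 + (1 + n' + n)
        lem = solve-∀

      bz' : b * z ≤ n
      bz' = ≤-trans (*-monoʳ-≤ b (≤-trans (m≤n*m z 17) (m≤m+n (17 * z) 4))) smallCut

      bz'' : b * (16 * z + 6) ≤ 14 * n
      bz'' = linear {a = b * (17 * z + 4) + b * 10} {b = n + b * z} (8 * b + 13 * n) (+-mono-≤ smallCut b≤bz) (lem b z n)
        where
        lem : ∀ b z n → b * (16 * z + 6) + (n + b * z) + (8 * b + 13 * n) ≡ 14 * n + (b * (17 * z + 4) + b * 10)
        lem = solve-∀

      sparsePair : ∀ {x} → g₂ * x < n * n → x ≤ z * z
      sparsePair {x} lt = *-cancelˡ-≤ g₂ ⦃ m*n≢0 (4 * H) H ⦃ m*n≢0 4 H ⦄ ⦄ (≤-trans (<⇒≤ lt) (≤-trans (*-mono-≤ n≤2Hz n≤2Hz) (≤-reflexive (lem H z))))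
        where
        lem : ∀ H z → 2 * H * z * (2 * H * z) ≡ 4 * H * H * (z * z)
        lem = solve-∀

      spanningHalin : HasSpanningHalin G
      spanningHalin = go (Decide.expandingOrWitness G a g₂)
        where
        go : _ ⊎ _ → HasSpanningHalin G
        go (inj₁ expanding) = CaseTwo.caseTwo G h₂ g₂ a z (*-mono-≤ {1} {2} {1} {H} (s≤s z≤n) 1≤H) (*-mono-≤ {1} {4 * H} {1} {H} (*-mono-≤ {1} {4} {1} {H} (s≤s z≤n) 1≤H) 1≤H)
          degree a-bound expanding n≤2Hz (≤-trans (m≤m+n 3 7) 10≤z) T₂ (≤-trans (≤-reflexive (+-comm 1 (10 * g₂))) T₃) T₄ (evenOrOdd n)
        go (inj₂ (f , f' , af , af' , lt)) = CaseOne.caseOne G b h g y z 180≤h 500≤g 4≤b degree noCut smallCut 100z≤n 100y≤n n≤180y 1000z≤y 2≤y T₅ wide _ _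
          (BuildCores.buildCores G a b z degree noSparse a-large (≤-trans (m≤m+n 6 4) 10≤z) bz'' bz' f f' (sparsePair lt) af af')

  -- From rational to natural numbers

  length-tabulate≡cnt : ∀ {m n} (f : Fin n → Bool) (k : Fin m → Fin n) → Sub.∣ Vec.tabulate (f ∘ k) ∣ ≡ cnt f (L.tabulate k)
  length-tabulate≡cnt {zero} f k = refl
  length-tabulate≡cnt {suc m} f k with f (k Fin.zero)
  ... | true = cong suc (length-tabulate≡cnt f (k ∘ Fin.suc))
  ... | false = length-tabulate≡cnt f (k ∘ Fin.suc)

  toSubset : ∀ {n} → (Fin n → Bool) → Subset n
  toSubset = Vec.tabulate

  ∣toSubset∣ : ∀ {n} (f : Fin n → Bool) → Sub.∣ toSubset f ∣ ≡ cnt f (L.allFin n)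
  ∣toSubset∣ f = length-tabulate≡cnt f id

  ∈-toSubset⁻ : ∀ {n} (f : Fin n → Bool) {v} → v Sub.∈ toSubset f → T (f v)
  ∈-toSubset⁻ f {v} m = subst T (sym (trans (sym (lookup∘tabulate f v)) ([]=⇒lookup m))) tt

  ∈-toSubset⁺ : ∀ {n} (f : Fin n → Bool) {v} → T (f v) → v Sub.∈ toSubset f
  ∈-toSubset⁺ f {v} t = lookup⇒[]= v (toSubset f) (trans (lookup∘tabulate f v) (T⇒true t))
    where
    T⇒true : ∀ {b} → T b → b ≡ true
    T⇒true {true} _ = refl

  mapWalk : ∀ {n} {G : Graph n} {P Q : Fin n → Set} → (∀ {v} → P v → Q v) → ∀ {u v} → Walk G P u v → Walk G Q u v
  mapWalk h (here p) = here (h p)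
  mapWalk h (step p a w) = step (h p) a (mapWalk h w)

  ℕ→ℚᵘ : ∀ k → Q.toℚᵘ (ℕ→ℚ k) QU.≃ QU.mkℚᵘ (ℤ.+ k) 0
  ℕ→ℚᵘ k = QP.toℚᵘ-fromℚᵘ (QU.mkℚᵘ (ℤ.+ k) 0)

  ℕ→ℚ-+ : ∀ k l → ℕ→ℚ (k + l) ≡ ℕ→ℚ k Q.+ ℕ→ℚ l
  ℕ→ℚ-+ k l = QP.toℚᵘ-injective (QUP.≃-trans (ℕ→ℚᵘ (k + l)) (QUP.≃-trans (QU.*≡* (eq (ℤ.+ k) (ℤ.+ l)))
    (QUP.≃-trans (QUP.+-cong (QUP.≃-sym (ℕ→ℚᵘ k)) (QUP.≃-sym (ℕ→ℚᵘ l))) (QUP.≃-sym (QP.toℚᵘ-homo-+ (ℕ→ℚ k) (ℕ→ℚ l))))))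
    where
    eq : ∀ x y → (x ℤ.+ y) ℤ.* ℤ.1ℤ ≡ (x ℤ.* ℤ.1ℤ ℤ.+ y ℤ.* ℤ.1ℤ) ℤ.* ℤ.1ℤ
    eq = ℤRing.solve-∀

  ℕ→ℚ-* : ∀ k l → ℕ→ℚ (k * l) ≡ ℕ→ℚ k Q.* ℕ→ℚ l
  ℕ→ℚ-* k l = QP.toℚᵘ-injective (QUP.≃-trans (ℕ→ℚᵘ (k * l)) (QUP.≃-trans (QU.*≡* (cong (ℤ._* ℤ.1ℤ) (ℤP.pos-* k l)))
    (QUP.≃-trans (QUP.*-cong (QUP.≃-sym (ℕ→ℚᵘ k)) (QUP.≃-sym (ℕ→ℚᵘ l))) (QUP.≃-sym (QP.toℚᵘ-homo-* (ℕ→ℚ k) (ℕ→ℚ l))))))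

  ℕ→ℚ-mono : ∀ {k l} → k ≤ l → ℕ→ℚ k Q.≤ ℕ→ℚ l
  ℕ→ℚ-mono {k} {l} h = QP.toℚᵘ-cancel-≤ (QUP.≤-respˡ-≃ (QUP.≃-sym (ℕ→ℚᵘ k)) (QUP.≤-respʳ-≃ (QUP.≃-sym (ℕ→ℚᵘ l))
    (QU.*≤* (ℤP.*-monoʳ-≤-nonNeg (ℤ.+ 1) (ℤ.+≤+ h)))))

  ℕ→ℚ-nonNeg : ∀ k → Q.NonNegative (ℕ→ℚ k)
  ℕ→ℚ-nonNeg k = Q.nonNegative (ℕ→ℚ-mono {0} {k} z≤n)

  denominator-bound : ∀ β → Q.Positive β → Q.1ℚ Q.≤ ℕ→ℚ (Q.↧ₙ β) Q.* β
  denominator-bound β@(Q.mkℚ (ℤ.+ suc p) q _) _ = QP.toℚᵘ-cancel-≤ (QUP.≤-respʳ-≃ (QUP.≃-trans (QUP.*-congʳ {Q.toℚᵘ β} (QUP.≃-sym (ℕ→ℚᵘ (suc q)))) (QUP.≃-sym (QP.toℚᵘ-homo-* (ℕ→ℚ (suc q)) β)))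
    (QU.*≤* (ℤ.+≤+ (≤-trans (≤-reflexive (trans (+-identityʳ _) (cong suc (+-identityʳ q)))) (≤-trans (m≤m*n (suc q) (suc p)) (≤-reflexive (sym (*-identityʳ _))))))))

  module Scaled (β : ℚ) (β>0 : Q.Positive β) where

    q : ℕ
    q = Q.↧ₙ β

    instance
      β≥0 : Q.NonNegative β
      β≥0 = QP.pos⇒nonNeg β ⦃ β>0 ⦄

    scale : ∀ k → ℕ→ℚ k Q.≤ ℕ→ℚ (q * k) Q.* β
    scale k = QP.≤-trans (QP.≤-reflexive (sym (QP.*-identityʳ (ℕ→ℚ k)))) (QP.≤-trans (QP.*-monoˡ-≤-nonNeg (ℕ→ℚ k) ⦃ ℕ→ℚ-nonNeg k ⦄ (denominator-bound β β>0))
      (QP.≤-reflexive (trans (sym (QP.*-assoc (ℕ→ℚ k) (ℕ→ℚ q) β)) (cong (Q._* β) (trans (QP.*-comm (ℕ→ℚ k) (ℕ→ℚ q)) (sym (ℕ→ℚ-* q k)))))))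

    below-β : ∀ k n → q * k ≤ n → ℕ→ℚ k Q.≤ β Q.* ℕ→ℚ n
    below-β k n h = QP.≤-trans (scale k) (QP.≤-trans (QP.*-monoʳ-≤-nonNeg β (ℕ→ℚ-mono h)) (QP.≤-reflexive (QP.*-comm (ℕ→ℚ n) β)))

    below-5β : ∀ k n → q * k ≤ n → ℕ→ℚ k Q.≤ ℕ→ℚ 5 Q.* β Q.* ℕ→ℚ n
    below-5β k n h = QP.≤-trans (below-β k n h) (QP.≤-trans (QP.≤-reflexive (sym (QP.*-identityˡ (β Q.* ℕ→ℚ n))))
      (QP.≤-trans (QP.*-monoʳ-≤-nonNeg (β Q.* ℕ→ℚ n) ⦃ QP.nonNeg*nonNeg⇒nonNeg β (ℕ→ℚ n) ⦃ ℕ→ℚ-nonNeg n ⦄ ⦄ (ℕ→ℚ-mono {1} {5} (s≤s z≤n)))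
        (QP.≤-reflexive (sym (QP.*-assoc (ℕ→ℚ 5) β (ℕ→ℚ n))))))

    above-half : ∀ n v → 4 * q * n ≤ 8 * q * v + 14 * n → (½ Q.- ℕ→ℚ 7 Q.* β) Q.* ℕ→ℚ n Q.≤ ℕ→ℚ v
    above-half n v h = QP.≤-trans (QP.≤-reflexive (expand ½ (ℕ→ℚ 7) β (ℕ→ℚ n)))
        (QP.≤-trans (QP.+-monoˡ-≤ (Q.- (ℕ→ℚ 7 Q.* X)) (QP.*-cancelˡ-≤-pos (ℕ→ℚ (8 * q)) ⦃ QP.normalize-pos (8 * q) 1 ⦄ cleared)) (QP.≤-reflexive (cancel (ℕ→ℚ v) (ℕ→ℚ 7 Q.* X))))
      where
      X : ℚ
      X = β Q.* ℕ→ℚ n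
      expand : ∀ a s b n → (a Q.- s Q.* b) Q.* n ≡ a Q.* n Q.- s Q.* (b Q.* n)
      expand = QS.solve 4 (λ a s b n → (a QS.:- s QS.:* b) QS.:* n QS.:= a QS.:* n QS.:- s QS.:* (b QS.:* n)) refl
      cancel : ∀ v x → (v Q.+ x) Q.- x ≡ v
      cancel = QS.solve 2 (λ v x → (v QS.:+ x) QS.:- x QS.:= v) refl
      left : ℕ→ℚ (8 * q) Q.* (½ Q.* ℕ→ℚ n) ≡ ℕ→ℚ (4 * q * n)
      left = trans (sym (QP.*-assoc (ℕ→ℚ (8 * q)) ½ (ℕ→ℚ n))) (trans (cong (Q._* ℕ→ℚ n) (trans (cong (Q._* ½) (trans (cong ℕ→ℚ (double q)) (ℕ→ℚ-* (4 * q) 2)))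
          (trans (QP.*-assoc (ℕ→ℚ (4 * q)) (ℕ→ℚ 2) ½) (QP.*-identityʳ (ℕ→ℚ (4 * q)))))) (sym (ℕ→ℚ-* (4 * q) n)))
        where
        double : ∀ q → 8 * q ≡ 4 * q * 2
        double = solve-∀
      right : ℕ→ℚ (8 * q * v + 14 * n) Q.≤ ℕ→ℚ (8 * q) Q.* (ℕ→ℚ v Q.+ ℕ→ℚ 7 Q.* X)
      right = QP.≤-trans (QP.≤-reflexive (ℕ→ℚ-+ (8 * q * v) (14 * n))) (QP.≤-trans (QP.+-monoʳ-≤ (ℕ→ℚ (8 * q * v)) (QP.≤-trans (ℕ→ℚ-mono (*-monoˡ-≤ n {14} {56} (m≤m+n 14 42)))
          (QP.≤-trans (QP.≤-reflexive (ℕ→ℚ-* 56 n)) (QP.*-monoˡ-≤-nonNeg (ℕ→ℚ 56) ⦃ ℕ→ℚ-nonNeg 56 ⦄ (scale n)))))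
        (QP.≤-reflexive (sym (trans (QP.*-distribˡ-+ (ℕ→ℚ (8 * q)) (ℕ→ℚ v) (ℕ→ℚ 7 Q.* X)) (cong₂ Q._+_ (sym (ℕ→ℚ-* (8 * q) v)) seven)))))
        where
        regroup : ∀ e q s b n → (e Q.* q) Q.* (s Q.* (b Q.* n)) ≡ (e Q.* s) Q.* ((q Q.* n) Q.* b)
        regroup = QS.solve 5 (λ e q s b n → (e QS.:* q) QS.:* (s QS.:* (b QS.:* n)) QS.:= (e QS.:* s) QS.:* ((q QS.:* n) QS.:* b)) refl
        seven : ℕ→ℚ (8 * q) Q.* (ℕ→ℚ 7 Q.* X) ≡ ℕ→ℚ 56 Q.* (ℕ→ℚ (q * n) Q.* β)
        seven = trans (cong (Q._* (ℕ→ℚ 7 Q.* X)) (ℕ→ℚ-* 8 q)) (trans (regroup (ℕ→ℚ 8) (ℕ→ℚ q) (ℕ→ℚ 7) β (ℕ→ℚ n))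
          (cong₂ (λ a b → a Q.* (b Q.* β)) (sym (ℕ→ℚ-* 8 7)) (sym (ℕ→ℚ-* q n))))
      cleared : ℕ→ℚ (8 * q) Q.* (½ Q.* ℕ→ℚ n) Q.≤ ℕ→ℚ (8 * q) Q.* (ℕ→ℚ v Q.+ ℕ→ℚ 7 Q.* X)
      cleared = QP.≤-trans (QP.≤-reflexive left) (QP.≤-trans (ℕ→ℚ-mono h) right)

    b : ℕ
    b = 4 * q

    q≤b : ∀ k n → b * k ≤ n → q * k ≤ n
    q≤b k n h = ≤-trans (*-monoˡ-≤ k (m≤n*m q 4)) h

    open Combine b 180 500 12000 ≤-refl (*-monoʳ-≤ 4 {1} {q} (s≤s z≤n)) ≤-refl ≤-refl public using (n₀)

    spanningHalin : ∀ n → n₀ ≤ n → (G : Graph n) → (∀ v → n + 1 ≤ 2 * deg G v) → NoSmallCut β G → NoSparsePart β G → HasSpanningHalin G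
    spanningHalin n large G degree noCut noSparse = Combine.spanningHalin b 180 500 12000 ≤-refl (*-monoʳ-≤ 4 {1} {q} (s≤s z≤n)) ≤-refl ≤-refl large G
      (λ v → subst (λ k → n + 1 ≤ 2 * k) (cnt≡countTrue (adj G v) (L.allFin n)) (degree v)) noCut' noSparse'
      where
      noCut' : ∀ (f : Fin n → Bool) → b * cnt f (L.allFin n) ≤ n → ¬ (∃ λ u → ∃ λ v → ¬ T (f u) × ¬ T (f v) × ¬ Walk G (λ x → ¬ T (f x)) u v)
      noCut' f h (u , v , fu , fv , nw) = noCut (toSubset f , below-5β Sub.∣ toSubset f ∣ n (subst (λ k → q * k ≤ n) (sym (∣toSubset∣ f)) (q≤b _ n h)) ,
        u , v , fu ∘ ∈-toSubset⁻ f , fv ∘ ∈-toSubset⁻ f , nw ∘ mapWalk (λ ne t → ne (∈-toSubset⁺ f t)))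
      noSparse' : ∀ (f : Fin n → Bool) → n * b ≤ 2 * b * cnt f (L.allFin n) + 14 * n →
        ¬ (∀ {v} → T (f v) → b * cnt (λ u → adj G v u ∧ f u) (L.allFin n) ≤ n)
      noSparse' f h hd = noSparse (toSubset f , above-half n Sub.∣ toSubset f ∣ (subst (λ k → 4 * q * n ≤ 8 * q * k + 14 * n) (sym (∣toSubset∣ f))
          (≤-trans (≤-reflexive (*-comm b n)) (≤-trans h (≤-reflexive (cong (_+ 14 * n) (lem q (cnt f (L.allFin n)))))))) ,
        λ v m → below-β _ n (≤-trans (≤-reflexive (cong (q *_) (degIn≡ v))) (q≤b _ n (hd (∈-toSubset⁻ f m)))))
        where
        lem : ∀ q c → 2 * (4 * q) * c ≡ 8 * q * c
        lem = solve-∀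
        degIn≡ : ∀ v → degIn G (toSubset f) v ≡ cnt (λ u → adj G v u ∧ f u) (L.allFin n)
        degIn≡ v = trans (cnt≡countTrue _ (L.allFin n)) (∑-cong (L.allFin n) (λ u → cong (λ x → b2n (adj G v u ∧ x)) (lookup∘tabulate f u)))

open import Defs
open import Data.Nat using (ℕ; _+_; _*_; _≤_)
open import Data.Rational using (ℚ; 0ℚ; _<_)
import Data.Rational as Q
open import Data.Product using (Σ; _×_; _,_)
open import Data.Rational.Properties using (positive⁻¹)

theorem3p3 : Σ ℚ λ β₀ → 0ℚ < β₀ ×
    (∀ (β : ℚ) → 0ℚ < β → β Q.≤ β₀ →
    Σ ℕ λ n₀ → ∀ (n : ℕ) → n₀ ≤ n → (G : Graph n) →
    (∀ v → n + 1 ≤ 2 * deg G v) →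
    NoSmallCut β G →
    NoSparsePart β G →
    HasSpanningHalin G)
theorem3p3 = Q.1ℚ , positive⁻¹ Q.1ℚ , λ β 0<β _ → let open SpanningHalin.Scaled β (Q.positive 0<β) in n₀ , spanningHalin
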